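{- The decision problem WeaklyColorAvoidingConnectedComponent is in P. More precisely, given a graph $G$, a color set $C=\{c_1,\ldots,c_k\}$ and a function $c: V(G)\to C$, the weakly color-avoiding connected components of $G$ can be found in polynomial time.
   Context: Let $G$ be a graph, $C=\{c_1,\ldots,c_k\}$ a color set and $c: V(G)\to C$ a function that assigns colors to the vertices. Suppose first that $G$ is connected. For $i\in\{1,\ldots,k\}$, vertices $u,v\in V(G)$ are called weakly $c_i$-avoiding connected if after the removal of the vertices of color $c_i$, either at least one of $u$ or $v$ is deleted or they are in the same component of the remaining graph; i.e. if neither $u$ nor $v$ is of color $c_i$, then there exists a path between them none of whose vertices is of color $c_i$. Vertices $u,v$ are weakly color-avoiding connected if they are weakly $c_i$-avoiding connected for all $i\in\{1,\ldots,k\}$. The definition is extended to non-connected graphs $G$ with the extra condition that two vertices can be weakly color-avoiding connected only if they are in the same component of the original graph $G$. This relation is in general not transitive. The weakly color-avoiding connected components of $G$ are the (inclusion-)maximal sets of vertices such that any two of them are weakly color-avoiding connected. Decision problem WeaklyColorAvoidingConnectedComponent. Instance: a graph $G$, a color set $C=\{c_1,\ldots,c_k\}$, a function $c: V(G)\to C$ and a positive integer $l$. Question: is it true that $G$ has a weakly color-avoiding connected component of size (number of vertices) at least $l$? Polynomial time means polynomial in the size of the input. -}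

module Defs where

open import Data.Bool.Base using (Bool; true; false; T)
open import Data.Fin.Base using (Fin; toℕ)
open import Data.Fin.Subset using (Subset; _∈_; _⊆_; ∣_∣)
open import Data.List.Base as List using (List; []; _∷_; [_]; _++_; length; foldr; concatMap; replicate)
import Data.List.Membership.Propositional as List∈
open import Data.List.Relation.Unary.Unique.Propositional using (Unique)
open import Data.Maybe.Base using (Maybe; just; nothing)
open import Data.Nat.Base using (ℕ; zero; suc; _+_; _*_; _≤_; _<_)
open import Data.Nat.Binary.Base as Bin using (ℕᵇ; 2[1+_]; 1+[2_])
open import Data.Product.Base using (Σ; ∃-syntax; _×_; _,_)
open import Data.Sum.Base using (_⊎_)
open import Data.Vec.Base as Vec using (Vec; _∷_)
open import Function.Bundles using (_⇔_; _↔_)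
open import Relation.Binary.Construct.Closure.ReflexiveTransitive using (Star)
open import Relation.Binary.PropositionalEquality.Core using (_≡_; _≢_)

------------------------------------------------------------------------
-- Deterministic multi-tape Turing machines

-- Inputs and outputs are strings over {0, 1, #}.
data Letter : Set where
  bit : Bool → Letter
  #   : Letter

-- The tape alphabet may contain g further symbols.
data Symbol (g : ℕ) : Set where
  blank  : Symbol g
  letter : Letter → Symbol g
  extra  : Fin g → Symbol g

data Move : Set where
  left stay right : Move

-- A two-way infinite tape.  Both lists start next to the head; the cells
-- beyond them are blank.
record Tape (g : ℕ) : Set where
  constructor tape
  field
    before : List (Symbol g)
    head   : Symbol g
    after  : List (Symbol g)

move : ∀ {g} → Move → Tape g → Tape g
move left  (tape []       h rs)       = tape [] blank (h ∷ rs)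
move left  (tape (l ∷ ls) h rs)       = tape ls l (h ∷ rs)
move stay  t                          = t
move right (tape ls       h [])       = tape (h ∷ ls) blank []
move right (tape ls       h (r ∷ rs)) = tape (h ∷ ls) r rs

writeAndMove : ∀ {g} → Tape g → Symbol g × Move → Tape g
writeAndMove (tape ls _ rs) (s , m) = move m (tape ls s rs)

inputTape : ∀ {g} → List Letter → Tape g
inputTape []      = tape [] blank []
inputTape (a ∷ w) = tape [] (letter a) (List.map letter w)

letterPrefix : ∀ {g} → List (Symbol g) → List Letter
letterPrefix (letter a ∷ ss) = a ∷ letterPrefix ss
letterPrefix _               = []

-- The longest string of letters starting at the head.
tapeOutput : ∀ {g} → Tape g → List Letter
tapeOutput (tape _ h rs) = letterPrefix (h ∷ rs)

record Machine : Set₁ where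
  field
    State     : Set
    numStates : ℕ
    finite    : State ↔ Fin numStates
    numExtra  : ℕ
    numWork   : ℕ
    start     : State
    accepting : State → Bool
    -- nothing: the machine halts.
    transition : State → Vec (Symbol numExtra) (suc numWork) →
                 Maybe (State × Vec (Symbol numExtra × Move) (suc numWork))

  Config : Set
  Config = State × Vec (Tape numExtra) (suc numWork)

  initial : List Letter → Config
  initial w = start , inputTape w ∷ Vec.replicate numWork (tape [] blank [])

  step : Config → Maybe Config
  step (q , ts) with transition q (Vec.map Tape.head ts)
  ... | nothing        = nothing
  ... | just (q′ , as) = just (q′ , Vec.zipWith writeAndMove ts as)

  -- run t c ≡ just c′ iff the computation from c halts in c′ after at
  -- most t steps.
  run : ℕ → Config → Maybe Config
  run t c with step c
  run t       c | nothing = just c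
  run zero    c | just _  = nothing
  run (suc t) c | just c′ = run t c′

  Accepts : Config → Set
  Accepts (q , _) = T (accepting q)

  output : Config → List Letter
  output (_ , ts) = tapeOutput (Vec.head ts)

------------------------------------------------------------------------
-- Polynomial time

-- Coefficients, constant term first.
Polynomial : Set
Polynomial = List ℕ

eval : Polynomial → ℕ → ℕ
eval p x = foldr (λ a r → a + x * r) 0 p

InP : (List Letter → Set) → Set₁
InP L = Σ Machine λ M → let open Machine M in
  Σ Polynomial λ p →
  ∀ w → ∃[ c ] (run (eval p (length w)) (initial w) ≡ just c × (Accepts c ⇔ L w))

-- The language of encodings of yes-instances: an accepting machine must
-- also reject every string that encodes no instance.
languageOf : {I : Set} → (I → List Letter) → (I → Set) → List Letter → Set
languageOf encode Yes w = ∃[ x ] (encode x ≡ w × Yes x)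

-- On every instance x, a string that solves x is computed.
ComputableInPolynomialTime :
  {I : Set} → (I → List Letter) → (I → List Letter → Set) → Set₁
ComputableInPolynomialTime encode Solves = Σ Machine λ M → let open Machine M in
  Σ Polynomial λ p →
  ∀ x → ∃[ c ] (run (eval p (length (encode x))) (initial (encode x)) ≡ just c
                × Solves x (output c))

------------------------------------------------------------------------
-- Vertex-colored graphs and weak color-avoiding connectivity

record Graph : Set where
  field
    order       : ℕ
    adjacent    : Fin order → Fin order → Bool
    symmetric   : ∀ u v → adjacent u v ≡ adjacent v u
    irreflexive : ∀ v → adjacent v v ≡ false

  Vertex : Set
  Vertex = Fin order

  Adj : Vertex → Vertex → Set
  Adj u v = T (adjacent u v)

record ColoredGraph : Set where
  field
    graph      : Graph
    numColors : ℕ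

  open Graph graph public

  field
    color : Vertex → Fin numColors

  SameComponent : Vertex → Vertex → Set
  SameComponent = Star Adj

  AdjAvoiding : Fin numColors → Vertex → Vertex → Set
  AdjAvoiding i u v = color u ≢ i × color v ≢ i × Adj u v

  -- The empty walk at a deleted vertex is harmless: the relation is only
  -- used as an alternative to one of the end vertices being deleted.
  SameComponentAvoiding : Fin numColors → Vertex → Vertex → Set
  SameComponentAvoiding i = Star (AdjAvoiding i)

  WeaklyAvoidingConnected : Fin numColors → Vertex → Vertex → Set
  WeaklyAvoidingConnected i u v =
    (color u ≡ i ⊎ color v ≡ i) ⊎ SameComponentAvoiding i u v

  WeaklyColorAvoidingConnected : Vertex → Vertex → Set
  WeaklyColorAvoidingConnected u v =
    SameComponent u v × (∀ i → WeaklyAvoidingConnected i u v)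

  PairwiseConnected : Subset order → Set
  PairwiseConnected S =
    ∀ u v → u ∈ S → v ∈ S → WeaklyColorAvoidingConnected u v

  IsComponent : Subset order → Set
  IsComponent S =
    PairwiseConnected S × (∀ S′ → PairwiseConnected S′ → S ⊆ S′ → S′ ≡ S)

------------------------------------------------------------------------
-- Encodings

unary : ℕ → List Letter
unary m = replicate m (bit true)

-- Bijective base 2, least significant digit first: the digits 1 and 2 are
-- written as the bits 0 and 1.
bijectiveBinary : ℕᵇ → List Letter
bijectiveBinary Bin.zero = []
bijectiveBinary 1+[2 b ] = bit false ∷ bijectiveBinary b
bijectiveBinary 2[1+ b ] = bit true ∷ bijectiveBinary b

binary : ℕ → List Letter
binary m = bijectiveBinary (Bin.fromℕ m)

-- The number of colors, then for each vertex its color and its row of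
-- the adjacency matrix.  Unary is adequate for colors, as the color set
-- is listed in the input.
encodeColoredGraph : ColoredGraph → List Letter
encodeColoredGraph G =
  unary numColors ++ # ∷ concatMap vertexCode (List.allFin order)
  where
  open ColoredGraph G
  vertexCode : Vertex → List Letter
  vertexCode v =
    unary (toℕ (color v)) ++ # ∷ List.tabulate (λ u → bit (adjacent v u)) ++ [ # ]

-- The characteristic vectors, each followed by #.
encodeSubsets : ∀ {n} → List (Subset n) → List Letter
encodeSubsets = concatMap λ S → List.map bit (Vec.toList S) ++ [ # ]

------------------------------------------------------------------------
-- The two problems

record Instance : Set where
  field
    coloredGraph : ColoredGraph
    l             : ℕ
    l-positive    : 0 < l

  open ColoredGraph coloredGraph public

encodeInstance : Instance → List Letter
encodeInstance x = binary l ++ # ∷ encodeColoredGraph coloredGraph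
  where open Instance x

HasLargeComponent : Instance → Set
HasLargeComponent x = ∃[ S ] (IsComponent S × l ≤ ∣ S ∣)
  where open Instance x

WeaklyColorAvoidingConnectedComponent : List Letter → Set
WeaklyColorAvoidingConnectedComponent = languageOf encodeInstance HasLargeComponent

-- All components are listed, each exactly once and in any order.
ListsComponents : ColoredGraph → List Letter → Set
ListsComponents G w =
  ∃[ Ss ] (w ≡ encodeSubsets Ss × Unique Ss × (∀ S → S List∈.∈ Ss ⇔ IsComponent S))
  where open ColoredGraph G

-- Two vertices that are weakly color-avoiding connected (∼) to both u and v are
-- connected to each other if u and v have different colors, since every color is
-- avoided by u or by v and walks can be joined there.  The same holds for the
-- ∼-neighbors of a single vertex if they all have its color.  Hence the components
-- are the sets of common ∼-neighbors of such pairs u ∼ v, or u = v, and there are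
-- at most n² of them.
--
-- Polynomial time is obtained from a first-order language whose only loops run
-- over the positions of the input: the running time of a compiled program is
-- bounded by a polynomial that depends on its syntax alone.

module Submission where

open import Defs
open import Data.Bool.Base using (Bool; true; false; T; not; _∧_; _∨_; if_then_else_)
open import Data.Bool.ListAction using (any)
open import Data.Bool.Properties as Bool using (not-involutive; ∨-conicalˡ; ∨-conicalʳ; T-∧; T-≡; T?)
open import Data.Empty using (⊥)
open import Data.Fin.Base as Fin using (Fin; zero; suc; toℕ; fromℕ<; _↑ˡ_; _↑ʳ_; splitAt)
open import Data.Fin.Patterns
import Data.Fin.Properties as Fin
open import Data.Fin.Subset using (Subset; ∣_∣; ⁅_⁆) renaming (_∈_ to _∈ˢ_)
open import Data.Fin.Subset.Properties using (⊆-antisym; x∈⁅x⁆; x∈⁅y⁆⇒x≡y; _∈?_; nonempty?)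
open import Data.List.Base as List
  using (List; []; _∷_; [_]; _++_; _ʳ++_; length; drop; take; replicate; map; concatMap)
open import Data.List.Membership.Propositional using (_∈_)
open import Data.List.Membership.Propositional.Properties using (∈-++⁺ˡ; ∈-++⁺ʳ; ∈-++⁻)
import Data.List.Properties as List
open import Data.List.Relation.Unary.All as All using (All; []; _∷_)
import Data.List.Relation.Unary.All.Properties as All
open import Data.List.Relation.Unary.AllPairs using (AllPairs; []; _∷_)
import Data.List.Relation.Unary.AllPairs.Properties as AllPairs
open import Data.List.Relation.Unary.Any using (here; there)
open import Data.List.Relation.Unary.Unique.Propositional using (Unique)
open import Data.Maybe.Base as Maybe using (Maybe; just; nothing; maybe)
open import Data.Maybe.Properties using (just-injective)
open import Data.Nat.Base
open import Data.Nat.Binary.Base as Bin using (ℕᵇ; 2[1+_]; 1+[2_])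
import Data.Nat.Binary.Properties as Bin
open import Data.Nat.ListAction using (sum)
open import Data.Nat.Properties
open import Data.Product.Base as Product using (∃; ∃₂; ∃-syntax; _×_; _,_; proj₁; proj₂)
open import Data.Product.Function.NonDependent.Propositional using (_×-⇔_)
open import Data.Sum.Base as Sum using (_⊎_; inj₁; inj₂)
open import Data.Sum.Function.Propositional using (_⊎-⇔_; _⊎-↔_)
open import Data.Unit.Base using (⊤; tt)
open import Data.Vec.Base as Vec using (Vec; []; _∷_; lookup; zipWith; _[_]≔_)
import Data.Vec.Properties as Vec
open import Function.Base using (_∘_; id; case_of_)
open import Function.Bundles using (_⇔_; _↔_; mk⇔; mk↔ₛ′; Equivalence)
open import Function.Properties.Equivalence using () renaming (refl to ⇔-refl; sym to ⇔-sym; trans to ⇔-trans)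
open import Function.Properties.Inverse using (↔-sym; ↔-trans)
open import Relation.Binary.Construct.Closure.ReflexiveTransitive using (Star; ε; _◅_; _◅◅_; gmap; reverse)
open import Relation.Binary.Definitions using (tri<; tri≈; tri>)
open import Relation.Binary.PropositionalEquality hiding (J; [_])
open import Relation.Nullary using (¬_; Dec; yes; no; does; contradiction)
open import Relation.Nullary.Decidable using (map′; ¬?; _×-dec_; _⊎-dec_; decidable-stable; dec-true; dec-false)
open import Relation.Nullary.Reflects
  using (Reflects; ofʸ; ofⁿ; T-reflects; ¬-reflects; _×-reflects_; _⊎-reflects_)

-- Turing machines as stack machines

-- The obstacle is that polynomial time is a statement about concrete Turing machines, while both
-- algorithms need deeply nested loops. One generic compiler is therefore verified together with its
-- time bound, and only Boolean functions on numbers remain to be reasoned about. All variables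
-- share one range, the numbers up to the input length; vertices, colors and row numbers fit into it
-- because colors are written in unary. The size bound l does not: it is written in binary and may
-- be exponentially large. The size of a component is therefore counted by a digit counter kept in
-- tables, which is compared with l digit by digit. A decider must also reject every word that
-- encodes no instance. Hence reading makes sense of any word as a list of rows, and validity is one
-- more formula about these rows, evaluated before anything else. Distinct pairs may generate the
-- same component. This is harmless for the decision, but the listing has to single out one pair for
-- each component.

asLetter : Symbol 0 → Maybe Letter
asLetter (letter a) = just a
asLetter _          = nothing

nonempty : Maybe Letter → Bool
nonempty = Maybe.is-just

Action : Set
Action = Symbol 0 × Move

tapeOutput-push : ∀ (t : Tape 0) {a} →
  tapeOutput (writeAndMove (writeAndMove t (Tape.head t , left)) (letter a , stay)) ≡ a ∷ tapeOutput t
tapeOutput-push (tape []       h rs) = refl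
tapeOutput-push (tape (l ∷ ls) h rs) = refl

tapeOutput-pop : ∀ (t : Tape 0) {a xs} → tapeOutput t ≡ a ∷ xs →
  tapeOutput (writeAndMove t (Tape.head t , right)) ≡ xs
tapeOutput-pop (tape ls (letter _) [])       eq = List.∷-injectiveʳ eq
tapeOutput-pop (tape ls (letter _) (r ∷ rs)) eq = List.∷-injectiveʳ eq

-- Every tape is used as a stack whose content, top first, is tapeOutput: a
-- push moves left and writes, a pop moves right.  The cells before the head are
-- overwritten before they are read, so they need no invariant.
module StackMachine {Ix : Set} {m : ℕ} (code : Ix → Fin (suc m))
  (code-injective : ∀ {i j} → code i ≡ code j → i ≡ j) where

  Tapes : Set
  Tapes = Vec (Tape 0) (suc m)

  infix 25 _‼_

  opaque
    _‼_ : Tapes → Ix → List Letter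
    ts ‼ i = tapeOutput (lookup ts (code i))

    ‼-def : ∀ ts i → ts ‼ i ≡ tapeOutput (lookup ts (code i))
    ‼-def ts i = refl

  infixr 5 _⨾_

  data Cmd : Set where
    skip  : Cmd
    push  : Ix → Letter → Cmd
    pop   : Ix → Cmd
    _⨾_   : Cmd → Cmd → Cmd
    cond  : (Maybe Letter → Bool) → Ix → Cmd → Cmd → Cmd
    while : Ix → Cmd → Cmd

  -- A control state is a position in the program text. A push takes two machine steps and so has
  -- two states; tests and loops have one state of their own, in which the stack is inspected.
  Control : Cmd → Set
  Control skip           = ⊤
  Control (push _ _)     = Bool
  Control (pop _)        = ⊤
  Control (C ⨾ D)        = Control C ⊎ Control D
  Control (cond _ _ C D) = ⊤ ⊎ (Control C ⊎ Control D)
  Control (while _ C)    = ⊤ ⊎ Control C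

  entry : ∀ C → Control C
  entry skip           = tt
  entry (push _ _)     = false
  entry (pop _)        = tt
  entry (C ⨾ D)        = inj₁ (entry C)
  entry (cond _ _ C D) = inj₁ tt
  entry (while _ C)    = inj₁ tt

  size : Cmd → ℕ
  size skip           = 1
  size (push _ _)     = 2
  size (pop _)        = 1
  size (C ⨾ D)        = size C + size D
  size (cond _ _ C D) = 1 + (size C + size D)
  size (while _ C)    = 1 + size C

  ⊎↔Fin : ∀ {A B : Set} {a b} → A ↔ Fin a → B ↔ Fin b → (A ⊎ B) ↔ Fin (a + b)
  ⊎↔Fin f g = ↔-trans (f ⊎-↔ g) (↔-sym Fin.+↔⊎)

  control↔Fin : ∀ C → Control C ↔ Fin (size C)
  control↔Fin skip           = ↔-sym Fin.1↔⊤
  control↔Fin (push _ _)     = ↔-sym Fin.2↔Bool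
  control↔Fin (pop _)        = ↔-sym Fin.1↔⊤
  control↔Fin (C ⨾ D)        = ⊎↔Fin (control↔Fin C) (control↔Fin D)
  control↔Fin (cond _ _ C D) =
    ⊎↔Fin (↔-sym Fin.1↔⊤) (⊎↔Fin (control↔Fin C) (control↔Fin D))
  control↔Fin (while _ C)    = ⊎↔Fin (↔-sym Fin.1↔⊤) (control↔Fin C)

  Symbols Actions : Set
  Symbols = Vec (Symbol 0) (suc m)
  Actions = Vec Action (suc m)

  idle : Symbols → Actions
  idle = Vec.map (_, stay)

  -- The control state nothing is the exit.
  δ : ∀ C → Control C → Symbols → Maybe (Control C) × Actions
  δ skip           _               hs = nothing , idle hs
  δ (push i a)     false           hs = just true , idle hs [ code i ]≔ (lookup hs (code i) , left)
  δ (push i a)     true            hs = nothing , idle hs [ code i ]≔ (letter a , stay)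
  δ (pop i)        _               hs = nothing , idle hs [ code i ]≔ (lookup hs (code i) , right)
  -- The exit of `C` is redirected to the entry of `D` within the same step, so sequencing costs no
  -- time. The body of a loop is redirected to the test in the same way.
  δ (C ⨾ D)        (inj₁ q)        hs =
    Product.map₁ (λ r → just (maybe inj₁ (inj₂ (entry D)) r)) (δ C q hs)
  δ (C ⨾ D)        (inj₂ q)        hs = Product.map₁ (Maybe.map inj₂) (δ D q hs)
  δ (cond t i C D) (inj₁ _)        hs =
    just (inj₂ (if t (asLetter (lookup hs (code i))) then inj₁ (entry C) else inj₂ (entry D))) ,
    idle hs
  δ (cond t i C D) (inj₂ (inj₁ q)) hs = Product.map₁ (Maybe.map (inj₂ ∘ inj₁)) (δ C q hs)
  δ (cond t i C D) (inj₂ (inj₂ q)) hs = Product.map₁ (Maybe.map (inj₂ ∘ inj₂)) (δ D q hs)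
  δ (while i C)    (inj₁ _)        hs =
    (if nonempty (asLetter (lookup hs (code i))) then just (inj₂ (entry C)) else nothing) , idle hs
  δ (while i C)    (inj₂ q)        hs =
    Product.map₁ (λ r → just (maybe inj₂ (inj₁ tt) r)) (δ C q hs)

  next : Tapes → Actions → Tapes
  next = zipWith writeAndMove

  heads : Tapes → Symbols
  heads = Vec.map Tape.head

  -- The last index is an upper bound on the number of steps, not their exact number: `exit` allows
  -- every positive index, which makes traces monotone in time.
  data Trace (C : Cmd) : Control C → Tapes → Tapes → ℕ → Set where
    exit : ∀ {q ts as t} → δ C q (heads ts) ≡ (nothing , as) →
           Trace C q ts (next ts as) (suc t)
    goto : ∀ {q q′ ts ts′ as t} → δ C q (heads ts) ≡ (just q′ , as) →
           Trace C q′ (next ts as) ts′ t → Trace C q ts ts′ (suc t)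

  Trace-mono : ∀ {C q ts ts′ t t′} → t ≤ t′ → Trace C q ts ts′ t → Trace C q ts ts′ t′
  Trace-mono (s≤s t≤t′) (exit eq)    = exit eq
  Trace-mono (s≤s t≤t′) (goto eq tr) = goto eq (Trace-mono t≤t′ tr)

  Trace-⨾ʳ : ∀ {C D q ts ts′ t} → Trace D q ts ts′ t → Trace (C ⨾ D) (inj₂ q) ts ts′ t
  Trace-⨾ʳ (exit eq)    = exit (cong (Product.map₁ (Maybe.map inj₂)) eq)
  Trace-⨾ʳ (goto eq tr) = goto (cong (Product.map₁ (Maybe.map inj₂)) eq) (Trace-⨾ʳ tr)

  Trace-⨾ : ∀ {C D q ts ts′ ts″ t t′} → Trace C q ts ts′ t → Trace D (entry D) ts′ ts″ t′ →
            Trace (C ⨾ D) (inj₁ q) ts ts″ (t + t′)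
  Trace-⨾ {t = suc t} (exit eq) tr′ =
    goto (cong (Product.map₁ (λ r → just (maybe inj₁ (inj₂ (entry _)) r))) eq) (Trace-mono (m≤n+m _ t) (Trace-⨾ʳ tr′))
  Trace-⨾ (goto eq tr) tr′ =
      goto (cong (Product.map₁ (λ r → just (maybe inj₁ (inj₂ (entry _)) r))) eq) (Trace-⨾ tr tr′)

  Trace-condˡ : ∀ {t i C D q ts ts′ n} → Trace C q ts ts′ n →
                Trace (cond t i C D) (inj₂ (inj₁ q)) ts ts′ n
  Trace-condˡ (exit eq)    = exit (cong (Product.map₁ (Maybe.map (inj₂ ∘ inj₁))) eq)
  Trace-condˡ (goto eq tr) = goto (cong (Product.map₁ (Maybe.map (inj₂ ∘ inj₁))) eq) (Trace-condˡ tr)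

  Trace-condʳ : ∀ {t i C D q ts ts′ n} → Trace D q ts ts′ n →
                Trace (cond t i C D) (inj₂ (inj₂ q)) ts ts′ n
  Trace-condʳ (exit eq)    = exit (cong (Product.map₁ (Maybe.map (inj₂ ∘ inj₂))) eq)
  Trace-condʳ (goto eq tr) = goto (cong (Product.map₁ (Maybe.map (inj₂ ∘ inj₂))) eq) (Trace-condʳ tr)

  Trace-while : ∀ {i C q ts ts′ ts″ t t′} → Trace C q ts ts′ t →
                Trace (while i C) (inj₁ tt) ts′ ts″ t′ →
                Trace (while i C) (inj₂ q) ts ts″ (t + t′)
  Trace-while {t = suc t} (exit eq) tr′ =
    goto (cong (Product.map₁ (λ r → just (maybe inj₂ (inj₁ tt) r))) eq) (Trace-mono (m≤n+m _ t) tr′)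
  Trace-while (goto eq tr) tr′ =
      goto (cong (Product.map₁ (λ r → just (maybe inj₂ (inj₁ tt) r))) eq) (Trace-while tr tr′)

  lookup-next : ∀ ts as k → lookup (next ts as) k ≡ writeAndMove (lookup ts k) (lookup as k)
  lookup-next ts as k = Vec.lookup-zipWith writeAndMove k ts as

  next-idle : ∀ ts → next ts (idle (heads ts)) ≡ ts
  next-idle ts = go ts
    where
    go : ∀ {n} (ts : Vec (Tape 0) n) → zipWith writeAndMove ts (Vec.map (_, stay) (Vec.map Tape.head ts)) ≡ ts
    go []       = refl
    go (t ∷ ts) = cong (t ∷_) (go ts)

  lookup-next-update : ∀ ts k a →
    lookup (next ts (idle (heads ts) [ k ]≔ a)) k ≡ writeAndMove (lookup ts k) a
  lookup-next-update ts k a = trans (lookup-next ts _ k)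
    (cong (writeAndMove (lookup ts k)) (Vec.lookup∘updateAt k (idle (heads ts))))

  lookup-next-other : ∀ ts {k l} a → l ≢ k → lookup (next ts (idle (heads ts) [ k ]≔ a)) l ≡ lookup ts l
  lookup-next-other ts {k} {l} a l≢k = begin
    lookup (next ts (idle (heads ts) [ k ]≔ a)) l
      ≡⟨ lookup-next ts _ l ⟩
    writeAndMove (lookup ts l) (lookup (idle (heads ts) [ k ]≔ a) l)
      ≡⟨ cong (writeAndMove (lookup ts l)) (Vec.lookup∘updateAt′ l k l≢k (idle (heads ts))) ⟩
    writeAndMove (lookup ts l) (lookup (idle (heads ts)) l)
      ≡⟨ lookup-next ts _ l ⟨
    lookup (next ts (idle (heads ts))) l
      ≡⟨ cong (λ us → lookup us l) (next-idle ts) ⟩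
    lookup ts l ∎
    where open ≡-Reasoning

  top : Tapes → Ix → Maybe Letter
  top ts i = List.head (ts ‼ i)

  opaque
    unfolding _‼_

    asLetter-heads : ∀ ts i → asLetter (lookup (heads ts) (code i)) ≡ top ts i
    asLetter-heads ts i rewrite Vec.lookup-map (code i) Tape.head ts with lookup ts (code i)
    ... | tape _ blank      _ = refl
    ... | tape _ (letter a) _ = refl

  record Update (ts : Tapes) (i : Ix) (xs : List Letter) (ts′ : Tapes) : Set where
    constructor update
    field
      this  : ts′ ‼ i ≡ xs
      other : ∀ {j} → j ≢ i → ts′ ‼ j ≡ ts ‼ j

  open Update public

  -- A Hoare triple for total correctness with a time bound, taken at a fixed starting
  -- configuration.
  Run : Cmd → Tapes → (Tapes → Set) → ℕ → Set
  Run C ts Q t = ∃[ ts′ ] (Q ts′ × Trace C (entry C) ts ts′ t)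

  run-mono : ∀ {C ts} {P Q : Tapes → Set} {t t′} → t ≤ t′ → (∀ {ts′} → P ts′ → Q ts′) →
             Run C ts P t → Run C ts Q t′
  run-mono t≤t′ P⊆Q (ts′ , p , tr) = ts′ , P⊆Q p , Trace-mono t≤t′ tr

  run-skip : ∀ {ts} {Q : Tapes → Set} → Q ts → Run skip ts Q 1
  run-skip {ts} {Q} q = _ , subst Q (sym (next-idle ts)) q , exit refl

  run-⨾ : ∀ {C D ts} {P Q : Tapes → Set} {t t′} → Run C ts P t → (∀ {ts′} → P ts′ → Run D ts′ Q t′) →
          Run (C ⨾ D) ts Q (t + t′)
  run-⨾ (ts′ , p , tr) k with k p
  ... | ts″ , q , tr′ = ts″ , q , Trace-⨾ tr tr′

  opaque
    unfolding _‼_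

    run-push : ∀ {ts i a} → Run (push i a) ts (Update ts i (a ∷ ts ‼ i)) 2
    run-push {ts} {i} {a} = ts₂ , update this₂ other₂ , goto refl (exit refl)
      where
      ts₁ ts₂ : Tapes
      ts₁ = next ts (idle (heads ts) [ code i ]≔ (lookup (heads ts) (code i) , left))
      ts₂ = next ts₁ (idle (heads ts₁) [ code i ]≔ (letter a , stay))
      this₂ : ts₂ ‼ i ≡ a ∷ ts ‼ i
      this₂ rewrite lookup-next-update ts₁ (code i) (letter a , stay)
                  | lookup-next-update ts (code i) (lookup (heads ts) (code i) , left)
                  | Vec.lookup-map (code i) Tape.head ts = tapeOutput-push (lookup ts (code i))
      other₂ : ∀ {j} → j ≢ i → ts₂ ‼ j ≡ ts ‼ j
      other₂ j≢i = cong (tapeOutput {0})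
        (trans (lookup-next-other ts₁ _ (j≢i ∘ code-injective)) (lookup-next-other ts _ (j≢i ∘ code-injective)))

    run-pop : ∀ {ts i a xs} → ts ‼ i ≡ a ∷ xs → Run (pop i) ts (Update ts i xs) 1
    run-pop {ts} {i} {a} {xs} eq = _ , update this₁ other₁ , exit refl
      where
      this₁ : next ts (idle (heads ts) [ code i ]≔ (lookup (heads ts) (code i) , right)) ‼ i ≡ xs
      this₁ rewrite lookup-next-update ts (code i) (lookup (heads ts) (code i) , right)
                  | Vec.lookup-map (code i) Tape.head ts = tapeOutput-pop (lookup ts (code i)) eq
      other₁ : ∀ {j} → j ≢ i → next ts (idle (heads ts) [ code i ]≔ (lookup (heads ts) (code i) , right)) ‼ j ≡ ts ‼ j
      other₁ j≢i = cong (tapeOutput {0}) (lookup-next-other ts _ (j≢i ∘ code-injective))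

  run-cond : ∀ {p i C D ts} {Q : Tapes → Set} {t} →
             (p (top ts i) ≡ true → Run C ts Q t) → (p (top ts i) ≡ false → Run D ts Q t) →
             Run (cond p i C D) ts Q (suc t)
  run-cond {p} {i} {C} {D} {ts} {Q} {t} rc rd with p (top ts i) in eq
  ... | true  with rc refl
  ...   | ts′ , q , tr = ts′ , q , goto
            (cong₂ _,_ (cong (λ b → just (inj₂ (if b then _ else _))) (trans (cong p (asLetter-heads ts i)) eq)) refl)
            (subst (λ us → Trace _ _ us ts′ t) (sym (next-idle ts)) (Trace-condˡ tr))
  run-cond {p} {i} {C} {D} {ts} {Q} {t} rc rd | false with rd refl
  ...   | ts′ , q , tr = ts′ , q , goto
            (cong₂ _,_ (cong (λ b → just (inj₂ (if b then _ else _))) (trans (cong p (asLetter-heads ts i)) eq)) refl)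
            (subst (λ us → Trace _ _ us ts′ t) (sym (next-idle ts)) (Trace-condʳ tr))

  -- The loop stack is its own variant: the invariant is indexed by its length, which each round
  -- lowers by one. A round costs the body and one test, and one further test ends the loop.
  run-while : ∀ {i C t} (I : ℕ → Tapes → Set) →
    (∀ {n ts} → I n ts → length (ts ‼ i) ≡ n) →
    (∀ {n ts} → I (suc n) ts → Run C ts (I n) t) →
    ∀ n {ts} → I n ts → Run (while i C) ts (I 0) (suc (n * suc t))
  run-while {i} I len body zero {ts} inv =
    ts , inv , subst (λ us → Trace _ _ ts us 1) (next-idle ts)
      (exit (cong (λ x → (if nonempty x then _ else nothing) , idle (heads ts))
        (trans (asLetter-heads ts i) (cong List.head (empty (ts ‼ i) (len inv))))))
    where
    empty : ∀ (xs : List Letter) → length xs ≡ 0 → xs ≡ []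
    empty [] _ = refl
  run-while {i} {C} {t} I len body (suc n) {ts} inv with body inv
  ... | ts′ , inv′ , tr with run-while I len body n inv′
  ...   | ts″ , inv″ , tr′ = ts″ , inv″ ,
          goto (cong (λ b → (if b then just (inj₂ (entry C)) else nothing) , idle (heads ts))
                 (trans (cong nonempty (asLetter-heads ts i)) (nonempty-head (ts ‼ i) (len inv))))
               (subst (λ us → Trace _ _ us ts″ _) (sym (next-idle ts))
                 (subst (Trace (while i C) (inj₂ (entry C)) ts ts″) (+-suc t (n * suc t))
                   (Trace-while tr tr′)))
    where
    nonempty-head : ∀ (xs : List Letter) → length xs ≡ suc n → nonempty (List.head xs) ≡ true
    nonempty-head (_ ∷ _) _ = refl

  -- The two final states beyond the exit are the rejecting and the accepting
  -- one; the machine accepts iff stack out is nonempty.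
  module _ (out : Ix) (C : Cmd) where

    transit : Control C ⊎ Maybe Bool → Symbols → Maybe ((Control C ⊎ Maybe Bool) × Actions)
    transit (inj₁ q)        hs = just (Product.map₁ (maybe inj₁ (inj₂ nothing)) (δ C q hs))
    transit (inj₂ nothing)  hs = just (inj₂ (just (nonempty (asLetter (lookup hs (code out))))) , idle hs)
    transit (inj₂ (just b)) hs = nothing

    Maybe↔⊤⊎ : ∀ {A : Set} → Maybe A ↔ (⊤ ⊎ A)
    Maybe↔⊤⊎ = mk↔ₛ′ (maybe inj₂ (inj₁ tt)) Sum.[ (λ _ → nothing) , just ]
      (λ { (inj₁ _) → refl ; (inj₂ _) → refl }) (λ { nothing → refl ; (just _) → refl })

    machine : Machine
    machine = record
      { State      = Control C ⊎ Maybe Bool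
      ; numStates  = size C + 3
      ; finite     = ⊎↔Fin (control↔Fin C) (↔-trans Maybe↔⊤⊎ (⊎↔Fin (↔-sym Fin.1↔⊤) (↔-sym Fin.2↔Bool)))
      ; numExtra   = 0
      ; numWork    = m
      ; start      = inj₁ (entry C)
      ; accepting  = Sum.[ (λ _ → false) , maybe id false ]
      ; transition = transit
      }

    open Machine machine using (run)

    -- One step more than the trace is needed: after the exit the machine inspects stack `out` to
    -- choose its final state.
    run-trace : ∀ {q ts ts′ t} → Trace C q ts ts′ t →
                run (suc t) (inj₁ q , ts) ≡ just (inj₂ (just (nonempty (top ts′ out))) , ts′)
    run-trace {q} {ts} (exit {as = as} {t} eq) rewrite eq
      | next-idle (next ts as) | asLetter-heads (next ts as) out with t
    ... | zero  = refl
    ... | suc _ = refl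
    run-trace (goto eq tr) rewrite eq = run-trace tr

    run-within : ∀ {q ts ts′ t n} → Trace C q ts ts′ t → suc t ≤ n →
                 run n (inj₁ q , ts) ≡ just (inj₂ (just (nonempty (top ts′ out))) , ts′)
    run-within tr (s≤s t≤n) = run-trace (Trace-mono t≤n tr)

-- Macros of stack machines: transfers, counted loops, non-destructive reading.

is : Letter → Maybe Letter → Bool
is #           (just #)           = true
is (bit true)  (just (bit true))  = true
is (bit false) (just (bit false)) = true
is _           _                  = false

ones : ℕ → List Letter
ones n = replicate n (bit true)

ones-ʳ++ : ∀ m n → ones m ʳ++ ones n ≡ ones (m + n)
ones-ʳ++ zero    n = refl
ones-ʳ++ (suc m) n = trans (ones-ʳ++ m (suc n)) (cong ones (+-suc m n))

length≡0⇒[] : ∀ {A : Set} {xs : List A} → length xs ≡ 0 → xs ≡ []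
length≡0⇒[] {xs = []} _ = refl

drop-1-drop : ∀ {A : Set} n (xs : List A) → drop 1 (drop n xs) ≡ drop (suc n) xs
drop-1-drop zero    xs       = refl
drop-1-drop (suc n) []       = refl
drop-1-drop (suc n) (x ∷ xs) = drop-1-drop n xs

-- Each of the n rounds pays one test, the body and a transfer of at most 6 steps. Afterwards n
-- letters are moved back, at 7 steps each for test and transfer.
forEachTime : ℕ → ℕ → ℕ
forEachTime n t = suc (n * suc (t + 6)) + suc (n * 7)

forEachTime-mono : ∀ {n n′ t t′} → n ≤ n′ → t ≤ t′ → forEachTime n t ≤ forEachTime n′ t′
forEachTime-mono n≤ t≤ = +-mono-≤ (s≤s (*-mono-≤ n≤ (s≤s (+-monoˡ-≤ 6 t≤)))) (s≤s (*-monoˡ-≤ 7 n≤))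

forEachTime-monoˡ : ∀ t {n n′} → n ≤ n′ → forEachTime n t ≤ forEachTime n′ t
forEachTime-monoˡ t n≤ = forEachTime-mono n≤ (≤-refl {t})

module StackMacros {Ix : Set} {m : ℕ} (code : Ix → Fin (suc m))
  (code-injective : ∀ {i j} → code i ≡ code j → i ≡ j) where

  open StackMachine code code-injective public

  _≟ᴵ_ : (i j : Ix) → Dec (i ≡ j)
  i ≟ᴵ j = map′ code-injective (cong code) (code i Fin.≟ code j)

  SameExcept₂ : Ix → Ix → Tapes → Tapes → Set
  SameExcept₂ i j ts ts′ = ∀ k → k ≢ i → k ≢ j → ts′ ‼ k ≡ ts ‼ k

  -- Commands carry no data between them, so the letter is identified by tests and each letter has
  -- its own branch; an empty source is left alone. Three tests, a pop and a push make 6 steps.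
  transfer : Ix → Ix → Cmd
  transfer i j =
    cond (is #) i (pop i ⨾ push j #)
    (cond (is (bit true)) i (pop i ⨾ push j (bit true))
    (cond (is (bit false)) i (pop i ⨾ push j (bit false)) skip))

  record Transferred (i j : Ix) (ts ts′ : Tapes) : Set where
    constructor transferred
    field
      source : ts′ ‼ i ≡ drop 1 (ts ‼ i)
      target : ts′ ‼ j ≡ take 1 (ts ‼ i) ++ ts ‼ j
      frame  : SameExcept₂ i j ts ts′

  open Transferred public

  run-transfer : ∀ {i j ts} → i ≢ j → Run (transfer i j) ts (Transferred i j ts) 6
  run-transfer {i} {j} {ts} i≢j with ts ‼ i in eq
  ... | [] = run-cond (λ p → contradiction (trans (sym p) (cong (is # ∘ List.head) eq)) λ())
               λ _ → run-cond (λ p → contradiction (trans (sym p) (cong (is (bit true) ∘ List.head) eq)) λ())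
               λ _ → run-cond (λ p → contradiction (trans (sym p) (cong (is (bit false) ∘ List.head) eq)) λ())
               λ _ → run-mono (s≤s z≤n) id (run-skip (transferred (trans eq (cong (drop 1) (sym eq)))
                 (cong (_++ ts ‼ j) (cong (take 1) (sym eq))) (λ _ _ _ → refl)))
  ... | a ∷ xs = found a eq
    where
    moved : ∀ a {ts xs} → ts ‼ i ≡ a ∷ xs → Run (pop i ⨾ push j a) ts (Transferred i j ts) 3
    moved a eq = run-⨾ (run-pop eq) λ u → run-mono ≤-refl
      (λ u′ → transferred (trans (other u′ i≢j) (trans (this u) (cong (drop 1) (sym eq))))
                (trans (this u′) (cong₂ (λ x y → take 1 x ++ y) (sym eq) (other u (i≢j ∘ sym))))
                (λ _ k≢i k≢j → trans (other u′ k≢j) (other u k≢i)))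
      run-push
    found : ∀ a {xs} → ts ‼ i ≡ a ∷ xs → Run (transfer i j) ts (Transferred i j ts) 6
    found # eq =
      run-cond (λ _ → run-mono (m≤m+n 3 2) id (moved # eq))
               (λ p → contradiction (trans (sym p) (cong (is # ∘ List.head) eq)) λ())
    found (bit true) eq =
      run-cond (λ p → contradiction (trans (sym p) (cong (is # ∘ List.head) eq)) λ())
      λ _ → run-cond (λ _ → run-mono (m≤m+n 3 1) id (moved (bit true) eq))
               (λ p → contradiction (trans (sym p) (cong (is (bit true) ∘ List.head) eq)) λ())
    found (bit false) eq =
      run-cond (λ p → contradiction (trans (sym p) (cong (is # ∘ List.head) eq)) λ())
      λ _ → run-cond (λ p → contradiction (trans (sym p) (cong (is (bit true) ∘ List.head) eq)) λ())
      λ _ → run-cond (λ _ → moved (bit false) eq)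
               (λ p → contradiction (trans (sym p) (cong (is (bit false) ∘ List.head) eq)) λ())

  moveAll : Ix → Ix → Cmd
  moveAll i j = while i (transfer i j)

  record MovedAll (i j : Ix) (ts ts′ : Tapes) : Set where
    constructor movedAll
    field
      source : ts′ ‼ i ≡ []
      target : ts′ ‼ j ≡ ts ‼ i ʳ++ ts ‼ j
      frame  : SameExcept₂ i j ts ts′

  run-moveAll : ∀ {i j ts} → i ≢ j → Run (moveAll i j) ts (MovedAll i j ts) (suc (length (ts ‼ i) * 7))
  run-moveAll {i} {j} {ts} i≢j = run-mono ≤-refl finish
      (run-while Inv proj₁ body (length (ts ‼ i)) (refl , refl , λ _ _ _ → refl))
    where
    Inv : ℕ → Tapes → Set
    Inv n us = length (us ‼ i) ≡ n × us ‼ i ʳ++ us ‼ j ≡ ts ‼ i ʳ++ ts ‼ j × SameExcept₂ i j ts us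
    finish : ∀ {us} → Inv 0 us → MovedAll i j ts us
    finish {us} (len , eq , same) =
      movedAll (length≡0⇒[] len) (trans (cong (_ʳ++ us ‼ j) (sym (length≡0⇒[] {xs = us ‼ i} len))) eq) same
    split : ∀ {n} (xs : List Letter) {ys} → length xs ≡ suc n →
            length (drop 1 xs) ≡ n × drop 1 xs ʳ++ (take 1 xs ++ ys) ≡ xs ʳ++ ys
    split (x ∷ xs) len = suc-injective len , refl
    body : ∀ {n us} → Inv (suc n) us → Run (transfer i j) us (Inv n) 6
    body {n} {us} (len , eq , same) = run-mono ≤-refl
      (λ tr → trans (cong length (source tr)) (proj₁ (split (us ‼ i) {us ‼ j} len)) ,
              trans (cong₂ _ʳ++_ (source tr) (target tr)) (trans (proj₂ (split (us ‼ i) {us ‼ j} len)) eq) ,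
              λ _ k≢i k≢j → trans (frame tr _ k≢i k≢j) (same _ k≢i k≢j))
      (run-transfer i≢j)

  clear : Ix → Cmd
  clear i = while i (pop i)

  run-clear : ∀ {i ts} → Run (clear i) ts (Update ts i []) (suc (length (ts ‼ i) * 2))
  run-clear {i} {ts} = run-mono ≤-refl (λ (len , same) → update (length≡0⇒[] len) (same _))
      (run-while (λ n us → length (us ‼ i) ≡ n × (∀ k → k ≢ i → us ‼ k ≡ ts ‼ k)) proj₁ body
        (length (ts ‼ i)) (refl , λ _ _ → refl))
    where
    body : ∀ {n us} → length (us ‼ i) ≡ suc n × (∀ k → k ≢ i → us ‼ k ≡ ts ‼ k) →
           Run (pop i) us (λ us′ → length (us′ ‼ i) ≡ n × (∀ k → k ≢ i → us′ ‼ k ≡ ts ‼ k)) 1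
    body {us = us} (len , same) with us ‼ i in eq
    ... | x ∷ xs = run-mono ≤-refl
      (λ u → trans (cong length (this u)) (suc-injective len) , λ _ k≢i → trans (other u k≢i) (same _ k≢i))
      (run-pop eq)

  -- Meanwhile t holds the number of completed rounds.
  forEach : Ix → Ix → Cmd → Cmd
  forEach c t B = while c (B ⨾ transfer c t) ⨾ moveAll t c

  -- The letters on `c` and `t` together always number n, so moving `t` back at the end restores `c`
  -- and the counter can be used again. Letters move between the two stacks outside of the body,
  -- hence the invariant must not depend on them; this is the hypothesis on `SameExcept₂`.
  run-forEach : ∀ {c t B n time ts} (Inv : ℕ → Tapes → Set) → c ≢ t →
    (∀ {v us us′} → SameExcept₂ c t us us′ → Inv v us → Inv v us′) →
    (∀ {v m us} → v + suc m ≡ n → us ‼ c ≡ ones (suc m) → us ‼ t ≡ ones v → Inv v us →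
       Run B us (λ us′ → us′ ‼ c ≡ us ‼ c × us′ ‼ t ≡ us ‼ t × Inv (suc v) us′) time) →
    ts ‼ c ≡ ones n → ts ‼ t ≡ [] → Inv 0 ts →
    Run (forEach c t B) ts (λ us → us ‼ c ≡ ones n × us ‼ t ≡ [] × Inv n us) (forEachTime n time)
  run-forEach {c} {t} {B} {n} {time} {ts} Inv c≢t stable body c≡ t≡ j =
    run-⨾ (run-while Round (λ (_ , _ , cs , _) → trans (cong length cs) (List.length-replicate _)) body′ n
             (0 , refl , c≡ , t≡ , j))
      λ {us} → restore
    where
    Round : ℕ → Tapes → Set
    Round m us = ∃[ v ] (v + m ≡ n × us ‼ c ≡ ones m × us ‼ t ≡ ones v × Inv v us)
    body′ : ∀ {m us} → Round (suc m) us → Run (B ⨾ transfer c t) us (Round m) (time + 6)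
    body′ {m} {us} (v , eq , cs , ts , j) = run-⨾ (body eq cs ts j) λ {us₁} (cs₁ , ts₁ , j₁) → run-mono ≤-refl
      (λ tr → suc v , trans (sym (+-suc v m)) eq ,
              trans (source tr) (cong (drop 1) (trans cs₁ cs)) ,
              trans (target tr) (cong₂ (λ x y → take 1 x ++ y) (trans cs₁ cs) (trans ts₁ ts)) ,
              stable (frame tr) j₁)
      (run-transfer c≢t)
    restore : ∀ {us} → Round 0 us →
              Run (moveAll t c) us (λ us → us ‼ c ≡ ones n × us ‼ t ≡ [] × Inv n us) (suc (n * 7))
    restore {us} (v , eq , cs , ts , j) with trans (sym (+-identityʳ v)) eq
    ... | refl = run-mono (≤-reflexive (cong (λ l → suc (l * 7)) (trans (cong length ts) (List.length-replicate v))))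
      (λ mv → trans (MovedAll.target mv)
        (trans (cong₂ _ʳ++_ ts cs) (trans (ones-ʳ++ v 0) (cong ones (+-identityʳ v)))) ,
              MovedAll.source mv , stable (λ _ k≢c k≢t → MovedAll.frame mv _ k≢t k≢c) j)
      (run-moveAll (c≢t ∘ sym))

  -- The top v letters of x (all of them if there are fewer) have been moved to a.
  record Skipped (x a : Ix) (v : ℕ) (ts ts′ : Tapes) : Set where
    constructor skipped
    field
      rest    : ts′ ‼ x ≡ drop v (ts ‼ x)
      whole   : ts′ ‼ a ʳ++ ts′ ‼ x ≡ ts ‼ a ʳ++ ts ‼ x
      bounded : length (ts′ ‼ a) ≤ v + length (ts ‼ a)
      frame   : SameExcept₂ x a ts ts′

  Skipped-zero : ∀ {x a ts} → Skipped x a 0 ts ts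
  Skipped-zero = skipped refl refl ≤-refl λ _ _ _ → refl

  Skipped-+ : ∀ {x a v w ts us us′} → Skipped x a v ts us → Skipped x a w us us′ → Skipped x a (v + w) ts us′
  Skipped-+ {x} {a} {v} {w} {ts} s s′ = skipped
    (trans (Skipped.rest s′) (trans (cong (drop w) (Skipped.rest s)) (List.drop-drop v w (ts ‼ x))))
    (trans (Skipped.whole s′) (Skipped.whole s))
    (≤-trans (Skipped.bounded s′) (≤-trans (+-monoʳ-≤ w (Skipped.bounded s))
      (≤-reflexive (trans (sym (+-assoc w v _)) (cong (_+ length (ts ‼ a)) (+-comm w v))))))
    (λ _ k≢x k≢a → trans (Skipped.frame s′ _ k≢x k≢a) (Skipped.frame s _ k≢x k≢a))

  Transferred⇒Skipped : ∀ {x a ts us} → Transferred x a ts us → Skipped x a 1 ts us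
  Transferred⇒Skipped {x} {a} {ts} {us} tr = skipped (source tr)
    (trans (cong₂ _ʳ++_ (target tr) (source tr)) (sides (ts ‼ x)))
    (≤-trans (≤-reflexive (cong length (target tr))) (len (ts ‼ x))) (frame tr)
    where
    sides : ∀ xs {ys : List Letter} → (take 1 xs ++ ys) ʳ++ drop 1 xs ≡ ys ʳ++ xs
    sides []       = refl
    sides (_ ∷ xs) = refl
    len : ∀ xs {ys : List Letter} → length (take 1 xs ++ ys) ≤ suc (length ys)
    len []       = n≤1+n _
    len (_ ∷ xs) = ≤-refl

  -- This is how the machine multiplies: n rounds that skip k letters each skip n * k letters, which
  -- locates a row in a table stored as one string.
  run-forEach-skip : ∀ {c t x a B n k time ts} → c ≢ t → c ≢ x → c ≢ a → t ≢ x → t ≢ a →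
    (∀ {us} → (∀ j → j ≢ x → j ≢ a → j ≢ c → j ≢ t → us ‼ j ≡ ts ‼ j) →
       Run B us (Skipped x a k us) time) →
    ts ‼ c ≡ ones n → ts ‼ t ≡ [] → Run (forEach c t B) ts (Skipped x a (n * k) ts) (forEachTime n time)
  run-forEach-skip {c} {t} {x} {a} {B} {n} {k} {time} {ts} c≢t c≢x c≢a t≢x t≢a body c≡ t≡ =
    run-mono ≤-refl finish
      (run-forEach Inv c≢t (λ {v} → stable {v})
        (λ {v} _ _ _ j → run-mono ≤-refl
          (λ sk → Skipped.frame sk _ c≢x c≢a , Skipped.frame sk _ t≢x t≢a , extend {v} j sk)
            (body (proj₂ (proj₂ (proj₂ j)))))
        c≡ t≡ (refl , refl , ≤-refl , λ _ _ _ _ _ → refl))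
    where
    Inv : ℕ → Tapes → Set
    Inv v us = us ‼ x ≡ drop (v * k) (ts ‼ x) × us ‼ a ʳ++ us ‼ x ≡ ts ‼ a ʳ++ ts ‼ x ×
             length (us ‼ a) ≤ v * k + length (ts ‼ a) ×
             (∀ j → j ≢ x → j ≢ a → j ≢ c → j ≢ t → us ‼ j ≡ ts ‼ j)
    stable : ∀ {v us us′} → SameExcept₂ c t us us′ → Inv v us → Inv v us′
    stable same (r , w , b , f) with same _ (c≢x ∘ sym) (t≢x ∘ sym) | same _ (c≢a ∘ sym) (t≢a ∘ sym)
    ... | x≡ | a≡ = trans x≡ r , trans (cong₂ _ʳ++_ a≡ x≡) w , ≤-trans (≤-reflexive (cong length a≡)) b ,
                    λ _ j≢x j≢a j≢c j≢t → trans (same _ j≢c j≢t) (f _ j≢x j≢a j≢c j≢t)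
    extend : ∀ {v us us′} → Inv v us → Skipped x a k us us′ → Inv (suc v) us′
    extend {v} {us} (r , w , b , f) sk =
      trans (Skipped.rest sk) (trans (cong (drop k) r)
          (trans (List.drop-drop (v * k) k (ts ‼ x)) (cong (λ n → drop n (ts ‼ x)) (+-comm (v * k) k)))) ,
      trans (Skipped.whole sk) w ,
      ≤-trans (Skipped.bounded sk) (≤-trans (+-monoʳ-≤ k b) (≤-reflexive (sym (+-assoc k (v * k) _)))) ,
      λ _ j≢x j≢a j≢c j≢t → trans (Skipped.frame sk _ j≢x j≢a) (f _ j≢x j≢a j≢c j≢t)
    finish : ∀ {us} → us ‼ c ≡ ones n × us ‼ t ≡ [] × Inv n us → Skipped x a (n * k) ts us
    finish {us} (c≡′ , t≡′ , r , w , b , f) = skipped r w b same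
      where
      same : SameExcept₂ x a ts us
      same j j≢x j≢a with j ≟ᴵ c | j ≟ᴵ t
      ... | yes refl | _        = trans c≡′ (sym c≡)
      ... | no _     | yes refl = trans t≡′ (sym t≡)
      ... | no j≢c   | no j≢t   = f _ j≢x j≢a j≢c j≢t

  skipBy : Ix → Ix → Ix → Ix → Cmd
  skipBy c t x a = forEach c t (transfer x a)

  run-skipBy : ∀ {c t x a n ts} → c ≢ t → c ≢ x → c ≢ a → t ≢ x → t ≢ a → x ≢ a →
    ts ‼ c ≡ ones n → ts ‼ t ≡ [] → Run (skipBy c t x a) ts (Skipped x a n ts) (forEachTime n 6)
  run-skipBy {x = x} {a} {n} {ts} c≢t c≢x c≢a t≢x t≢a x≢a c≡ t≡ =
    run-mono ≤-refl (λ {us} → subst (λ k → Skipped x a k ts us) (*-identityʳ n))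
      (run-forEach-skip c≢t c≢x c≢a t≢x t≢a
        (λ _ → run-mono ≤-refl Transferred⇒Skipped (run-transfer x≢a)) c≡ t≡)

  test : (Maybe Letter → Bool) → Ix → Ix → Ix → Cmd
  test p v x a = cond p x (push v (bit true)) (push v (bit false)) ⨾ moveAll a x

  -- Reading is not destructive: the skipped letters lie on `a` in reverse order, and by `whole`
  -- moving them back restores `x`.
  run-test : ∀ {p v x a n ts us} → v ≢ x → v ≢ a → x ≢ a → ts ‼ a ≡ [] → Skipped x a n ts us →
    Run (test p v x a) us (Update ts v (bit (p (List.head (drop n (ts ‼ x)))) ∷ ts ‼ v)) (3 + suc (n * 7))
  run-test {p} {v} {x} {a} {n} {ts} {us} v≢x v≢a x≢a a≡ sk =
    run-⨾ (run-cond (λ eq → answer eq run-push) (λ eq → answer eq run-push)) restore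
    where
    b : Bool
    b = p (List.head (drop n (ts ‼ x)))
    answer : ∀ {c} → p (top us x) ≡ c → Run (push v (bit c)) us (Update us v (bit c ∷ us ‼ v)) 2 →
             Run (push v (bit c)) us (Update us v (bit b ∷ us ‼ v)) 2
    answer refl r = run-mono ≤-refl
      (λ {us′} → subst (λ b → Update us v (bit b ∷ us ‼ v) us′) (cong (p ∘ List.head) (Skipped.rest sk))) r
    restore : ∀ {us′} → Update us v (bit b ∷ us ‼ v) us′ →
              Run (moveAll a x) us′ (Update ts v (bit b ∷ ts ‼ v)) (suc (n * 7))
    restore {us′} u = run-mono
      (s≤s (*-monoˡ-≤ 7 (≤-trans (≤-reflexive (cong length (other u (v≢a ∘ sym))))
        (≤-trans (Skipped.bounded sk) (≤-reflexive (trans (cong (λ l → n + length l) a≡) (+-identityʳ n)))))))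
      (λ mv → update (trans (MovedAll.frame mv _ v≢a v≢x)
        (trans (this u) (cong (bit b ∷_) (Skipped.frame sk _ v≢x v≢a)))) (rest mv))
      (run-moveAll (x≢a ∘ sym))
      where
      rest : ∀ {us″} → MovedAll a x us′ us″ → ∀ {j} → j ≢ v → us″ ‼ j ≡ ts ‼ j
      rest mv {j} j≢v with j ≟ᴵ a | j ≟ᴵ x
      ... | yes refl | _ = trans (MovedAll.source mv) (sym a≡)
      ... | no _ | yes refl = trans (MovedAll.target mv)
              (trans (cong₂ _ʳ++_ (other u (v≢a ∘ sym)) (other u (v≢x ∘ sym)))
                (trans (Skipped.whole sk) (cong (_ʳ++ ts ‼ x) a≡)))
      ... | no j≢a | no j≢x =
              trans (MovedAll.frame mv _ j≢a j≢x) (trans (other u j≢v) (Skipped.frame sk _ j≢x j≢a))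

-- The query language: syntax and semantics.

anyBelow : ℕ → (ℕ → Bool) → Bool
anyBelow zero    f = false
anyBelow (suc n) f = f n ∨ anyBelow n f

loop : ∀ {A : Set} → ℕ → (ℕ → A → A) → A → A
loop zero    f s = s
loop (suc n) f s = f n (loop n f s)

-- A first-order query language with loops.  Variables range over the numbers
-- up to the length of the input, the r tables are binary relations on them, and
-- less xs z says that the sum of the variables xs is less than z.
module Language (r : ℕ) where

  data Form (d : ℕ) : Set where
    inp   : Letter → Fin d → Form d
    rel   : Fin r → Fin d → Fin d → Form d
    less  : List (Fin d) → Fin d → Form d
    neg   : Form d → Form d
    _∧ᶠ_  : Form d → Form d → Form d
    _∨ᶠ_  : Form d → Form d → Form d
    ex    : Form (suc d) → Form d
    all   : Form (suc d) → Form d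

  infixr 7 _∧ᶠ_
  infixr 6 _∨ᶠ_

  infixr 5 _▹_

  data Prog (d : ℕ) : Set where
    define : Fin r → Form (2 + d) → Prog d
    _▹_    : Prog d → Prog d → Prog d
    for    : Prog (suc d) → Prog d
    when   : Form d → Prog d → Prog d
    emit   : Letter → Prog d

  Tables : Set
  Tables = Fin r → ℕ → ℕ → Bool

  Store : Set
  Store = Tables × List Letter

  _[_↦_] : Tables → Fin r → (ℕ → ℕ → Bool) → Tables
  (ρ [ A ↦ f ]) B = if does (B Fin.≟ A) then f else ρ B

  heightF : ∀ {d} → Form d → ℕ
  heightF (inp _ _)   = 0
  heightF (rel _ _ _) = 0
  heightF (less _ _)  = 0
  heightF (neg φ)     = heightF φ
  heightF (φ ∧ᶠ ψ)    = heightF φ ⊔ heightF ψ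
  heightF (φ ∨ᶠ ψ)    = heightF φ ⊔ heightF ψ
  heightF (ex φ)      = suc (heightF φ)
  heightF (all φ)     = suc (heightF φ)

  height : ∀ {d} → Prog d → ℕ
  height (define _ φ) = 2 + heightF φ
  height (P ▹ Q)      = height P ⊔ height Q
  height (for P)      = suc (height P)
  height (when φ P)   = heightF φ ⊔ height P
  height (emit _)     = 0

  module Semantics (w : List Letter) where

    opaque
      -- One more than the length, so that the length itself is a value of a variable. The number of
      -- rows attains it when all rows are empty.
      N : ℕ
      N = suc (length w)

      N-def : N ≡ suc (length w)
      N-def = refl

    evalF : ∀ {d} → Form d → Vec ℕ d → Tables → Bool
    evalF (inp a x)   env ρ = is a (List.head (drop (lookup env x) w))
    evalF (rel A x y) env ρ = ρ A (lookup env x) (lookup env y)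
    evalF (less xs z) env ρ = sum (map (lookup env) xs) <ᵇ lookup env z
    evalF (neg φ)     env ρ = not (evalF φ env ρ)
    evalF (φ ∧ᶠ ψ)    env ρ = evalF φ env ρ ∧ evalF ψ env ρ
    evalF (φ ∨ᶠ ψ)    env ρ = evalF φ env ρ ∨ evalF ψ env ρ
    evalF (ex φ)      env ρ = anyBelow N (λ v → evalF φ (v ∷ env) ρ)
    evalF (all φ)     env ρ = not (anyBelow N (λ v → not (evalF φ (v ∷ env) ρ)))

    -- In define A φ the variables 1 and 0 of φ are the row and the column.
    -- The emitted letters are stored in reverse order.
    exec : ∀ {d} → Prog d → Vec ℕ d → Store → Store
    exec (define A φ) env (ρ , o) = ρ [ A ↦ (λ a b → evalF φ (b ∷ a ∷ env) ρ) ] , o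
    exec (P ▹ Q)      env s       = exec Q env (exec P env s)
    exec (for P)      env s       = loop N (λ v → exec P (v ∷ env)) s
    exec (when φ P)   env s       = if evalF φ env (proj₁ s) then exec P env s else s
    exec (emit a)     env (ρ , o) = ρ , a ∷ o

  initialStore : Store
  initialStore = (λ _ _ _ → false) , []

  opaque

    result : Prog 0 → List Letter → List Letter
    result P w = proj₂ (Semantics.exec w P [] initialStore) ʳ++ []

    result-def : ∀ P w → result P w ≡ proj₂ (Semantics.exec w P [] initialStore) ʳ++ []
    result-def P w = refl

-- Compilation.  The value of a variable is the number of elapsed rounds of its
-- loop; idle loops have both their stacks empty.
module Compilation (r D : ℕ) where

  open Language r

  data Stack : Set where
    input count value fresh output aux tmp tmp′ : Stack
    remaining elapsed : Fin D → Stack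
    table : Fin r → Stack

  code : Stack → Fin (suc (7 + (D + (D + r))))
  code input         = zero
  code count         = suc zero
  code value         = suc (suc zero)
  code fresh         = suc (suc (suc zero))
  code output        = suc (suc (suc (suc zero)))
  code aux           = suc (suc (suc (suc (suc zero))))
  code tmp           = suc (suc (suc (suc (suc (suc zero)))))
  code tmp′          = suc (suc (suc (suc (suc (suc (suc zero))))))
  code (remaining x) = 8 ↑ʳ (x ↑ˡ (D + r))
  code (elapsed x)   = 8 ↑ʳ (D ↑ʳ (x ↑ˡ r))
  code (table A)     = 8 ↑ʳ (D ↑ʳ (D ↑ʳ A))

  decode : Fin (suc (7 + (D + (D + r)))) → Stack
  decode zero                                                 = input
  decode (suc zero)                                           = count
  decode (suc (suc zero))                                     = value
  decode (suc (suc (suc zero)))                               = fresh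
  decode (suc (suc (suc (suc zero))))                         = output
  decode (suc (suc (suc (suc (suc zero)))))                   = aux
  decode (suc (suc (suc (suc (suc (suc zero))))))             = tmp
  decode (suc (suc (suc (suc (suc (suc (suc zero)))))))       = tmp′
  decode (suc (suc (suc (suc (suc (suc (suc (suc k)))))))) =
    Sum.[ remaining , Sum.[ elapsed , table ] ∘ splitAt D ] (splitAt D k)

  decode-code : ∀ i → decode (code i) ≡ i
  decode-code input  = refl
  decode-code count  = refl
  decode-code value  = refl
  decode-code fresh  = refl
  decode-code output = refl
  decode-code aux    = refl
  decode-code tmp    = refl
  decode-code tmp′   = refl
  decode-code (remaining x) rewrite Fin.splitAt-↑ˡ D x (D + r) = refl
  decode-code (elapsed x)   rewrite Fin.splitAt-↑ʳ D (D + r) (x ↑ˡ r) | Fin.splitAt-↑ˡ D x r = refl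
  decode-code (table A)     rewrite Fin.splitAt-↑ʳ D (D + r) (D ↑ʳ A) | Fin.splitAt-↑ʳ D r A = refl

  code-injective : ∀ {i j} → code i ≡ code j → i ≡ j
  code-injective {i} {j} eq = trans (sym (decode-code i)) (trans (cong decode eq) (decode-code j))

  open StackMacros code code-injective public

  -- Turns a de Bruijn index into a level, counted from the outermost loop. The stacks of a loop
  -- thus depend on its nesting depth alone and stay the same when further variables are bound
  -- inside.
  variableOf : ∀ {d} → d ≤ D → Fin d → Fin D
  variableOf p zero    = fromℕ< p
  variableOf p (suc i) = variableOf (<⇒≤ p) i

  negC : Cmd → Cmd
  negC C = C ⨾ cond (is (bit true)) value (pop value ⨾ push value (bit false)) (pop value ⨾ push value (bit true))

  andC : Cmd → Cmd → Cmd
  andC C C′ = C ⨾ cond (is (bit true)) value (pop value ⨾ C′) skip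

  -- All nested loops have the same range but `count` is a single stack, so every loop counts down a
  -- private copy of it, which is removed at the end.
  forC : Fin D → Cmd → Cmd
  forC x B =
    forEach count tmp (push (remaining x) (bit true)) ⨾
    forEach (remaining x) (elapsed x) B ⨾
    clear (remaining x)

  -- The disjunction of the earlier rounds lies on `value` beneath the result of the current one. A
  -- true result replaces both by true, a false result is dropped.
  exC : Fin D → Cmd → Cmd
  exC x C = push value (bit false) ⨾ forC x
    (C ⨾ cond (is (bit true)) value (pop value ⨾ pop value ⨾ push value (bit true)) (pop value))

  skipsC : List (Fin D) → Fin D → Cmd
  skipsC []       z = skip
  skipsC (x ∷ xs) z = skipBy (elapsed x) tmp (elapsed z) aux ⨾ skipsC xs z

  -- The comparison drops letters from the unary stack of `z`, which cannot at the same time serve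
  -- as a loop counter. If `z` is itself a summand, the sum is at least its value and the answer is
  -- false without any computation.
  lessC : List (Fin D) → Fin D → Cmd
  lessC xs z = if any (λ x → does (x Fin.≟ z)) xs
    then push value (bit false)
    else skipsC xs z ⨾ test nonempty value (elapsed z) aux

  deeper : ∀ d {h} → d + suc h ≤ D → suc d + h ≤ D
  deeper d {h} = subst (_≤ D) (+-suc d h)

  form : ∀ {d} (φ : Form d) → d + heightF φ ≤ D → Cmd
  form {d} (inp a x) p =
    skipBy (elapsed (variableOf (m+n≤o⇒m≤o d p) x)) tmp input aux ⨾ test (is a) value input aux
  form {d} (rel A x y) p =
    forEach (elapsed (variableOf (m+n≤o⇒m≤o d p) x)) tmp (skipBy count tmp′ (table A) aux) ⨾
    skipBy (elapsed (variableOf (m+n≤o⇒m≤o d p) y)) tmp (table A) aux ⨾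
    test (is (bit true)) value (table A) aux
  form {d} (less xs z) p =
    lessC (map (variableOf (m+n≤o⇒m≤o d p)) xs) (variableOf (m+n≤o⇒m≤o d p) z)
  form (neg φ) p = negC (form φ p)
  form {d} (φ ∧ᶠ ψ) p = andC
    (form φ (≤-trans (+-monoʳ-≤ d (m≤m⊔n (heightF φ) (heightF ψ))) p))
    (form ψ (≤-trans (+-monoʳ-≤ d (m≤n⊔m (heightF φ) (heightF ψ))) p))
  form {d} (φ ∨ᶠ ψ) p = negC (andC
    (negC (form φ (≤-trans (+-monoʳ-≤ d (m≤m⊔n (heightF φ) (heightF ψ))) p)))
    (negC (form ψ (≤-trans (+-monoʳ-≤ d (m≤n⊔m (heightF φ) (heightF ψ))) p))))
  form {d} (ex φ) p  = exC (fromℕ< (m+n≤o⇒m≤o (suc d) (deeper d p))) (form φ (deeper d p))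
  form {d} (all φ) p = negC (exC (fromℕ< (m+n≤o⇒m≤o (suc d) (deeper d p))) (negC (form φ (deeper d p))))

  prog : ∀ {d} (P : Prog d) → d + height P ≤ D → Cmd
  -- The new matrix is collected on `fresh`, because `φ` may still read the old table `A`. It arises
  -- in reverse order, and the final move reverses it again.
  prog {d} (define A φ) p =
    forC (fromℕ< (m+n≤o⇒m≤o (1 + d) (deeper d p)))
      (forC (fromℕ< (m+n≤o⇒m≤o (2 + d) (deeper (suc d) (deeper d p))))
        (form φ (deeper (suc d) (deeper d p)) ⨾ transfer value fresh)) ⨾
    clear (table A) ⨾ moveAll fresh (table A)
  prog {d} (P ▹ Q) p =
    prog P (≤-trans (+-monoʳ-≤ d (m≤m⊔n (height P) (height Q))) p) ⨾
    prog Q (≤-trans (+-monoʳ-≤ d (m≤n⊔m (height P) (height Q))) p)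
  prog {d} (for P) p = forC (fromℕ< (m+n≤o⇒m≤o (suc d) (deeper d p))) (prog P (deeper d p))
  prog {d} (when φ P) p =
    form φ (≤-trans (+-monoʳ-≤ d (m≤m⊔n (heightF φ) (height P))) p) ⨾
    cond (is (bit true)) value
      (pop value ⨾ prog P (≤-trans (+-monoʳ-≤ d (m≤n⊔m (heightF φ) (height P))) p)) (pop value)
  prog (emit a) p = push output a

  -- The first loop counts the input in unary, and the extra push turns the length into `N`. At the
  -- end the output goes to the first tape, and this move turns the stored reverse order into the
  -- order of emission.
  whole : (P : Prog 0) → height P ≤ D → Cmd
  whole P p =
    while input (transfer input aux ⨾ push count (bit true)) ⨾ moveAll aux input ⨾
    push count (bit true) ⨾ prog P p ⨾ clear input ⨾ moveAll output input

forTime : ℕ → ℕ → ℕ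
forTime n t = forEachTime n 2 + (forEachTime n t + suc (n * 2))

module Cost (r : ℕ) where

  open Language r

  negTime : ℕ → ℕ
  negTime t = t + 4

  andTime : ℕ → ℕ → ℕ
  andTime t t′ = t + suc (1 + t′)

  exTime : ℕ → ℕ → ℕ
  exTime n t = 2 + forTime n (t + 5)

  skipsTime : ∀ {A : Set} → List A → ℕ → ℕ
  skipsTime []       n = 1
  skipsTime (x ∷ xs) n = forEachTime n 6 + skipsTime xs n

  formTime : ∀ {d} → Form d → ℕ → ℕ
  formTime (inp a x)   n = forEachTime n 6 + (3 + suc (n * 7))
  formTime (rel A x y) n =
    forEachTime n (forEachTime n 6) + (forEachTime n 6 + (3 + suc ((n * n + n) * 7)))
  formTime (less xs z) n = 2 + (skipsTime xs n + (3 + suc ((length xs * n) * 7)))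
  formTime (neg φ)     n = negTime (formTime φ n)
  formTime (φ ∧ᶠ ψ)    n = andTime (formTime φ n) (formTime ψ n)
  formTime (φ ∨ᶠ ψ)    n = negTime (andTime (negTime (formTime φ n)) (negTime (formTime ψ n)))
  formTime (ex φ)      n = exTime n (formTime φ n)
  formTime (all φ)     n = negTime (exTime n (negTime (formTime φ n)))

  progTime : ∀ {d} → Prog d → ℕ → ℕ
  progTime (define A φ) n =
    forTime n (forTime n (formTime φ n + 6)) + (suc ((n * n) * 2) + suc ((n * n) * 7))
  progTime (P ▹ Q)      n = progTime P n + progTime Q n
  progTime (for P)      n = forTime n (progTime P n)
  progTime (when φ P)   n = formTime φ n + suc (1 + progTime P n)
  progTime (emit a)     n = 2

-- Correctness and running time of compiled formulas.

≥⇒<ᵇ-false : ∀ {m n} → n ≤ m → (m <ᵇ n) ≡ false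
≥⇒<ᵇ-false {m} {n} n≤m = dec-false (m <? n) (≤⇒≯ n≤m)

nonempty-drop-ones : ∀ m n → nonempty (List.head (drop m (ones n))) ≡ (m <ᵇ n)
nonempty-drop-ones zero    zero    = refl
nonempty-drop-ones zero    (suc n) = refl
nonempty-drop-ones (suc m) zero    = refl
nonempty-drop-ones (suc m) (suc n) = nonempty-drop-ones m n

module Correctness (r D : ℕ) (w : List Letter) where

  open Language r
  open Semantics w
  open Compilation r D
  open Cost r

  -- Lookup by level instead of by index; `nothing` stands for a loop that is not running.
  clock : ∀ {d} → Vec ℕ d → ℕ → Maybe ℕ
  clock []                l = nothing
  clock {suc d} (v ∷ env) l = if does (l ≟ d) then just v else clock env l

  clock-here : ∀ {d} v (env : Vec ℕ d) → clock (v ∷ env) d ≡ just v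
  clock-here {d} v env rewrite dec-true (d ≟ d) refl = refl

  clock-there : ∀ {d} v (env : Vec ℕ d) {l} → l ≢ d → clock (v ∷ env) l ≡ clock env l
  clock-there {d} v env {l} l≢d rewrite dec-false (l ≟ d) l≢d = refl

  clock-idle : ∀ {d} (env : Vec ℕ d) {l} → d ≤ l → clock env l ≡ nothing
  clock-idle []        _   = refl
  clock-idle (v ∷ env) d<l = trans (clock-there v env (>⇒≢ d<l)) (clock-idle env (<⇒≤ d<l))

  toℕ-variableOf-< : ∀ {d} (p : d ≤ D) i → toℕ (variableOf p i) < d
  toℕ-variableOf-< {suc d} p zero    = s≤s (≤-reflexive (Fin.toℕ-fromℕ< p))
  toℕ-variableOf-< {suc d} p (suc i) = m<n⇒m<1+n (toℕ-variableOf-< (<⇒≤ p) i)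

  clock-variableOf : ∀ {d} (p : d ≤ D) (env : Vec ℕ d) i → clock env (toℕ (variableOf p i)) ≡ just (lookup env i)
  clock-variableOf p (v ∷ env) zero    = trans (cong (clock (v ∷ env)) (Fin.toℕ-fromℕ< p)) (clock-here v env)
  clock-variableOf p (v ∷ env) (suc i) =
    trans (clock-there v env (<⇒≢ (toℕ-variableOf-< (<⇒≤ p) i))) (clock-variableOf (<⇒≤ p) env i)

  record Content : Set where
    constructor content
    field
      tables  : Fin r → List Letter
      values  : List Letter
      scratch : List Letter
      emitted : List Letter

  open Content

  -- The memory layout between commands. The current round of a loop still counts as remaining, so a
  -- variable with value v has v letters elapsed and `N ∸ v` remaining.
  σ : ∀ {d} → Vec ℕ d → Content → Stack → List Letter
  σ env S input         = w
  σ env S count         = ones N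
  σ env S value         = values S
  σ env S fresh         = scratch S
  σ env S output        = emitted S
  σ env S aux           = []
  σ env S tmp           = []
  σ env S tmp′          = []
  σ env S (remaining x) = ones (maybe (N ∸_) 0 (clock env (toℕ x)))
  σ env S (elapsed x)   = ones (maybe id 0 (clock env (toℕ x)))
  σ env S (table A)     = tables S A

  Rep : ∀ {d} → Vec ℕ d → Content → Tapes → Set
  Rep env S ts = ∀ k → ts ‼ k ≡ σ env S k

  Rep-update : ∀ {d} {env : Vec ℕ d} {S S′ ts ts′ k xs} → Rep env S ts → Update ts k xs ts′ →
    xs ≡ σ env S′ k → (∀ j → j ≢ k → σ env S j ≡ σ env S′ j) → Rep env S′ ts′
  Rep-update {k = k} rep u eq same j with j ≟ᴵ k
  ... | yes refl = trans (this u) eq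
  ... | no j≢k   = trans (other u j≢k) (trans (rep j) (same j j≢k))

  withValues : List Letter → Content → Content
  withValues vs S = record S { values = vs }

  σ-values : ∀ {d} (env : Vec ℕ d) S vs j → j ≢ value → σ env S j ≡ σ env (withValues vs S) j
  σ-values env S vs input         _ = refl
  σ-values env S vs count         _ = refl
  σ-values env S vs value         p = contradiction refl p
  σ-values env S vs fresh         _ = refl
  σ-values env S vs output        _ = refl
  σ-values env S vs aux           _ = refl
  σ-values env S vs tmp           _ = refl
  σ-values env S vs tmp′          _ = refl
  σ-values env S vs (remaining x) _ = refl
  σ-values env S vs (elapsed x)   _ = refl
  σ-values env S vs (table A)     _ = refl

  σ-scratch : ∀ {d} (env : Vec ℕ d) S vs xs j → j ≢ value → j ≢ fresh →
              σ env S j ≡ σ env (record S { values = vs ; scratch = xs }) j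
  σ-scratch env S vs xs input         _ _ = refl
  σ-scratch env S vs xs count         _ _ = refl
  σ-scratch env S vs xs value         p _ = contradiction refl p
  σ-scratch env S vs xs fresh         _ p = contradiction refl p
  σ-scratch env S vs xs output        _ _ = refl
  σ-scratch env S vs xs aux           _ _ = refl
  σ-scratch env S vs xs tmp           _ _ = refl
  σ-scratch env S vs xs tmp′          _ _ = refl
  σ-scratch env S vs xs (remaining x) _ _ = refl
  σ-scratch env S vs xs (elapsed x)   _ _ = refl
  σ-scratch env S vs xs (table A)     _ _ = refl

  σ-emitted : ∀ {d} (env : Vec ℕ d) S xs j → j ≢ output → σ env S j ≡ σ env (record S { emitted = xs }) j
  σ-emitted env S xs input         _ = refl
  σ-emitted env S xs count         _ = refl
  σ-emitted env S xs value         _ = refl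
  σ-emitted env S xs fresh         _ = refl
  σ-emitted env S xs output        p = contradiction refl p
  σ-emitted env S xs aux           _ = refl
  σ-emitted env S xs tmp           _ = refl
  σ-emitted env S xs tmp′          _ = refl
  σ-emitted env S xs (remaining x) _ = refl
  σ-emitted env S xs (elapsed x)   _ = refl
  σ-emitted env S xs (table A)     _ = refl

  σ-clock : ∀ {d} v (env : Vec ℕ d) S {x} → toℕ x ≡ d → ∀ j → j ≢ remaining x → j ≢ elapsed x →
            σ env S j ≡ σ (v ∷ env) S j
  σ-clock v env S x≡d input         _ _ = refl
  σ-clock v env S x≡d count         _ _ = refl
  σ-clock v env S x≡d value         _ _ = refl
  σ-clock v env S x≡d fresh         _ _ = refl
  σ-clock v env S x≡d output        _ _ = refl
  σ-clock v env S x≡d aux           _ _ = refl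
  σ-clock v env S x≡d tmp           _ _ = refl
  σ-clock v env S x≡d tmp′          _ _ = refl
  σ-clock v env S x≡d (remaining y) p _ = cong (λ c → ones (maybe (N ∸_) 0 c))
    (sym (clock-there v env λ y≡d → p (cong remaining (Fin.toℕ-injective (trans y≡d (sym x≡d))))))
  σ-clock v env S x≡d (elapsed y)   _ p = cong (λ c → ones (maybe id 0 c))
    (sym (clock-there v env λ y≡d → p (cong elapsed (Fin.toℕ-injective (trans y≡d (sym x≡d))))))
  σ-clock v env S x≡d (table A)     _ _ = refl

  elapsed-variable : ∀ {d} {env : Vec ℕ d} {S ts} (p : d ≤ D) → Rep env S ts → ∀ i →
                     ts ‼ elapsed (variableOf p i) ≡ ones (lookup env i)
  elapsed-variable {env = env} p rep i =
    trans (rep (elapsed (variableOf p i))) (cong (λ c → ones (maybe id 0 c)) (clock-variableOf p env i))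

  -- The level of the new variable is the length of `env`. Hence its clock is idle outside of the
  -- loop, and inside the same stacks represent the extended environment.
  run-forC : ∀ {d} {env : Vec ℕ d} (p : d < D) {B t S ts} (K : ℕ → Content → Set) →
    (∀ {v S ts} → v < N → K v S → Rep (v ∷ env) S ts →
       Run B ts (λ ts′ → ∃[ S′ ] (K (suc v) S′ × Rep (v ∷ env) S′ ts′)) t) →
    K 0 S → Rep env S ts →
    Run (forC (fromℕ< p) B) ts (λ ts′ → ∃[ S′ ] (K N S′ × Rep env S′ ts′)) (forTime N t)
  run-forC {d} {env} p {B} {t} {S} {ts} K body k₀ rep =
    run-⨾ (run-forEach Filled (λ ()) (λ {v} → Filled-stable {v}) fill (rep count) (rep tmp)
             (trans (rep (remaining x)) (cong (λ c → ones (maybe (N ∸_) 0 c)) idle-x) , λ k _ _ _ → rep k))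
    λ (c≡ , t≡ , full , same) →
    run-⨾ (run-forEach Inv (λ ()) (λ {v} → Inv-stable {v}) round full
             (trans (same (elapsed x) (λ ()) (λ ()) (λ ())) (cong (λ c → ones (maybe id 0 c)) idle-x))
             (S , k₀ , rest c≡ t≡ same))
    λ {us} (c≡ , t≡ , S′ , k , same) → run-mono
      (s≤s (≤-reflexive (cong (_* 2) (trans (cong length c≡) (List.length-replicate N)))))
      (λ u → S′ , k , finish t≡ same u)
      run-clear
    where
    x : Fin D
    x = fromℕ< p
    x≡d : toℕ x ≡ d
    x≡d = Fin.toℕ-fromℕ< p
    idle-x : clock env (toℕ x) ≡ nothing
    idle-x = clock-idle env (≤-reflexive (sym x≡d))
    Filled : ℕ → Tapes → Set
    Filled v us = us ‼ remaining x ≡ ones v ×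
                  (∀ k → k ≢ remaining x → k ≢ count → k ≢ tmp → us ‼ k ≡ σ env S k)
    Filled-stable : ∀ {v us us′} → SameExcept₂ count tmp us us′ → Filled v us → Filled v us′
    Filled-stable same (r≡ , f) = trans (same _ (λ ()) (λ ())) r≡ ,
      λ k a b c → trans (same k b c) (f k a b c)
    fill : ∀ {v m us} → v + suc m ≡ N → us ‼ count ≡ ones (suc m) → us ‼ tmp ≡ ones v → Filled v us →
           Run (push (remaining x) (bit true)) us
             (λ us′ → us′ ‼ count ≡ us ‼ count × us′ ‼ tmp ≡ us ‼ tmp × Filled (suc v) us′) 2
    fill _ _ _ (r≡ , f) = run-mono ≤-refl
      (λ u → other u (λ ()) , other u (λ ()) , trans (this u) (cong (bit true ∷_) r≡) ,
             λ k a b c → trans (other u a) (f k a b c))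
      run-push
    rest : ∀ {us} → us ‼ count ≡ ones N → us ‼ tmp ≡ [] →
           (∀ k → k ≢ remaining x → k ≢ count → k ≢ tmp → us ‼ k ≡ σ env S k) →
           ∀ k → k ≢ remaining x → k ≢ elapsed x → us ‼ k ≡ σ env S k
    rest c≡ t≡ same k k≢r k≢e with k ≟ᴵ count | k ≟ᴵ tmp
    ... | yes refl | _        = c≡
    ... | no _     | yes refl = t≡
    ... | no k≢c   | no k≢t   = same k k≢r k≢c k≢t
    Inv : ℕ → Tapes → Set
    Inv v us = ∃[ S ] (K v S × (∀ k → k ≢ remaining x → k ≢ elapsed x → us ‼ k ≡ σ env S k))
    Inv-stable : ∀ {v us us′} → SameExcept₂ (remaining x) (elapsed x) us us′ → Inv v us → Inv v us′
    Inv-stable same (S , k , f) = S , k , λ i a b → trans (same i a b) (f i a b)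
    begin-round : ∀ {v m us S} → v + suc m ≡ N → us ‼ remaining x ≡ ones (suc m) → us ‼ elapsed x ≡ ones v →
                  (∀ k → k ≢ remaining x → k ≢ elapsed x → us ‼ k ≡ σ env S k) → Rep (v ∷ env) S us
    begin-round {v} {m} {us} {S} eq r≡ e≡ f k with k ≟ᴵ remaining x | k ≟ᴵ elapsed x
    ... | yes refl | _ = trans r≡ (cong ones (sym (trans
            (cong (maybe (N ∸_) 0) (trans (cong (clock (v ∷ env)) x≡d) (clock-here v env)))
            (trans (cong (_∸ v) (sym eq)) (m+n∸m≡n v (suc m))))))
    ... | no _ | yes refl = trans e≡ (cong ones (sym
            (cong (maybe id 0) (trans (cong (clock (v ∷ env)) x≡d) (clock-here v env)))))
    ... | no k≢r | no k≢e = trans (f k k≢r k≢e) (σ-clock v env S x≡d k k≢r k≢e)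
    round : ∀ {v m us} → v + suc m ≡ N → us ‼ remaining x ≡ ones (suc m) → us ‼ elapsed x ≡ ones v → Inv v us →
            Run B us (λ us′ → us′ ‼ remaining x ≡ us ‼ remaining x × us′ ‼ elapsed x ≡ us ‼ elapsed x × Inv
                (suc v) us′) t
    round {v} {m} {us} eq r≡ e≡ (S , k , f) with begin-round eq r≡ e≡ f
    ... | rep = run-mono ≤-refl
      (λ (S′ , k′ , rep′) → trans (rep′ (remaining x)) (sym (rep (remaining x))) ,
                            trans (rep′ (elapsed x)) (sym (rep (elapsed x))) ,
                            S′ , k′ , λ i a b → trans (rep′ i) (sym (σ-clock v env S′ x≡d i a b)))
      (body (≤-trans (m<m+n v z<s) (≤-reflexive eq)) k rep)
    finish : ∀ {S us us′} → us ‼ elapsed x ≡ [] →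
             (∀ k → k ≢ remaining x → k ≢ elapsed x → us ‼ k ≡ σ env S k) →
             Update us (remaining x) [] us′ → Rep env S us′
    finish t≡ same u k with k ≟ᴵ remaining x | k ≟ᴵ elapsed x
    ... | yes refl | _ = trans (this u) (sym (cong (λ c → ones (maybe (N ∸_) 0 c)) idle-x))
    ... | no k≢r | yes refl = trans (other u k≢r) (trans t≡ (sym (cong (λ c → ones (maybe id 0 c)) idle-x)))
    ... | no k≢r | no k≢e = trans (other u k≢r) (same k k≢r k≢e)

  Below : ∀ {d} → Vec ℕ d → Set
  Below env = ∀ i → lookup env i < N

  Below-∷ : ∀ {d v} {env : Vec ℕ d} → v < N → Below env → Below (v ∷ env)
  Below-∷ v<N below zero    = v<N
  Below-∷ v<N below (suc i) = below i

  -- Tables are stored row by row with rows of length `N`. Agreement is required within the range of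
  -- the variables only, as a table of the semantics is a function on all numbers.
  Models : (Fin r → List Letter) → Tables → Set
  Models tb ρ = ∀ A {a b} → a < N → b < N → is (bit true) (List.head (drop (a * N + b) (tb A))) ≡ ρ A a b

  pushValue : Bool → Content → Content
  pushValue b S = withValues (bit b ∷ values S) S

  Rep-answer : ∀ {d} {env : Vec ℕ d} {S ts ts′ b b′ vs} → Rep env S ts →
    Update ts value (bit b ∷ ts ‼ value) ts′ → b ≡ b′ → values S ≡ vs → Rep env (withValues (bit b′ ∷ vs) S) ts′
  Rep-answer {env = env} {S} rep u refl refl =
    Rep-update rep u (cong (_ ∷_) (rep value)) (σ-values env S _)

  Computes : ∀ {d} → Cmd → (Vec ℕ d → Tables → Bool) → ℕ → Set
  Computes C f t = ∀ {env S ρ ts} → Below env → Models (tables S) ρ → Rep env S ts →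
                   Run C ts (Rep env (pushValue (f env ρ) S)) t

  pop-push : ∀ {d} {env : Vec ℕ d} {S ts b vs} → Rep env S ts → ∀ {c} → values S ≡ c ∷ vs →
             Run (pop value ⨾ push value (bit b)) ts (Rep env (withValues (bit b ∷ vs) S)) 3
  pop-push {env = env} {S} {vs = vs} rep eq = run-⨾
    (run-mono {P = Update _ value vs} ≤-refl id (run-pop (trans (rep value) eq)))
    λ u → run-mono ≤-refl
      (λ u′ → Rep-update (Rep-update {S′ = withValues vs S} rep u refl (σ-values env S vs)) u′
                (cong (_ ∷_) (this u)) (σ-values env (withValues vs S) _))
      run-push

  run-pop-value : ∀ {d} {env : Vec ℕ d} {S ts vs} → Rep env S ts → ∀ {c} → values S ≡ c ∷ vs →
                  Run (pop value) ts (Rep env (withValues vs S)) 1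
  run-pop-value {env = env} {S} {vs = vs} rep eq = run-mono ≤-refl
    (λ u → Rep-update rep u refl (σ-values env S vs)) (run-pop (trans (rep value) eq))

  top-value : ∀ {d} {env : Vec ℕ d} {S ts} → Rep env S ts → ∀ {b vs} → values S ≡ bit b ∷ vs →
              is (bit true) (top ts value) ≡ b
  top-value rep {b} eq = trans (cong (is (bit true) ∘ List.head) (trans (rep value) eq)) (is-true b)
    where
    is-true : ∀ b → is (bit true) (just (bit b)) ≡ b
    is-true true  = refl
    is-true false = refl

  negC-correct : ∀ {d C t} {f : Vec ℕ d → Tables → Bool} → Computes C f t →
                 Computes (negC C) (λ env ρ → not (f env ρ)) (negTime t)
  negC-correct {f = f} correct {env} {S} {ρ} below models rep =
    run-⨾ (correct below models rep) λ rep₁ → run-cond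
      (λ is-1 → subst (λ b → Run _ _ (Rep env (pushValue b S)) 3)
        (cong not (trans (sym is-1) (top-value rep₁ refl))) (pop-push rep₁ refl))
      (λ is-0 → subst (λ b → Run _ _ (Rep env (pushValue b S)) 3)
        (cong not (trans (sym is-0) (top-value rep₁ refl))) (pop-push rep₁ refl))

  andC-correct : ∀ {d C C′ t t′} {f g : Vec ℕ d → Tables → Bool} → Computes C f t → Computes C′ g t′ →
                 Computes (andC C C′) (λ env ρ → f env ρ ∧ g env ρ) (andTime t t′)
  andC-correct {t′ = t′} {f} {g} correct correct′ {env} {S} {ρ} below models rep =
    run-⨾ (correct below models rep) λ rep₁ → run-cond
      (λ is-1 → subst (λ b → Run _ _ (Rep env (pushValue (b ∧ g env ρ) S)) (1 + t′))
        (trans (sym is-1) (top-value rep₁ refl))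
        (run-⨾ (run-pop-value rep₁ refl) λ rep₂ → correct′ below models rep₂))
      (λ is-0 → run-mono (s≤s z≤n) id (run-skip (subst (λ b → Rep env (pushValue (b ∧ g env ρ) S) _)
        (trans (sym is-0) (top-value rep₁ refl))
        (subst (λ b → Rep env (pushValue b S) _) (trans (sym (top-value rep₁ refl)) is-0) rep₁))))

  exC-correct : ∀ {d C t} {f : Vec ℕ (suc d) → Tables → Bool} (p : d < D) → Computes C f t →
                Computes (exC (fromℕ< p) C) (λ env ρ → anyBelow N (λ v → f (v ∷ env) ρ)) (exTime N t)
  exC-correct {C = C} {t} {f} p correct {env} {S} {ρ} below models rep =
    run-⨾ (run-mono ≤-refl (λ u → Rep-answer rep u refl refl) run-push) λ rep₁ →
    run-mono ≤-refl (λ { (_ , refl , rep′) → rep′ }) (run-forC p K body refl rep₁)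
    where
    upTo : ℕ → Bool
    upTo v = anyBelow v (λ u → f (u ∷ env) ρ)
    K : ℕ → Content → Set
    K v S′ = S′ ≡ pushValue (upTo v) S
    body : ∀ {v S′ ts} → v < N → K v S′ → Rep (v ∷ env) S′ ts →
      Run (C ⨾ cond (is (bit true)) value (pop value ⨾ pop value ⨾ push value (bit true)) (pop value)) ts
        (λ ts′ → ∃[ S″ ] (K (suc v) S″ × Rep (v ∷ env) S″ ts′)) (t + 5)
    body {v} v<N refl rep = run-⨾ (correct (Below-∷ v<N below) models rep) λ rep₁ → run-cond
      (λ is-1 → run-⨾ (run-pop-value rep₁ refl) λ rep₂ → run-mono ≤-refl
        (λ rep₃ → _ , cong (λ b → pushValue (b ∨ upTo v) S) (trans (sym is-1) (top-value rep₁ refl)) , rep₃)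
        (pop-push rep₂ refl))
      (λ is-0 → run-mono (m≤m+n 1 3)
        (λ rep₂ → _ , cong (λ b → pushValue (b ∨ upTo v) S) (trans (sym is-0) (top-value rep₁ refl)) , rep₂)
        (run-pop-value rep₁ refl))

  run-test-value : ∀ {d} {env : Vec ℕ d} {S ts us q x n b b′ t} → Rep env S ts → value ≢ x → x ≢ aux →
    Skipped x aux n ts us → q (List.head (drop n (σ env S x))) ≡ b → b ≡ b′ → 3 + suc (n * 7) ≤ t →
    Run (test q value x aux) us (Rep env (pushValue b′ S)) t
  run-test-value {q = q} {n = n} rep v≢x x≢a sk eq refl n≤t = run-mono n≤t
    (λ u → Rep-answer rep u (trans (cong (q ∘ List.head ∘ drop n) (rep _)) eq) refl)
    (run-test v≢x (λ ()) x≢a (rep aux) sk)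

  less-same : ∀ {d} (p : d ≤ D) (env : Vec ℕ d) xs z →
    any (λ x → does (x Fin.≟ variableOf p z)) (map (variableOf p) xs) ≡ true →
    lookup env z ≤ sum (map (lookup env) xs)
  less-same p env (x ∷ xs) z eq with variableOf p x Fin.≟ variableOf p z
  ... | no _  = ≤-trans (less-same p env xs z eq) (m≤n+m _ (lookup env x))
  ... | yes e = ≤-trans (≤-reflexive (just-injective (trans (sym (clock-variableOf p env z))
      (trans (cong (clock env ∘ toℕ) (sym e)) (clock-variableOf p env x))))) (m≤m+n (lookup env x) _)

  run-skipsC : ∀ {d} (p : d ≤ D) {env : Vec ℕ d} {S ts} xs z {n us} → Below env →
    any (λ x → does (x Fin.≟ z)) (map (variableOf p) xs) ≡ false → Rep env S ts →
    Skipped (elapsed z) aux n ts us →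
    Run (skipsC (map (variableOf p) xs) z) us (Skipped (elapsed z) aux (n + sum (map (lookup env) xs)) ts)
        (skipsTime xs N)
  run-skipsC p {env} [] z {n} {us} below eq rep sk =
    run-skip (subst (λ k → Skipped _ aux k _ us) (sym (+-identityʳ n)) sk)
  run-skipsC p {env} {ts = ts} (x ∷ xs) z {n} below eq rep sk = run-⨾
    (run-mono (forEachTime-monoˡ 6 (<⇒≤ (below x))) (Skipped-+ sk)
      (run-skipBy (λ ()) x≢z (λ ()) (λ ()) (λ ()) (λ ())
        (trans (Skipped.frame sk _ x≢z (λ ())) (elapsed-variable p rep x))
        (trans (Skipped.frame sk _ (λ ()) (λ ())) (rep tmp))))
    λ sk′ → run-mono ≤-refl (λ {us} → subst (λ k → Skipped (elapsed z) aux k ts us) (+-assoc n _ _))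
      (run-skipsC p xs z below (∨-conicalʳ _ _ eq) rep sk′)
    where
    x≢z : elapsed (variableOf p x) ≢ elapsed z
    x≢z refl with variableOf p x Fin.≟ variableOf p x | ∨-conicalˡ _ (any _ (map (variableOf p) xs)) eq
    ... | no ≢x | _ = contradiction refl ≢x

  sum-≤ : ∀ {d} {env : Vec ℕ d} → Below env → ∀ xs → sum (map (lookup env) xs) ≤ length xs * N
  sum-≤ below []       = z≤n
  sum-≤ {env = env} below (x ∷ xs) = +-mono-≤ (<⇒≤ (below x)) (sum-≤ {env = env} below xs)

  lessC-correct : ∀ {d} (p : d ≤ D) xs z →
    Computes (lessC (map (variableOf p) xs) (variableOf p z))
      (λ env _ → sum (map (lookup env) xs) <ᵇ lookup env z) (formTime (less xs z) N)
  lessC-correct p xs z {env} {S} below models rep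
    with any (λ x → does (x Fin.≟ variableOf p z)) (map (variableOf p) xs) in eq
  ... | true  = run-mono (m≤m+n 2 _)
      (λ u → Rep-answer rep u (sym (≥⇒<ᵇ-false (less-same p env xs z eq))) refl) run-push
  ... | false = run-mono (m≤n+m _ 2) id
    (run-⨾ (run-skipsC p xs (variableOf p z) below eq rep Skipped-zero) λ sk →
     run-test-value rep (λ ()) (λ ()) sk
       (trans (cong (nonempty ∘ List.head ∘ drop (sum (map (lookup env) xs)))
                (cong (λ c → ones (maybe id 0 c)) (clock-variableOf p env z)))
              (nonempty-drop-ones (sum (map (lookup env) xs)) (lookup env z)))
       refl (s≤s (s≤s (s≤s (s≤s (*-monoˡ-≤ 7 (sum-≤ {env = env} below xs)))))))

  form-correct : ∀ {d} (φ : Form d) (p : d + heightF φ ≤ D) → Computes (form φ p) (evalF φ) (formTime φ N)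
  form-correct {d} (inp a x) p {env} below models rep = run-⨾
    (run-mono (forEachTime-monoˡ 6 (<⇒≤ (below x))) id
      (run-skipBy (λ ()) (λ ()) (λ ()) (λ ()) (λ ()) (λ ())
        (elapsed-variable (m+n≤o⇒m≤o d p) rep x) (rep tmp)))
    λ sk → run-test-value rep (λ ()) (λ ()) sk refl refl
        (s≤s (s≤s (s≤s (s≤s (*-monoˡ-≤ 7 {lookup env x} (<⇒≤ (below x)))))))
  form-correct {d} (rel A x y) p {env} below models rep = run-⨾
    (run-mono (forEachTime-monoˡ (forEachTime N 6) (<⇒≤ (below x))) id
      (run-forEach-skip (λ ()) (λ ()) (λ ()) (λ ()) (λ ())
        (λ {us} same → run-skipBy (λ ()) (λ ()) (λ ()) (λ ()) (λ ()) (λ ())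
          (trans (same count (λ ()) (λ ()) (λ ()) (λ ())) (rep count))
          (trans (same tmp′ (λ ()) (λ ()) (λ ()) (λ ())) (rep tmp′)))
        (elapsed-variable (m+n≤o⇒m≤o d p) rep x) (rep tmp)))
    λ sk → run-⨾
      (run-mono (forEachTime-monoˡ 6 (<⇒≤ (below y))) (Skipped-+ sk)
        (run-skipBy (λ ()) (λ ()) (λ ()) (λ ()) (λ ()) (λ ())
          (trans (Skipped.frame sk _ (λ ()) (λ ())) (elapsed-variable (m+n≤o⇒m≤o d p) rep y))
          (trans (Skipped.frame sk _ (λ ()) (λ ())) (rep tmp))))
    λ sk′ → run-test-value rep (λ ()) (λ ()) sk′ (models A (below x) (below y)) refl
      (s≤s (s≤s (s≤s (s≤s (*-monoˡ-≤ 7 (+-mono-≤ (*-monoˡ-≤ N (<⇒≤ (below x))) (<⇒≤ (below y))))))))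
  form-correct {d} (less xs z) p = lessC-correct (m+n≤o⇒m≤o d p) xs z
  form-correct (neg φ) p = negC-correct (form-correct φ p)
  form-correct (φ ∧ᶠ ψ) p = andC-correct (form-correct φ _) (form-correct ψ _)
  form-correct (φ ∨ᶠ ψ) p {env} {ρ = ρ} below models rep = run-mono ≤-refl
    (λ {ts} → subst (λ b → Rep env (pushValue b _) ts) (de-morgan (evalF φ env ρ) (evalF ψ env ρ)))
    (negC-correct (andC-correct (negC-correct (form-correct φ _)) (negC-correct (form-correct ψ _))) below models rep)
    where
    de-morgan : ∀ a b → not (not a ∧ not b) ≡ a ∨ b
    de-morgan true  _ = refl
    de-morgan false b = not-involutive b
  form-correct {d} (ex φ) p = exC-correct (m+n≤o⇒m≤o (suc d) (deeper d p)) (form-correct φ (deeper d p))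
  form-correct {d} (all φ) p =
    negC-correct (exC-correct (m+n≤o⇒m≤o (suc d) (deeper d p)) (negC-correct (form-correct φ (deeper d p))))

-- Tables as strings, and correctness of compiled programs.

rowʳ : (ℕ → Bool) → ℕ → List Letter
rowʳ f zero    = []
rowʳ f (suc b) = bit (f b) ∷ rowʳ f b

matrixʳ : ℕ → (ℕ → ℕ → Bool) → ℕ → List Letter
matrixʳ n f zero    = []
matrixʳ n f (suc a) = rowʳ (f a) n ++ matrixʳ n f a

length-rowʳ : ∀ f b → length (rowʳ f b) ≡ b
length-rowʳ f zero    = refl
length-rowʳ f (suc b) = cong suc (length-rowʳ f b)

length-matrixʳ : ∀ n f a → length (matrixʳ n f a) ≡ a * n
length-matrixʳ n f zero    = refl
length-matrixʳ n f (suc a) = trans (List.length-++ (rowʳ (f a) n))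
  (cong₂ _+_ (length-rowʳ (f a) n) (length-matrixʳ n f a))

drop-ʳ++ : ∀ {A : Set} (xs : List A) {ys} k → drop (length xs + k) (xs ʳ++ ys) ≡ drop k ys
drop-ʳ++ []       k = refl
drop-ʳ++ (x ∷ xs) {ys} k = trans (cong (λ m → drop m (xs ʳ++ (x ∷ ys))) (sym (+-suc (length xs) k)))
  (drop-ʳ++ xs (suc k))

head-rowʳ : ∀ f {b n} ys → b < n → List.head (drop b (rowʳ f n ʳ++ ys)) ≡ just (bit (f b))
head-rowʳ f {b} {suc n} ys b<1+n with m<1+n⇒m<n∨m≡n b<1+n
... | inj₁ b<n  = head-rowʳ f _ b<n
... | inj₂ refl = cong List.head (trans
  (cong (λ m → drop m (rowʳ f b ʳ++ (bit (f b) ∷ ys))) (sym (trans (+-identityʳ _) (length-rowʳ f b))))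
  (drop-ʳ++ (rowʳ f b) 0))

head-matrixʳ : ∀ {n} f {a b m} ys → a < m → b < n →
               List.head (drop (a * n + b) (matrixʳ n f m ʳ++ ys)) ≡ just (bit (f a b))
head-matrixʳ {n} f {a} {b} {suc m} ys a<1+m b<n rewrite List.++-ʳ++ (rowʳ (f m) n) {matrixʳ n f m} {ys}
  with m<1+n⇒m<n∨m≡n a<1+m
... | inj₁ a<m  = head-matrixʳ f _ a<m b<n
... | inj₂ refl = trans
  (cong List.head (trans
    (cong (λ l → drop (l + b) (matrixʳ n f a ʳ++ (rowʳ (f a) n ʳ++ ys))) (sym (length-matrixʳ n f a)))
    (drop-ʳ++ (matrixʳ n f a) b)))
  (head-rowʳ (f a) ys b<n)

module ProgramCorrectness (r D : ℕ) (w : List Letter) where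

  open Language r
  open Semantics w
  open Compilation r D
  open Cost r
  open Correctness r D w
  open Content

  record Valid (s : Store) (vs : List Letter) (S : Content) : Set where
    constructor valid
    field
      models    : Models (tables S) (proj₁ s)
      -- Serves the time bound: redefining a table first clears the old one. An inequality, since
      -- tables are empty before their first definition.
      small     : ∀ A → length (tables S A) ≤ N * N
      emitted≡  : emitted S ≡ proj₂ s
      scratch≡  : scratch S ≡ []
      values≡   : values S ≡ vs

  Rep-transfer : ∀ {d} {env : Vec ℕ d} {S ts ts′ b} →
    Rep env (pushValue b S) ts → Transferred value fresh ts ts′ →
    Rep env (record S { scratch = bit b ∷ scratch S }) ts′
  Rep-transfer {env = env} {S} {b = b} rep tr j with j ≟ᴵ value | j ≟ᴵ fresh
  ... | yes refl | _        = trans (source tr) (cong (drop 1) (rep value))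
  ... | no _     | yes refl = trans (target tr) (cong₂ (λ x y → take 1 x ++ y) (rep value) (rep fresh))
  ... | no j≢v   | no j≢f   = trans (frame tr j j≢v j≢f)
        (trans (rep j) (σ-scratch env (pushValue b S) (values S) (bit b ∷ scratch S) j j≢v j≢f))

  replace : Fin r → List Letter → Content → Content
  replace A xs S = record S { tables = λ B → if does (B Fin.≟ A) then xs else tables S B ; scratch = [] }

  replace-same : ∀ A xs S → tables (replace A xs S) A ≡ xs
  replace-same A xs S rewrite dec-true (A Fin.≟ A) refl = refl

  σ-table : ∀ {d} (env : Vec ℕ d) S A xs j → j ≢ table A → j ≢ fresh → σ env S j ≡ σ env (replace A xs S) j
  σ-table env S A xs input         _ _ = refl
  σ-table env S A xs count         _ _ = refl
  σ-table env S A xs value         _ _ = refl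
  σ-table env S A xs fresh         _ p = contradiction refl p
  σ-table env S A xs output        _ _ = refl
  σ-table env S A xs aux           _ _ = refl
  σ-table env S A xs tmp           _ _ = refl
  σ-table env S A xs tmp′          _ _ = refl
  σ-table env S A xs (remaining x) _ _ = refl
  σ-table env S A xs (elapsed x)   _ _ = refl
  σ-table env S A xs (table B)     p _ rewrite dec-false (B Fin.≟ A) (λ { refl → p refl }) = refl

  Models-replace : ∀ {S ρ} A f → Models (tables S) ρ →
                   Models (tables (replace A (matrixʳ N f N ʳ++ []) S)) (ρ [ A ↦ f ])
  Models-replace A f models B {a} {b} a<N b<N with does (B Fin.≟ A)
  ... | false = models B a<N b<N
  ... | true  = trans (cong (is (bit true)) (head-matrixʳ f [] a<N b<N)) (is-bit (f a b))
    where
    is-bit : ∀ c → is (bit true) (just (bit c)) ≡ c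
    is-bit true  = refl
    is-bit false = refl

  length-replace : ∀ {S} A f → (∀ B → length (tables S B) ≤ N * N) →
                   ∀ B → length (tables (replace A (matrixʳ N f N ʳ++ []) S) B) ≤ N * N
  length-replace A f small B with does (B Fin.≟ A)
  ... | false = small B
  ... | true  = ≤-reflexive (trans (List.length-ʳ++ (matrixʳ N f N)) (trans (+-identityʳ _) (length-matrixʳ N f N)))

  prog-correct : ∀ {d} (P : Prog d) (p : d + height P ≤ D) {env S s vs ts} → Below env → Valid s vs S →
    Rep env S ts → Run (prog P p) ts (λ ts′ → ∃[ S′ ] (Valid (exec P env s) vs S′ × Rep env S′ ts′)) (progTime P N)
  prog-correct {d} (define A φ) p {env} {content tb vs .[] o} {ρ , o} below (valid models small refl refl refl) rep =
    run-⨾ (run-forC (m+n≤o⇒m≤o (1 + d) (deeper d p)) Rows (λ {v} {S′} {ts} → rows {v} {S′} {ts}) refl rep)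
    λ { {us} (_ , refl , rep₁) →
      run-⨾ (run-mono (s≤s (*-monoˡ-≤ 2 (≤-trans (≤-reflexive (cong length (rep₁ (table A)))) (small A)))) id
          run-clear)
      λ {us′} u → run-mono
        (s≤s (*-monoˡ-≤ 7 (≤-reflexive
          (trans (cong length (trans (other u (λ ())) (rep₁ fresh))) (length-matrixʳ N f N)))))
        (λ mv → _ , valid (Models-replace {S₀} A f models) (length-replace {S₀} A f small) refl refl refl ,
          finish rep₁ u mv)
        (run-moveAll (λ ())) }
    where
    f : ℕ → ℕ → Bool
    f a b = evalF φ (b ∷ a ∷ env) ρ
    S₀ : Content
    S₀ = content tb vs [] o
    Rows : ℕ → Content → Set
    Rows a S′ = S′ ≡ content tb vs (matrixʳ N f a) o
    Row : ℕ → ℕ → Content → Set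
    Row a b S′ = S′ ≡ content tb vs (rowʳ (f a) b ++ matrixʳ N f a) o
    cells : ∀ {a b S′ ts} → a < N → b < N → Row a b S′ → Rep (b ∷ a ∷ env) S′ ts →
      Run (form φ (deeper (suc d) (deeper d p)) ⨾ transfer value fresh) ts
        (λ ts′ → ∃[ S″ ] (Row a (suc b) S″ × Rep (b ∷ a ∷ env) S″ ts′)) (formTime φ N + 6)
    cells a<N b<N refl rep = run-⨾
        (form-correct φ (deeper (suc d) (deeper d p)) (Below-∷ b<N (Below-∷ a<N below)) models rep)
      λ rep₁ → run-mono ≤-refl (λ tr → _ , refl , Rep-transfer rep₁ tr) (run-transfer (λ ()))
    rows : ∀ {a S′ ts} → a < N → Rows a S′ → Rep (a ∷ env) S′ ts →
      Run (forC (fromℕ< (m+n≤o⇒m≤o (2 + d) (deeper (suc d) (deeper d p))))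
          (form φ (deeper (suc d) (deeper d p)) ⨾ transfer value fresh)) ts
        (λ ts′ → ∃[ S″ ] (Rows (suc a) S″ × Rep (a ∷ env) S″ ts′)) (forTime N (formTime φ N + 6))
    rows {a} a<N refl rep = run-forC (m+n≤o⇒m≤o (2 + d) (deeper (suc d) (deeper d p))) (Row a) (cells a<N) refl rep
    finish : ∀ {us us′ us″} → Rep env (content tb vs (matrixʳ N f N) o) us → Update us (table A) [] us′ →
             MovedAll fresh (table A) us′ us″ → Rep env (replace A (matrixʳ N f N ʳ++ []) S₀) us″
    finish {us} {us′} rep₁ u mv j with j ≟ᴵ fresh | j ≟ᴵ table A
    ... | yes refl | _        = MovedAll.source mv
    ... | no _     | yes refl = trans (MovedAll.target mv)
            (trans (cong₂ _ʳ++_ (trans (other u (λ ())) (rep₁ fresh)) (this u)) (sym (replace-same A _ S₀)))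
    ... | no j≢f   | no j≢A   = trans (MovedAll.frame mv j j≢f j≢A)
            (trans (other u j≢A) (trans (rep₁ j) (σ-table env (content tb vs (matrixʳ N f N) o) A _ j j≢A j≢f)))
  prog-correct (P ▹ Q) p below v rep = run-⨾ (prog-correct P _ below v rep)
    λ (S′ , v′ , rep′) → prog-correct Q _ below v′ rep′
  prog-correct {d} (for P) p {env} {s = s} {vs} below v rep = run-forC (m+n≤o⇒m≤o (suc d) (deeper d p))
    (λ k → Valid (loop k (λ u → exec P (u ∷ env)) s) vs)
    (λ v<N valid rep → prog-correct P (deeper d p) (Below-∷ v<N below) valid rep) v rep
  prog-correct {d} (when φ P) p {env} {S} {s} below v@(valid models small o≡ s≡ v≡) rep =
    run-⨾ (form-correct φ (≤-trans (+-monoʳ-≤ d (m≤m⊔n (heightF φ) (height P))) p) below models rep) λ rep₁ → run-cond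
      (λ is-1 → run-⨾ (run-pop-value rep₁ refl) λ rep₂ →
        subst (λ b → Run _ _ (λ ts′ → ∃[ S′ ] (Valid (if b then exec P env s else s) _ S′ × Rep env S′ ts′))
            (progTime P N))
          (trans (sym is-1) (top-value rep₁ refl)) (prog-correct P _ below v rep₂))
      (λ is-0 → run-mono (m≤m+n 1 _)
        (λ rep₂ → S , subst (λ b → Valid (if b then exec P env s else s) _ S)
          (trans (sym is-0) (top-value rep₁ refl)) v , rep₂)
        (run-pop-value rep₁ refl))
  prog-correct (emit a) p {env} {S} below (valid models small o≡ s≡ v≡) rep = run-mono ≤-refl
    (λ u → _ , valid models small (cong (a ∷_) o≡) s≡ v≡ ,
           Rep-update rep u (cong (a ∷_) (rep output)) (σ-emitted env S (a ∷ emitted S)))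
    run-push

  n≤forEachTime : ∀ n t → n * t ≤ forEachTime n t
  n≤forEachTime n t = ≤-trans (*-monoʳ-≤ n (≤-trans (m≤m+n t 6) (n≤1+n _))) (≤-trans (n≤1+n _) (m≤m+n _ _))

  n≤forTime : ∀ n t → n * t ≤ forTime n t
  n≤forTime n t = ≤-trans (n≤forEachTime n t) (≤-trans (m≤m+n _ _) (m≤n+m _ (forEachTime n 2)))

  -- Moving the output to the first tape takes time proportional to its length, which is therefore
  -- bounded by the running time that produced it.
  length-emitted : ∀ {d} (P : Prog d) (env : Vec ℕ d) s →
                   length (proj₂ (exec P env s)) ≤ progTime P N + length (proj₂ s)
  length-emitted (define A φ) env s = m≤n+m _ _
  length-emitted (P ▹ Q) env s = ≤-trans (length-emitted Q env _)
    (≤-trans (+-monoʳ-≤ (progTime Q N) (length-emitted P env s))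
      (≤-reflexive (trans (sym (+-assoc (progTime Q N) (progTime P N) _))
        (cong (_+ length (proj₂ s)) (+-comm (progTime Q N) (progTime P N))))))
  length-emitted (for P) env s = ≤-trans (rounds N) (+-monoˡ-≤ (length (proj₂ s)) (n≤forTime N (progTime P N)))
    where
    rounds : ∀ n → length (proj₂ (loop n (λ v → exec P (v ∷ env)) s)) ≤ n * progTime P N + length (proj₂ s)
    rounds zero    = ≤-refl
    rounds (suc n) = ≤-trans (length-emitted P (n ∷ env) _)
      (≤-trans (+-monoʳ-≤ (progTime P N) (rounds n)) (≤-reflexive (sym (+-assoc (progTime P N) _ _))))
  length-emitted (when φ P) env s with evalF φ env (proj₁ s)
  ... | false = m≤n+m _ _
  ... | true  = ≤-trans (length-emitted P env s)
    (+-monoˡ-≤ (length (proj₂ s)) (≤-trans (m≤n+m _ 2) (m≤n+m _ (formTime φ N))))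
  length-emitted (emit a) env s = +-monoˡ-≤ (length (proj₂ s)) {1} {2} (s≤s z≤n)

  wholeTime : Prog 0 → ℕ
  wholeTime P = suc (length w * 9) + (suc (length w * 7) +
    (2 + (progTime P N + (suc (length w * 2) + suc (progTime P N * 7)))))

  whole-correct : (P : Prog 0) (p : height P ≤ D) → ∀ {ts} → ts ‼ input ≡ w → (∀ k → k ≢ input → ts ‼ k ≡ []) →
                  Run (whole P p) ts (λ ts′ → ts′ ‼ input ≡ result P w) (wholeTime P)
  whole-correct P p {ts} input≡ empty =
    run-⨾ (run-while Read (λ (l , _) → l) read (length w)
            (cong length input≡ , trans (empty count (λ ())) (sym (cong (ones ∘ length) (empty aux (λ ())))) ,
             cong (λ xs → length xs + length w) (empty aux (λ ())) , cong₂ _ʳ++_ (empty aux (λ ())) input≡ ,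
                 λ k a _ _ → empty k a))
    λ {us} (l , c , la , back , same) →
    run-⨾ (run-mono (s≤s (≤-reflexive (cong (_* 7) (trans (sym (+-identityʳ _)) la)))) id (run-moveAll (λ ())))
    λ mv → run-⨾ (run-push {i = count} {bit true})
    λ u → run-⨾ (prog-correct P p {[]} {content (λ _ → []) [] [] []} {initialStore} {[]}
            (λ ()) (valid (λ A {a} {b} _ _ → empty-table (a * N + b)) (λ _ → z≤n) refl refl refl)
              (initially l c la back same mv u))
    λ { {us₁} (S′ , v , rep) → run-⨾
      (run-mono (s≤s (≤-reflexive (cong (λ xs → length xs * 2) (rep input)))) id run-clear)
      λ u′ → run-mono
        (s≤s (*-monoˡ-≤ 7 (≤-trans (≤-reflexive (cong length (emitted-all v rep u′)))
          (≤-trans (length-emitted P [] _) (≤-reflexive (+-identityʳ _))))))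
        (λ mv′ → trans (MovedAll.target mv′)
          (trans (cong₂ _ʳ++_ (emitted-all v rep u′) (this u′)) (sym (result-def P w))))
        (run-moveAll (λ ())) }
    where
    -- An empty stack is read as the table that is false everywhere, so the initial tables need no
    -- preparation.
    empty-table : ∀ n → is (bit true) (List.head (drop n [])) ≡ false
    empty-table zero    = refl
    empty-table (suc n) = refl
    Read : ℕ → Tapes → Set
    Read m us = length (us ‼ input) ≡ m × us ‼ count ≡ ones (length (us ‼ aux)) × length (us ‼ aux) + m ≡ length w ×
      us ‼ aux ʳ++ us ‼ input ≡ w × (∀ k → k ≢ input → k ≢ aux → k ≢ count → us ‼ k ≡ [])
    read : ∀ {m us} → Read (suc m) us → Run (transfer input aux ⨾ push count (bit true)) us (Read m) 8
    read {m} {us} (l , c , la , back , same) with us ‼ input in eq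
    ... | a ∷ xs = run-⨾ (run-transfer (λ ())) λ {us₁} tr → run-mono ≤-refl (λ {us₂} u → after tr u) run-push
      where
      after : ∀ {us₁ us₂} → Transferred input aux us us₁ → Update us₁ count (bit true ∷ us₁ ‼ count) us₂ → Read m us₂
      after {us₁} {us₂} tr u = trans (cong length input₂) (suc-injective l) ,
        trans (this u) (trans (cong (bit true ∷_) (trans (frame tr count (λ ()) (λ ())) c))
            (cong (ones ∘ length) (sym aux₂))) ,
        trans (cong (λ xs → length xs + m) aux₂) (trans (sym (+-suc _ m)) la) ,
        trans (cong₂ _ʳ++_ aux₂ input₂) back ,
        λ k k≢i k≢a k≢c → trans (other u k≢c) (trans (frame tr k k≢i k≢a) (same k k≢i k≢a k≢c))
        where
        input₂ : us₂ ‼ input ≡ xs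
        input₂ = trans (other u (λ ())) (trans (source tr) (cong (drop 1) eq))
        aux₂ : us₂ ‼ aux ≡ a ∷ us ‼ aux
        aux₂ = trans (other u (λ ())) (trans (target tr) (cong (λ xs → take 1 xs ++ us ‼ aux) eq))
    initially : ∀ {us us₁ us₂} → length (us ‼ input) ≡ 0 → us ‼ count ≡ ones (length (us ‼ aux)) →
      length (us ‼ aux) + 0 ≡ length w → us ‼ aux ʳ++ us ‼ input ≡ w →
      (∀ k → k ≢ input → k ≢ aux → k ≢ count → us ‼ k ≡ []) → MovedAll aux input us us₁ →
      Update us₁ count (bit true ∷ us₁ ‼ count) us₂ → Rep [] (content (λ _ → []) [] [] []) us₂
    initially {us} {us₁} {us₂} l c la back same mv u = rep
      where
      others : ∀ k → k ≢ input → k ≢ aux → k ≢ count → us₂ ‼ k ≡ []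
      others k k≢i k≢a k≢c = trans (other u k≢c) (trans (MovedAll.frame mv k k≢a k≢i) (same k k≢i k≢a k≢c))
      rep : Rep [] (content (λ _ → []) [] [] []) us₂
      rep input         = trans (other u (λ ())) (trans (MovedAll.target mv) back)
      rep count         = trans (this u) (trans
                            (cong (bit true ∷_) (trans (MovedAll.frame mv count (λ ()) (λ ()))
                              (trans c (cong ones (trans (sym (+-identityʳ _)) la)))))
                            (cong ones (sym N-def)))
      rep aux           = trans (other u (λ ())) (MovedAll.source mv)
      rep value         = others value (λ ()) (λ ()) (λ ())
      rep fresh         = others fresh (λ ()) (λ ()) (λ ())
      rep output        = others output (λ ()) (λ ()) (λ ())
      rep tmp           = others tmp (λ ()) (λ ()) (λ ())
      rep tmp′          = others tmp′ (λ ()) (λ ()) (λ ())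
      rep (remaining x) = others (remaining x) (λ ()) (λ ()) (λ ())
      rep (elapsed x)   = others (elapsed x) (λ ()) (λ ()) (λ ())
      rep (table A)     = others (table A) (λ ()) (λ ()) (λ ())
    emitted-all : ∀ {S′ us us′ xs} → Valid (exec P [] initialStore) [] S′ → Rep [] S′ us →
      Update us input xs us′ → us′ ‼ output ≡ proj₂ (exec P [] initialStore)
    emitted-all v rep u = trans (other u (λ ())) (trans (rep output) (Valid.emitted≡ v))

-- Polynomial bounds

_+ᴾ_ : Polynomial → Polynomial → Polynomial
[]      +ᴾ q       = q
(a ∷ p) +ᴾ []      = a ∷ p
(a ∷ p) +ᴾ (b ∷ q) = a + b ∷ p +ᴾ q

_*ᴾ_ : Polynomial → Polynomial → Polynomial
[]      *ᴾ q = []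
(a ∷ p) *ᴾ q = map (a *_) q +ᴾ (0 ∷ p *ᴾ q)

eval-+ᴾ : ∀ p q n → eval (p +ᴾ q) n ≡ eval p n + eval q n
eval-+ᴾ []      q       n = refl
eval-+ᴾ (a ∷ p) []      n = sym (+-identityʳ _)
eval-+ᴾ (a ∷ p) (b ∷ q) n rewrite eval-+ᴾ p q n | *-distribˡ-+ n (eval p n) (eval q n) =
  +-interchange a b (n * eval p n) (n * eval q n)
  where
  +-interchange : ∀ a b c d → a + b + (c + d) ≡ a + c + (b + d)
  +-interchange a b c d = begin
    a + b + (c + d)   ≡⟨ +-assoc a b (c + d) ⟩
    a + (b + (c + d)) ≡⟨ cong (a +_) (+-assoc b c d) ⟨
    a + (b + c + d)   ≡⟨ cong (λ x → a + (x + d)) (+-comm b c) ⟩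
    a + (c + b + d)   ≡⟨ cong (a +_) (+-assoc c b d) ⟩
    a + (c + (b + d)) ≡⟨ +-assoc a c (b + d) ⟨
    a + c + (b + d)   ∎
    where open ≡-Reasoning

eval-scale : ∀ a q n → eval (map (a *_) q) n ≡ a * eval q n
eval-scale a []      n = sym (*-zeroʳ a)
eval-scale a (b ∷ q) n rewrite eval-scale a q n = begin
  a * b + n * (a * eval q n) ≡⟨ cong (a * b +_) (*-assoc n a _) ⟨
  a * b + n * a * eval q n   ≡⟨ cong (λ x → a * b + x * eval q n) (*-comm n a) ⟩
  a * b + a * n * eval q n   ≡⟨ cong (a * b +_) (*-assoc a n _) ⟩
  a * b + a * (n * eval q n) ≡⟨ *-distribˡ-+ a b _ ⟨
  a * (b + n * eval q n)     ∎
  where open ≡-Reasoning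

eval-*ᴾ : ∀ p q n → eval (p *ᴾ q) n ≡ eval p n * eval q n
eval-*ᴾ []      q n = refl
eval-*ᴾ (a ∷ p) q n rewrite eval-+ᴾ (map (a *_) q) (0 ∷ p *ᴾ q) n | eval-scale a q n | eval-*ᴾ p q n =
  trans (cong (a * eval q n +_) (sym (*-assoc n (eval p n) (eval q n)))) (sym (*-distribʳ-+ (eval q n) a _))

record PolynomiallyBounded (f : ℕ → ℕ) : Set where
  constructor _,_
  field
    polynomial : Polynomial
    bound      : ∀ n → f n ≤ eval polynomial n

open PolynomiallyBounded

pb-const : ∀ c → PolynomiallyBounded (λ _ → c)
pb-const c = c ∷ [] , λ n → m≤m+n c _

pb-id : PolynomiallyBounded id
pb-id = 0 ∷ 1 ∷ [] , λ n → ≤-reflexive (sym (trans (cong (λ x → n * suc x) (*-zeroʳ n)) (*-identityʳ n)))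

pb-+ : ∀ {f g} → PolynomiallyBounded f → PolynomiallyBounded g → PolynomiallyBounded (λ n → f n + g n)
pb-+ (p , f≤) (q , g≤) = p +ᴾ q , λ n → ≤-trans (+-mono-≤ (f≤ n) (g≤ n)) (≤-reflexive (sym (eval-+ᴾ p q n)))

pb-* : ∀ {f g} → PolynomiallyBounded f → PolynomiallyBounded g → PolynomiallyBounded (λ n → f n * g n)
pb-* (p , f≤) (q , g≤) = p *ᴾ q , λ n → ≤-trans (*-mono-≤ (f≤ n) (g≤ n)) (≤-reflexive (sym (eval-*ᴾ p q n)))

-- Program times are expressed in `N`, which exceeds the input length by one; this substitution
-- returns to the length.
pb-sucʳ : ∀ {f} → PolynomiallyBounded f → PolynomiallyBounded (λ n → f (suc n))
pb-sucʳ {f} (p , f≤) with shifted p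
  where
  shifted : ∀ p → PolynomiallyBounded (λ n → eval p (suc n))
  shifted []      = pb-const 0
  shifted (a ∷ p) = pb-+ (pb-const a) (pb-* (pb-+ (pb-const 1) pb-id) (shifted p))
... | q , p≤ = q , λ n → ≤-trans (f≤ (suc n)) (p≤ n)

pb-suc : ∀ {f} → PolynomiallyBounded f → PolynomiallyBounded (λ n → suc (f n))
pb-suc = pb-+ (pb-const 1)

pb-forEachTime : ∀ {f t} → PolynomiallyBounded f → PolynomiallyBounded t →
                 PolynomiallyBounded (λ n → forEachTime (f n) (t n))
pb-forEachTime f t = pb-+ (pb-suc (pb-* f (pb-suc (pb-+ t (pb-const 6))))) (pb-suc (pb-* f (pb-const 7)))

pb-forTime : ∀ {t} → PolynomiallyBounded t → PolynomiallyBounded (λ n → forTime n (t n))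
pb-forTime t = pb-+ (pb-forEachTime pb-id (pb-const 2))
  (pb-+ (pb-forEachTime pb-id t) (pb-suc (pb-* pb-id (pb-const 2))))

module Compiler (r : ℕ) where

  open Language r
  open Cost r

  pb-negTime : ∀ {t} → PolynomiallyBounded t → PolynomiallyBounded (λ n → negTime (t n))
  pb-negTime t = pb-+ t (pb-const 4)

  pb-andTime : ∀ {t u} → PolynomiallyBounded t → PolynomiallyBounded u →
      PolynomiallyBounded (λ n → andTime (t n) (u n))
  pb-andTime t u = pb-+ t (pb-+ (pb-const 2) u)

  pb-exTime : ∀ {t} → PolynomiallyBounded t → PolynomiallyBounded (λ n → exTime n (t n))
  pb-exTime t = pb-+ (pb-const 2) (pb-forTime (pb-+ t (pb-const 5)))

  pb-skipsTime : ∀ {A : Set} (xs : List A) → PolynomiallyBounded (skipsTime xs)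
  pb-skipsTime []       = pb-const 1
  pb-skipsTime (x ∷ xs) = pb-+ (pb-forEachTime pb-id (pb-const 6)) (pb-skipsTime xs)

  pb-formTime : ∀ {d} (φ : Form d) → PolynomiallyBounded (formTime φ)
  pb-formTime (inp a x)   = pb-+ (pb-forEachTime pb-id (pb-const 6)) (pb-+ (pb-const 4) (pb-* pb-id (pb-const 7)))
  pb-formTime (rel A x y) = pb-+ (pb-forEachTime pb-id (pb-forEachTime pb-id (pb-const 6)))
    (pb-+ (pb-forEachTime pb-id (pb-const 6))
      (pb-+ (pb-const 4) (pb-* (pb-+ (pb-* pb-id pb-id) pb-id) (pb-const 7))))
  pb-formTime (less xs z) = pb-+ (pb-const 2) (pb-+ (pb-skipsTime xs)
    (pb-+ (pb-const 4) (pb-* (pb-* (pb-const (length xs)) pb-id) (pb-const 7))))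
  pb-formTime (neg φ)     = pb-negTime (pb-formTime φ)
  pb-formTime (φ ∧ᶠ ψ)    = pb-andTime (pb-formTime φ) (pb-formTime ψ)
  pb-formTime (φ ∨ᶠ ψ)    = pb-negTime (pb-andTime (pb-negTime (pb-formTime φ)) (pb-negTime (pb-formTime ψ)))
  pb-formTime (ex φ)      = pb-exTime (pb-formTime φ)
  pb-formTime (all φ)     = pb-negTime (pb-exTime (pb-negTime (pb-formTime φ)))

  pb-progTime : ∀ {d} (P : Prog d) → PolynomiallyBounded (progTime P)
  pb-progTime (define A φ) = pb-+ (pb-forTime (pb-forTime (pb-+ (pb-formTime φ) (pb-const 6))))
    (pb-+ (pb-suc (pb-* (pb-* pb-id pb-id) (pb-const 2))) (pb-suc (pb-* (pb-* pb-id pb-id) (pb-const 7))))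
  pb-progTime (P ▹ Q)      = pb-+ (pb-progTime P) (pb-progTime Q)
  pb-progTime (for P)      = pb-forTime (pb-progTime P)
  pb-progTime (when φ P)   = pb-+ (pb-formTime φ) (pb-+ (pb-const 2) (pb-progTime P))
  pb-progTime (emit a)     = pb-const 2

  module _ (P : Prog 0) where

    open Compilation r (height P)

    machineOf : Machine
    machineOf = machine input (whole P ≤-refl)

    open Machine machineOf using (run; initial; Accepts) renaming (output to machineOutput)

    -- The time `wholeTime` in terms of the input length, with the one step added that chooses the
    -- final state.
    pb-time : PolynomiallyBounded λ n → suc (suc (n * 9) + (suc (n * 7) +
      (2 + (progTime P (suc n) + (suc (n * 2) + suc (progTime P (suc n) * 7))))))
    pb-time = pb-suc (pb-+ (pb-suc (pb-* pb-id (pb-const 9))) (pb-+ (pb-suc (pb-* pb-id (pb-const 7)))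
      (pb-+ (pb-const 2) (pb-+ time (pb-+ (pb-suc (pb-* pb-id (pb-const 2))) (pb-suc (pb-* time (pb-const 7))))))))
      where
      time : PolynomiallyBounded λ n → progTime P (suc n)
      time = pb-sucʳ (pb-progTime P)

    tapeOutput-inputTape : ∀ w → tapeOutput {0} (inputTape w) ≡ w
    tapeOutput-inputTape []      = refl
    tapeOutput-inputTape (a ∷ w) = cong (a ∷_) (letterPrefix-letters w)
      where
      letterPrefix-letters : ∀ w → letterPrefix {0} (map letter w) ≡ w
      letterPrefix-letters []      = refl
      letterPrefix-letters (a ∷ w) = cong (a ∷_) (letterPrefix-letters w)

    initial-empty : ∀ w k → k ≢ input → proj₂ (initial w) ‼ k ≡ []
    initial-empty w k k≢i = trans (‼-def _ k) (go (code k) refl)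
      where
      go : ∀ i → code k ≡ i → tapeOutput (lookup (proj₂ (initial w)) i) ≡ []
      go zero    eq = contradiction (code-injective {k} {input} eq) k≢i
      go (suc i) eq = cong tapeOutput (Vec.lookup-replicate i (tape [] blank []))

    nonempty-head : ∀ (xs : List Letter) → T (nonempty (List.head xs)) ⇔ xs ≢ []
    nonempty-head []       = mk⇔ (λ ()) (λ xs≢[] → xs≢[] refl)
    nonempty-head (x ∷ xs) = mk⇔ (λ _ ()) (λ _ → tt)

    first-tape : ∀ {m} (ts : Vec (Tape 0) (suc m)) → tapeOutput (lookup ts zero) ≡ tapeOutput (Vec.head ts)
    first-tape (t ∷ ts) = refl

    compiler-correct : ∀ w → ∃[ c ] (run (eval (polynomial pb-time) (length w)) (initial w) ≡ just c ×
                                     machineOutput c ≡ result P w × (Accepts c ⇔ result P w ≢ []))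
    compiler-correct w = halted (ProgramCorrectness.whole-correct r (height P) w P ≤-refl
        (trans (‼-def (proj₂ (initial w)) input) (tapeOutput-inputTape w)) (initial-empty w))
      where
      timeFor : ℕ → ℕ
      timeFor n = suc (suc (length w * 9) + (suc (length w * 7) +
        (2 + (progTime P n + (suc (length w * 2) + suc (progTime P n * 7))))))
      halted : Run (whole P ≤-refl) (proj₂ (initial w)) (λ ts′ → ts′ ‼ input ≡ result P w)
                 (ProgramCorrectness.wholeTime r (height P) w P) →
               ∃[ c ] (run (eval (polynomial pb-time) (length w)) (initial w) ≡ just c ×
                       machineOutput c ≡ result P w × (Accepts c ⇔ result P w ≢ []))
      halted (ts′ , out≡ , tr) = (inj₂ (just (nonempty (top ts′ input))) , ts′) ,
        run-within input (whole P ≤-refl) tr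
          (≤-trans (≤-reflexive (cong timeFor (Language.Semantics.N-def r w))) (bound pb-time (length w))) ,
        trans (sym (trans (‼-def ts′ input) (first-tape ts′))) out≡ ,
        subst (λ xs → T (nonempty (List.head (ts′ ‼ input))) ⇔ xs ≢ []) out≡ (nonempty-head (ts′ ‼ input))

    computable : {I : Set} (encode : I → List Letter) (Solves : I → List Letter → Set) →
                 (∀ x → Solves x (result P (encode x))) → ComputableInPolynomialTime encode Solves
    computable encode Solves solved = machineOf , polynomial pb-time , λ x →
      solution x (compiler-correct (encode x))
      where
      solution : ∀ x →
        ∃[ c ] (run (eval (polynomial pb-time) (length (encode x))) (initial (encode x)) ≡ just c ×
                machineOutput c ≡ result P (encode x) × (Accepts c ⇔ result P (encode x) ≢ [])) →
        ∃[ c ] (run (eval (polynomial pb-time) (length (encode x))) (initial (encode x)) ≡ just c ×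
                Solves x (machineOutput c))
      solution x (c , halts , out≡ , _) = c , halts , subst (Solves x) (sym out≡) (solved x)

    decidable : (L : List Letter → Set) → (∀ w → result P w ≢ [] ⇔ L w) → InP L
    decidable L answer = machineOf , polynomial pb-time , λ w → decision w (compiler-correct w)
      where
      decision : ∀ w →
        ∃[ c ] (run (eval (polynomial pb-time) (length w)) (initial w) ≡ just c ×
                machineOutput c ≡ result P w × (Accepts c ⇔ result P w ≢ [])) →
        ∃[ c ] (run (eval (polynomial pb-time) (length w)) (initial w) ≡ just c × (Accepts c ⇔ L w))
      decision w (c , halts , _ , accepts) = c , halts , ⇔-trans accepts (answer w)

-- Generation of the components by pairs of vertices

module WeakConnectivity (G : ColoredGraph) where

  open ColoredGraph G

  infix 4 _∼_

  _∼_ : Vertex → Vertex → Set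
  _∼_ = WeaklyColorAvoidingConnected

  ∼-refl : ∀ {u} → u ∼ u
  ∼-refl = ε , λ i → inj₂ ε

  Adj-sym : ∀ {u v} → Adj u v → Adj v u
  Adj-sym {u} {v} = subst T (symmetric u v)

  ∼-sym : ∀ {u v} → u ∼ v → v ∼ u
  ∼-sym (c , a) = reverse Adj-sym c ,
    λ i → Sum.map Sum.swap (reverse (λ (p , q , e) → q , p , Adj-sym e)) (a i)

  -- As `p` survives the deletion of color i, two walks can be joined there. If `x` or `y` is
  -- deleted, there is nothing to show.
  join-avoiding : ∀ {i x p y} → color p ≢ i → WeaklyAvoidingConnected i p x → WeaklyAvoidingConnected i p y →
                  WeaklyAvoidingConnected i x y
  join-avoiding p≢i (inj₁ (inj₁ p≡i)) b = contradiction p≡i p≢i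
  join-avoiding p≢i (inj₁ (inj₂ x≡i)) b = inj₁ (inj₁ x≡i)
  join-avoiding p≢i (inj₂ s) (inj₁ (inj₁ p≡i)) = contradiction p≡i p≢i
  join-avoiding p≢i (inj₂ s) (inj₁ (inj₂ y≡i)) = inj₁ (inj₂ y≡i)
  join-avoiding p≢i (inj₂ s) (inj₂ t) = inj₂ (reverse (λ (p , q , e) → q , p , Adj-sym e) s ◅◅ t)

  -- Every color is avoided by one of u and v.
  join-two : ∀ {u v x y} → color u ≢ color v → u ∼ x → u ∼ y → v ∼ x → v ∼ y → x ∼ y
  join-two {u} {v} u≢v (ux , ux′) (uy , uy′) (_ , vx′) (_ , vy′) = reverse Adj-sym ux ◅◅ uy , avoid
    where
    avoid : ∀ i → WeaklyAvoidingConnected i _ _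
    avoid i with color u Fin.≟ i
    ... | no u≢i   = join-avoiding u≢i (ux′ i) (uy′ i)
    ... | yes refl = join-avoiding (λ eq → u≢v (sym eq)) (vx′ i) (vy′ i)

  -- Deleting the color of `u` deletes `x` as well, which settles this color; under every other
  -- color `u` survives as the joint.
  join-one : ∀ {u x y} → color x ≡ color u → u ∼ x → u ∼ y → x ∼ y
  join-one {u} {x} x≡u (ux , ux′) (uy , uy′) = reverse Adj-sym ux ◅◅ uy , avoid
    where
    avoid : ∀ i → WeaklyAvoidingConnected i _ _
    avoid i with color u Fin.≟ i
    ... | no u≢i   = join-avoiding u≢i (ux′ i) (uy′ i)
    ... | yes refl = inj₁ (inj₁ x≡u)

  Generates : Vertex → Vertex → Set
  Generates u v = u ∼ v × (color u ≢ color v ⊎ (u ≡ v × ∀ x → u ∼ x → color u ≡ color x))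

  module Components (conn : Vertex → Vertex → Bool) (conn⇔∼ : ∀ {u v} → T (conn u v) ⇔ u ∼ v) where

    private
      to : ∀ {u v} → T (conn u v) → u ∼ v
      to = Equivalence.to conn⇔∼
      from : ∀ {u v} → u ∼ v → T (conn u v)
      from = Equivalence.from conn⇔∼

    common : Vertex → Vertex → Subset order
    common u v = Vec.tabulate λ x → conn u x ∧ conn v x

    ∈-common⁺ : ∀ {u v x} → u ∼ x → v ∼ x → x ∈ˢ common u v
    ∈-common⁺ {u} {v} {x} ux vx = Vec.lookup⇒[]= x (common u v)
      (trans (Vec.lookup∘tabulate _ x)
        (Equivalence.to T-≡ (Equivalence.from T-∧ (from ux , from vx))))

    ∈-common⁻ : ∀ {u v x} → x ∈ˢ common u v → u ∼ x × v ∼ x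
    ∈-common⁻ {u} {v} {x} x∈ = Product.map to to (Equivalence.to T-∧ (Equivalence.from T-≡
      (trans (sym (Vec.lookup∘tabulate _ x)) (Vec.[]=⇒lookup x∈))))

    common-pairwise : ∀ {u v} → Generates u v → PairwiseConnected (common u v)
    common-pairwise (_ , inj₁ u≢v) x y x∈ y∈ with ∈-common⁻ x∈ | ∈-common⁻ y∈
    ... | ux , vx | uy , vy = join-two u≢v ux uy vx vy
    common-pairwise (_ , inj₂ (refl , mono)) x y x∈ y∈ with ∈-common⁻ x∈ | ∈-common⁻ y∈
    ... | ux , _ | uy , _ = join-one (sym (mono x ux)) ux uy

    -- Both u and v belong to the set of their common neighbors. A pairwise connected superset
    -- therefore contains both and consists of common neighbors of them.
    common-component : ∀ {u v} → Generates u v → IsComponent (common u v)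
    common-component {u} {v} g@(uv , _) = common-pairwise g , λ S pw common⊆S → ⊆-antisym
      (λ {x} x∈S → ∈-common⁺ (pw u x (common⊆S (∈-common⁺ ∼-refl (∼-sym uv))) x∈S)
                             (pw v x (common⊆S (∈-common⁺ uv ∼-refl)) x∈S))
      common⊆S

    -- The singleton of any vertex is pairwise connected, so the empty set is not maximal. The given
    -- vertex matters: in the graph without vertices the empty set is a component.
    component-nonempty : Vertex → ∀ {S} → IsComponent S → ∃ λ u → u ∈ˢ S
    component-nonempty v {S} (_ , maximal) with nonempty? S
    ... | yes (u , u∈S) = u , u∈S
    ... | no empty = v , subst (v ∈ˢ_) (maximal ⁅ v ⁆ pairwise (λ x∈S → contradiction (_ , x∈S) empty)) (x∈⁅x⁆ v)
      where
      pairwise : PairwiseConnected ⁅ v ⁆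
      pairwise x y x∈ y∈ rewrite x∈⁅y⁆⇒x≡y _ x∈ | x∈⁅y⁆⇒x≡y _ y∈ = ∼-refl

    -- Fix u in S. If S contains another color, take v in S of that color. If S is monochromatic but
    -- u has a neighbor v of another color, `join-one` connects v to all of S. If all neighbors of u
    -- share its color, take v = u. Each time S lies within the pairwise connected set of common
    -- neighbors, and maximality gives equality.
    component-common : Vertex → ∀ {S} → IsComponent S → ∃₂ λ u v → Generates u v × S ≡ common u v
    component-common v₀ {S} S-component@(pw , maximal) with component-nonempty v₀ S-component
    ... | u , u∈S with Fin.any? (λ v → v ∈? S ×-dec ¬? (color u Fin.≟ color v))
    ...   | yes (v , v∈S , u≢v) = u , v , g ,
            sym (maximal _ (common-pairwise g) λ {x} x∈S → ∈-common⁺ (pw u x u∈S x∈S) (pw v x v∈S x∈S))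
      where
      g : Generates u v
      g = pw u v u∈S v∈S , inj₁ u≢v
    ...   | no mono-S with Fin.any? (λ x → map′ to from (T? (conn u x)) ×-dec ¬? (color u Fin.≟ color x))
    ...     | yes (v , uv , u≢v) = u , v , g , sym (maximal _ (common-pairwise g) λ {x} x∈S →
              ∈-common⁺ (pw u x u∈S x∈S) (∼-sym (join-one (sym (same-color x∈S)) (pw u x u∈S x∈S) uv)))
      where
      g : Generates u v
      g = uv , inj₁ u≢v
      same-color : ∀ {x} → x ∈ˢ S → color u ≡ color x
      same-color {x} x∈S = decidable-stable (color u Fin.≟ color x) λ u≢x → mono-S (x , x∈S , u≢x)
    ...     | no mono-N = u , u , g , sym (maximal _ (common-pairwise g) λ {x} x∈S →
              ∈-common⁺ (pw u x u∈S x∈S) (pw u x u∈S x∈S))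
      where
      g : Generates u u
      g = ∼-refl , inj₂ (refl , λ x ux → decidable-stable (color u Fin.≟ color x) λ u≢x → mono-N (x , ux , u≢x))

-- Formulas as propositions, and arithmetic expressed by formulas.

open Equivalence using (to; from)

infixl 9 _at_

_at_ : ∀ {A : Set} → List A → ℕ → Maybe A
xs at i = List.head (drop i xs)

Reflects⇒⇔ : ∀ {A : Set} {b} → Reflects A b → T b ⇔ A
Reflects⇒⇔ (ofʸ a)  = mk⇔ (λ _ → a) (λ _ → tt)
Reflects⇒⇔ (ofⁿ ¬a) = mk⇔ (λ ()) ¬a

T-injective : ∀ {p q} → T p ⇔ T q → p ≡ q
T-injective {true}  {true}  e = refl
T-injective {false} {false} e = refl
T-injective {true}  {false} e = contradiction (to e tt) id
T-injective {false} {true}  e = contradiction (from e tt) id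

is-reflects : ∀ a m → Reflects (m ≡ just a) (is a m)
is-reflects #             nothing             = ofⁿ λ ()
is-reflects (bit true)    nothing             = ofⁿ λ ()
is-reflects (bit false)   nothing             = ofⁿ λ ()
is-reflects #             (just #)            = ofʸ refl
is-reflects #             (just (bit _))      = ofⁿ λ ()
is-reflects (bit true)    (just (bit true))   = ofʸ refl
is-reflects (bit false)   (just (bit false))  = ofʸ refl
is-reflects (bit true)    (just (bit false))  = ofⁿ λ ()
is-reflects (bit false)   (just (bit true))   = ofⁿ λ ()
is-reflects (bit true)    (just #)            = ofⁿ λ ()
is-reflects (bit false)   (just #)            = ofⁿ λ ()

anyBelow-reflects : ∀ {P : ℕ → Set} {f : ℕ → Bool} → (∀ v → Reflects (P v) (f v)) → ∀ n →
                    Reflects (∃[ v ] (v < n × P v)) (anyBelow n f)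
anyBelow-reflects r zero    = ofⁿ λ ()
anyBelow-reflects {P} {f} r (suc n) with f n | r n | anyBelow n f | anyBelow-reflects r n
... | true  | ofʸ p  | _     | _                 = ofʸ (n , ≤-refl , p)
... | false | ofⁿ ¬p | true  | ofʸ (v , v<n , p) = ofʸ (v , m<n⇒m<1+n v<n , p)
... | false | ofⁿ ¬p | false | ofⁿ ¬q            = ofⁿ none
  where
  none : ¬ (∃[ v ] (v < suc n × P v))
  none (v , v<1+n , p) with m<1+n⇒m<n∨m≡n v<1+n
  ... | inj₁ v<n  = ¬q (v , v<n , p)
  ... | inj₂ refl = ¬p p

allBelow-reflects : ∀ {P : ℕ → Set} {f : ℕ → Bool} → (∀ v → Reflects (P v) (f v)) → ∀ n →
                    Reflects (∀ v → v < n → P v) (not (anyBelow n (λ v → not (f v))))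
allBelow-reflects {P} {f} r n = dual (anyBelow-reflects (λ v → ¬-reflects (r v)) n)
  where
  stable : ∀ v → ¬ ¬ P v → P v
  stable v ¬¬p with f v | r v
  ... | true  | ofʸ p  = p
  ... | false | ofⁿ ¬p = contradiction ¬p ¬¬p
  dual : ∀ {b} → Reflects (∃[ v ] (v < n × ¬ P v)) b → Reflects (∀ v → v < n → P v) (not b)
  dual (ofʸ (v , v<n , ¬p)) = ofⁿ λ h → ¬p (h v v<n)
  dual (ofⁿ ¬q)             = ofʸ λ v v<n → stable v (λ ¬p → ¬q (v , v<n , ¬p))

loop-invariant : ∀ {A : Set} (I : ℕ → A → Set) {f : ℕ → A → A} {s} n →
  (∀ {v s} → v < n → I v s → I (suc v) (f v s)) → I 0 s → I n (loop n f s)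
loop-invariant I zero    step i = i
loop-invariant I (suc n) step i = step ≤-refl (loop-invariant I n (λ v<n → step (m<n⇒m<1+n v<n)) i)


module Meaning {r : ℕ} (w : List Letter) where

  open Language r
  open Semantics w

  -- Sums of one and of two variables have cases of their own, to be free of the final + 0 of `sum`.
  Holds : ∀ {d} → Form d → Vec ℕ d → Tables → Set
  Holds (inp a x)            env ρ = w at lookup env x ≡ just a
  Holds (rel A x y)          env ρ = T (ρ A (lookup env x) (lookup env y))
  Holds (less (x ∷ []) z)    env ρ = lookup env x < lookup env z
  Holds (less (x ∷ y ∷ []) z) env ρ = lookup env x + lookup env y < lookup env z
  Holds (less xs z)          env ρ = sum (map (lookup env) xs) < lookup env z
  Holds (neg φ)              env ρ = ¬ Holds φ env ρ
  Holds (φ ∧ᶠ ψ)             env ρ = Holds φ env ρ × Holds ψ env ρ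
  Holds (φ ∨ᶠ ψ)             env ρ = Holds φ env ρ ⊎ Holds ψ env ρ
  Holds (ex φ)               env ρ = ∃[ v ] (v < N × Holds φ (v ∷ env) ρ)
  Holds (all φ)              env ρ = ∀ v → v < N → Holds φ (v ∷ env) ρ

  holds-reflects : ∀ {d} (φ : Form d) env ρ → Reflects (Holds φ env ρ) (evalF φ env ρ)
  holds-reflects (inp a x)   env ρ = is-reflects a _
  holds-reflects (rel A x y) env ρ = T-reflects _
  holds-reflects (less [] z) env ρ = <ᵇ-reflects-< _ _
  holds-reflects (less (x ∷ []) z) env ρ =
      subst (λ s → Reflects (s < lookup env z) (lookup env x + 0 <ᵇ lookup env z))
    (+-identityʳ (lookup env x)) (<ᵇ-reflects-< _ _)
  holds-reflects (less (x ∷ y ∷ []) z) env ρ =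
    subst (λ s → Reflects (lookup env x + s < lookup env z) (lookup env x + (lookup env y + 0) <ᵇ lookup env z))
    (+-identityʳ (lookup env y)) (<ᵇ-reflects-< _ _)
  holds-reflects (less (x ∷ y ∷ x′ ∷ xs) z) env ρ = <ᵇ-reflects-< _ _
  holds-reflects (neg φ)     env ρ = ¬-reflects (holds-reflects φ env ρ)
  holds-reflects (φ ∧ᶠ ψ)    env ρ = holds-reflects φ env ρ ×-reflects holds-reflects ψ env ρ
  holds-reflects (φ ∨ᶠ ψ)    env ρ = holds-reflects φ env ρ ⊎-reflects holds-reflects ψ env ρ
  holds-reflects (ex φ)      env ρ = anyBelow-reflects (λ v → holds-reflects φ (v ∷ env) ρ) N
  holds-reflects (all φ)     env ρ = allBelow-reflects (λ v → holds-reflects φ (v ∷ env) ρ) N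

  evalF⇔Holds : ∀ {d} (φ : Form d) env ρ → T (evalF φ env ρ) ⇔ Holds φ env ρ
  evalF⇔Holds φ env ρ = Reflects⇒⇔ (holds-reflects φ env ρ)

module Vocabulary (r : ℕ) where

  open Language r

  infixr 5 _⇒ᶠ_

  _⇒ᶠ_ : ∀ {d} → Form d → Form d → Form d
  φ ⇒ᶠ ψ = neg φ ∨ᶠ ψ

  same successor : ∀ {d} → Fin d → Fin d → Form d
  same x y     = neg (less (x ∷ []) y) ∧ᶠ neg (less (y ∷ []) x)
  successor x y = less (x ∷ []) y ∧ᶠ neg (ex (less (suc x ∷ []) 0F ∧ᶠ less (0F ∷ []) (suc y)))

  isConst : ∀ {d} → ℕ → Fin d → Form d
  isConst zero    x = neg (ex (less (0F ∷ []) (suc x)))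
  isConst (suc c) x = ex (successor 0F (suc x) ∧ᶠ isConst c 0F)

  -- y = 1 + c + 2 x
  double : ∀ {d} → ℕ → Fin d → Fin d → Form d
  double zero    x y = less (x ∷ x ∷ []) y ∧ᶠ neg (ex (less (0F ∷ []) (suc y) ∧ᶠ less (suc x ∷ suc x ∷ []) 0F))
  double (suc c) x y = ex (successor 0F (suc y) ∧ᶠ double c (suc x) 0F)

  module VocabularyMeaning (w : List Letter) where

    open Semantics w
    open Meaning {r} w

    within : ∀ {n} → n ≤ length w → n < N
    within n≤ = subst (_ <_) (sym N-def) (s≤s n≤)

    module _ {d} (env : Vec ℕ d) (ρ : Tables) where

      ⇒ᶠ-⇔ : ∀ φ ψ → Holds (φ ⇒ᶠ ψ) env ρ ⇔ (Holds φ env ρ → Holds ψ env ρ)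
      ⇒ᶠ-⇔ φ ψ = mk⇔ (λ { (inj₁ ¬p) p → contradiction p ¬p ; (inj₂ q) _ → q }) decide
        where
        decide : (Holds φ env ρ → Holds ψ env ρ) → Holds (φ ⇒ᶠ ψ) env ρ
        decide h with evalF φ env ρ | holds-reflects φ env ρ
        ... | true  | ofʸ p  = inj₂ (h p)
        ... | false | ofⁿ ¬p = inj₁ ¬p

      same-⇔ : ∀ x y → Holds (same x y) env ρ ⇔ lookup env x ≡ lookup env y
      same-⇔ x y = mk⇔ (λ (x≮y , y≮x) → ≤-antisym (≮⇒≥ y≮x) (≮⇒≥ x≮y))
        (λ eq → <-irrefl eq , <-irrefl (sym eq))

      -- If y exceeds x by more than one, the number after x witnesses the gap. The bound on y keeps
      -- this witness within the range of the quantifier.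
      successor-⇔ : ∀ x y → lookup env y < N → Holds (successor x y) env ρ ⇔ lookup env y ≡ suc (lookup env x)
      successor-⇔ x y y<N = mk⇔
        (λ (x<y , none) → ≤-antisym
          (≮⇒≥ λ 1+x<y → none (suc (lookup env x) , <-trans 1+x<y y<N , ≤-refl , 1+x<y)) x<y)
        (λ eq → ≤-reflexive (sym eq) , λ (z , _ , x<z , z<y) → <⇒≱ x<z (≤-pred (≤-trans z<y (≤-reflexive eq))))

    isConst-⇔ : ∀ {d} (env : Vec ℕ d) ρ c x → lookup env x < N → Holds (isConst c x) env ρ ⇔ lookup env x ≡ c
    isConst-⇔ env ρ zero x x<N = mk⇔
      (λ none → n≤0⇒n≡0 (≮⇒≥ λ 0<x → none (0 , within z≤n , 0<x)))
      (λ { eq (z , _ , z<x) → <⇒≱ z<x (≤-trans (≤-reflexive eq) z≤n) })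
    isConst-⇔ env ρ (suc c) x x<N = mk⇔
      (λ (z , z<N , s , h) → trans (to (successor-⇔ (z ∷ env) ρ 0F (suc x) x<N) s)
                                   (cong suc (to (isConst-⇔ (z ∷ env) ρ c 0F z<N) h)))
      (λ eq → c , <-trans (≤-reflexive (sym eq)) x<N ,
              from (successor-⇔ (c ∷ env) ρ 0F (suc x) x<N) eq ,
              from (isConst-⇔ (c ∷ env) ρ c 0F (<-trans (≤-reflexive (sym eq)) x<N)) refl)

    double-⇔ : ∀ {d} (env : Vec ℕ d) ρ c x y → lookup env y < N →
               Holds (double c x y) env ρ ⇔ lookup env y ≡ suc (c + (lookup env x + lookup env x))
    double-⇔ env ρ zero x y y<N = mk⇔
      (λ (2x<y , none) → ≤-antisym (≮⇒≥ λ 1+2x<y → none (_ , <-trans 1+2x<y y<N , 1+2x<y , ≤-refl)) 2x<y)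
      (λ eq → ≤-reflexive (sym eq) , λ (z , _ , z<y , 2x<z) → <⇒≱ 2x<z (≤-pred (≤-trans z<y (≤-reflexive eq))))
    double-⇔ env ρ (suc c) x y y<N = mk⇔
      (λ (z , z<N , s , h) → trans (to (successor-⇔ (z ∷ env) ρ 0F (suc y) y<N) s)
                                   (cong suc (to (double-⇔ (z ∷ env) ρ c (suc x) 0F z<N) h)))
      (λ eq → _ , <-trans (≤-reflexive (sym eq)) y<N ,
              from (successor-⇔ (_ ∷ env) ρ 0F (suc y) y<N) eq ,
              from (double-⇔ (_ ∷ env) ρ c (suc x) 0F (<-trans (≤-reflexive (sym eq)) y<N)) refl)

-- Reading the input

pattern 10F = suc 9F
pattern 11F = suc 10F
pattern 12F = suc 11F
pattern 13F = suc 12F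
pattern 14F = suc 13F
pattern 15F = suc 14F

pattern ROW  = 0F
pattern COL  = 1F
pattern ONE  = 2F
pattern ZERO = 3F
pattern END  = 4F
pattern VTX  = 5F
pattern ADJ  = 6F
pattern HUE  = 7F
pattern CLR  = 8F
pattern WCA  = 9F
pattern RCH  = 10F
pattern GEN  = 11F
pattern KEEP = 12F
pattern ONE′ = 13F
pattern ZER′ = 14F
pattern TMP  = 15F

open Language 16
open Vocabulary 16

tableOf : Letter → Fin 16
tableOf (bit true)  = ONE
tableOf (bit false) = ZERO
tableOf #           = END

isBit : ∀ {d} → Fin d → Form d
isBit x = inp (bit true) x ∨ᶠ inp (bit false) x

markForm : Letter → Form 3
markForm c = rel (tableOf c) 1F 0F ∨ᶠ rel ROW 1F 1F ∧ᶠ rel COL 0F 0F ∧ᶠ inp c 2F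

-- A number is stored as a table whose row at that number is true in all columns, so it can be
-- tested on the diagonal. The loop runs for one round beyond the last letter; there neither `#` nor
-- a bit is found, and the position has to stay as it is.
rowForm colForm : Form 3
rowForm = inp # 2F ∧ᶠ ex (successor 0F 2F ∧ᶠ rel ROW 0F 0F) ∨ᶠ neg (inp # 2F) ∧ᶠ rel ROW 1F 1F
colForm = inp # 2F ∧ᶠ isConst 0 1F ∨ᶠ isBit 2F ∧ᶠ ex (successor 0F 2F ∧ᶠ rel COL 0F 0F) ∨ᶠ
          neg (inp # 2F) ∧ᶠ neg (isBit 2F) ∧ᶠ rel COL 1F 1F

-- The input is read as a list of rows, each closed by a #.  Tables ROW and COL
-- hold the position of the next letter, the tables ONE, ZERO and END the
-- positions of the letters already read.
readLetter : Prog 1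
readLetter = define ONE (markForm (bit true)) ▹ define ZERO (markForm (bit false)) ▹ define END (markForm #) ▹
  define ROW rowForm ▹ define COL colForm

parse : Prog 0
parse = define ROW (isConst 0 1F) ▹ define COL (isConst 0 1F) ▹ for readLetter

nextRow nextCol : Letter → ℕ → ℕ
nextRow #       j = suc j
nextRow (bit _) j = j
nextCol #       t = 0
nextCol (bit _) t = suc t

endPosition : List Letter → ℕ → ℕ → ℕ × ℕ
endPosition []      j t = j , t
endPosition (c ∷ w) j t = endPosition w (nextRow c j) (nextCol c t)

-- Reading w from position (j , t) on, letter a is met at position (x , y).
Cell : List Letter → ℕ → ℕ → Letter → ℕ → ℕ → Set
Cell []      j t a x y = ⊥
Cell (c ∷ w) j t a x y = (c ≡ a × x ≡ j × y ≡ t) ⊎ Cell w (nextRow c j) (nextCol c t) a x y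

at-drop : ∀ {A : Set} {w rest : List A} p → drop p w ≡ rest → w at p ≡ List.head rest
at-drop p refl = refl

module Parsing (w : List Letter) where

  open Semantics w
  open Meaning {16} w
  open VocabularyMeaning w

  -- The loop invariant of reading, stated against the whole word: recorded and outstanding cells
  -- together are all cells, and the final position is the one reached from here. `room` keeps row
  -- and column numbers within the range of variables.
  record Parsed (rest : List Letter) (s : Store) : Set where
    field
      {j t}  : ℕ
      room   : j + t + length rest ≤ length w
      end    : endPosition rest j t ≡ endPosition w 0 0
      row    : ∀ {a b} → a < N → T (proj₁ s ROW a b) ⇔ a ≡ j
      col    : ∀ {a b} → a < N → T (proj₁ s COL a b) ⇔ a ≡ t
      cells  : ∀ c {x y} → x < N → y < N →
               (T (proj₁ s (tableOf c) x y) ⊎ Cell rest j t c x y) ⇔ Cell w 0 0 c x y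
      silent : proj₂ s ≡ []

  j<N : ∀ {rest s} (P : Parsed rest s) → Parsed.j P < N
  j<N P = within (≤-trans (≤-trans (m≤m+n _ _) (m≤m+n _ _)) (Parsed.room P))

  t<N : ∀ {rest s} (P : Parsed rest s) → Parsed.t P < N
  t<N P = within (≤-trans (≤-trans (m≤n+m _ (Parsed.j P)) (m≤m+n _ _)) (Parsed.room P))

  module Round {p rest s} (p<N : p < N) (P : Parsed rest s) (eq : drop p w ≡ rest) where

    open Parsed P

    -- The letter is recorded before the position advances, since the marks refer to the old `ROW`
    -- and `COL`.
    s₁ s₂ s₃ s₄ s′ : Store
    s₁ = exec (define ONE (markForm (bit true))) (p ∷ []) s
    s₂ = exec (define ZERO (markForm (bit false))) (p ∷ []) s₁
    s₃ = exec (define END (markForm #)) (p ∷ []) s₂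
    s₄ = exec (define ROW rowForm) (p ∷ []) s₃
    s′ = exec (define COL colForm) (p ∷ []) s₄

    mark : ∀ c {x y} → x < N → y < N → T (proj₁ s′ (tableOf c) x y) ⇔
           (T (proj₁ s (tableOf c) x y) ⊎ (x ≡ j × y ≡ t × List.head rest ≡ just c))
    mark c {x} {y} x<N y<N = ⇔-trans (marked c) (⇔-refl ⊎-⇔ (row {b = x} x<N ×-⇔ (col {b = y} y<N ×-⇔ read)))
      where
      read : (w at p ≡ just c) ⇔ (List.head rest ≡ just c)
      read = subst (λ m → (w at p ≡ just c) ⇔ (m ≡ just c)) (at-drop p eq) ⇔-refl
      marked : ∀ c → T (proj₁ s′ (tableOf c) x y) ⇔
               (T (proj₁ s (tableOf c) x y) ⊎ (T (proj₁ s ROW x x) × T (proj₁ s COL y y) × w at p ≡ just c))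
      marked (bit true)  = evalF⇔Holds (markForm (bit true)) (y ∷ x ∷ p ∷ []) (proj₁ s)
      marked (bit false) = evalF⇔Holds (markForm (bit false)) (y ∷ x ∷ p ∷ []) (proj₁ s₁)
      marked #           = evalF⇔Holds (markForm #) (y ∷ x ∷ p ∷ []) (proj₁ s₂)

    row⇔ : ∀ {a b} → a < N → T (proj₁ s′ ROW a b) ⇔
           ((List.head rest ≡ just # × a ≡ suc j) ⊎ (List.head rest ≢ just # × a ≡ j))
    row⇔ {a} {b} a<N rewrite sym (at-drop p eq) = ⇔-trans (evalF⇔Holds rowForm (b ∷ a ∷ p ∷ []) (proj₁ s₃))
      ((⇔-refl ×-⇔ mk⇔ (λ (z , z<N , sz , r) →
        trans (to (successor-⇔ (z ∷ b ∷ a ∷ p ∷ []) (proj₁ s) 0F 2F a<N) sz) (cong suc (to (row {b = z} z<N) r)))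
                       (λ eq → j , j<N P , from (successor-⇔ (j ∷ b ∷ a ∷ p ∷ []) (proj₁ s) 0F 2F a<N) eq ,
                         from (row {b = j} (j<N P)) refl))
       ⊎-⇔ (⇔-refl ×-⇔ row {b = a} a<N))

    col⇔ : ∀ {a b} → a < N → T (proj₁ s′ COL a b) ⇔
           ((List.head rest ≡ just # × a ≡ 0) ⊎
            ((List.head rest ≡ just (bit true) ⊎ List.head rest ≡ just (bit false)) × a ≡ suc t) ⊎
            (List.head rest ≢ just # × ¬
              (List.head rest ≡ just (bit true) ⊎ List.head rest ≡ just (bit false)) × a ≡ t))
    col⇔ {a} {b} a<N rewrite sym (at-drop p eq) = ⇔-trans (evalF⇔Holds colForm (b ∷ a ∷ p ∷ []) (proj₁ s₄))
      ((⇔-refl ×-⇔ isConst-⇔ (b ∷ a ∷ p ∷ []) (proj₁ s) 0 1F a<N) ⊎-⇔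
       ((⇔-refl ×-⇔ mk⇔ (λ (z , z<N , sz , r) →
         trans (to (successor-⇔ (z ∷ b ∷ a ∷ p ∷ []) (proj₁ s) 0F 2F a<N) sz) (cong suc (to (col {b = z} z<N) r)))
                        (λ eq → t , t<N P , from (successor-⇔ (t ∷ b ∷ a ∷ p ∷ []) (proj₁ s) 0F 2F a<N) eq ,
                          from (col {b = t} (t<N P)) refl))
       ⊎-⇔ (⇔-refl ×-⇔ (⇔-refl ×-⇔ col {b = a} a<N))))

    advance : Parsed (drop (suc p) w) s′
    advance = subst (λ u → Parsed u s′) (trans (cong (drop 1) (sym eq)) (drop-1-drop p w)) (by rest refl)
      where
      by : ∀ u → rest ≡ u → Parsed (drop 1 u) s′
      by [] refl = record
        { room = room ; end = end ; silent = silent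
        ; row = λ {a} {b} a<N → ⇔-trans (row⇔ {b = b} a<N)
          (mk⇔ (λ { (inj₁ (() , _)) ; (inj₂ (_ , e)) → e }) (λ e → inj₂ ((λ ()) , e)))
        ; col = λ {a} {b} a<N → ⇔-trans (col⇔ {b = b} a<N)
          (mk⇔ (λ { (inj₁ (() , _)) ; (inj₂ (inj₁ (inj₁ () , _))) ; (inj₂ (inj₁ (inj₂ () , _))) ;
          (inj₂ (inj₂ (_ , _ , e))) → e })
                  (λ e → inj₂ (inj₂ ((λ ()) , (λ { (inj₁ ()) ; (inj₂ ()) }) , e))))
        ; cells = λ c x<N y<N → ⇔-trans
          (mk⇔ (λ { (inj₁ h) → case to (mark c x<N y<N) h of λ { (inj₁ h) → inj₁ h ; (inj₂ (_ , _ , ())) } ;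
          (inj₂ ()) })
                  (λ { (inj₁ h) → inj₁ (from (mark c x<N y<N) (inj₁ h)) ; (inj₂ ()) })) (cells c x<N y<N)
        }
      by (d ∷ u) refl = record
        { j = nextRow d j ; t = nextCol d t
        ; room = ≤-trans (moved d) room ; end = end ; silent = silent
        ; row = λ {a} {b} a<N → ⇔-trans (row⇔ {b = b} a<N) (rows d)
        ; col = λ {a} {b} a<N → ⇔-trans (col⇔ {b = b} a<N) (cols d)
        ; cells = λ c x<N y<N → ⇔-trans (mk⇔
            (λ { (inj₁ h) → case to (mark c x<N y<N) h of λ
                   { (inj₁ h) → inj₁ h ; (inj₂ (e , e′ , e″)) → inj₂ (inj₁ (just-injective e″ , e , e′)) }
               ; (inj₂ h) → inj₂ (inj₂ h) })
            (λ { (inj₁ h) → inj₁ (from (mark c x<N y<N) (inj₁ h))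
               ; (inj₂ (inj₁ (e″ , e , e′))) → inj₁ (from (mark c x<N y<N) (inj₂ (e , e′ , cong just e″)))
               ; (inj₂ (inj₂ h)) → inj₂ h })) (cells c x<N y<N)
        }
        where
        moved : ∀ d → nextRow d j + nextCol d t + length u ≤ j + t + suc (length u)
        moved #       = ≤-trans (s≤s (+-monoˡ-≤ (length u) (+-monoʳ-≤ j z≤n)))
            (≤-reflexive (sym (+-suc (j + t) (length u))))
        moved (bit _) = ≤-reflexive (trans (cong (_+ length u) (+-suc j t)) (sym (+-suc (j + t) (length u))))
        rows : ∀ d {a} → ((just d ≡ just # × a ≡ suc j) ⊎ (just d ≢ just # × a ≡ j)) ⇔ a ≡ nextRow d j
        rows #       = mk⇔ (λ { (inj₁ (_ , e)) → e ; (inj₂ (n , _)) → contradiction refl n }) (λ e → inj₁ (refl , e))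
        rows (bit _) = mk⇔ (λ { (inj₁ (() , _)) ; (inj₂ (_ , e)) → e }) (λ e → inj₂ ((λ ()) , e))
        cols : ∀ d {a} → ((just d ≡ just # × a ≡ 0) ⊎
            ((just d ≡ just (bit true) ⊎ just d ≡ just (bit false)) × a ≡ suc t) ⊎
            (just d ≢ just # × ¬ (just d ≡ just (bit true) ⊎ just d ≡ just (bit false)) × a ≡ t)) ⇔ a ≡ nextCol d t
        cols #           = mk⇔ (λ { (inj₁ (_ , e)) → e ; (inj₂ (inj₁ (inj₁ () , _))) ; (inj₂ (inj₁ (inj₂ () , _)))
                                  ; (inj₂ (inj₂ (n , _))) → contradiction refl n }) (λ e → inj₁ (refl , e))
        cols (bit true)  = mk⇔ (λ { (inj₁ (() , _)) ; (inj₂ (inj₁ (_ , e))) → e ; (inj₂ (inj₂ (_ , n , _))) →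
            contradiction (inj₁ refl) n })
                               (λ e → inj₂ (inj₁ (inj₁ refl , e)))
        cols (bit false) = mk⇔ (λ { (inj₁ (() , _)) ; (inj₂ (inj₁ (_ , e))) → e ; (inj₂ (inj₂ (_ , n , _))) →
            contradiction (inj₂ refl) n })
                               (λ e → inj₂ (inj₁ (inj₂ refl , e)))

  drop-N : drop N w ≡ []
  drop-N = List.drop-all N w (≤-trans (n≤1+n _) (≤-reflexive (sym N-def)))

  parse-correct : Parsed [] (exec parse [] initialStore)
  parse-correct = subst (λ u → Parsed u (exec parse [] initialStore)) drop-N
    (loop-invariant (λ p s → Parsed (drop p w) s) N (λ p<N P → Round.advance p<N P refl) start)
    where
    start : Parsed w (exec (define ROW (isConst 0 1F) ▹ define COL (isConst 0 1F)) [] initialStore)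
    start = record
      { j = 0 ; t = 0 ; room = ≤-refl ; end = refl ; silent = refl
      ; row = λ {a} {b} a<N → ⇔-trans (evalF⇔Holds (isConst 0 1F) (b ∷ a ∷ []) (λ _ _ _ → false))
        (isConst-⇔ (b ∷ a ∷ []) (λ _ _ _ → false) 0 1F a<N)
      ; col = λ {a} {b} a<N → ⇔-trans
        (evalF⇔Holds (isConst 0 1F) (b ∷ a ∷ []) (proj₁ (exec (define ROW (isConst 0 1F)) [] initialStore)))
        (isConst-⇔ (b ∷ a ∷ []) (λ _ _ _ → false) 0 1F a<N)
      ; cells = λ { (bit true) _ _ → unread ; (bit false) _ _ → unread ; # _ _ → unread }
      }
      where
      unread : ∀ {A : Set} → (⊥ ⊎ A) ⇔ A
      unread = mk⇔ (λ { (inj₁ ()) ; (inj₂ a) → a }) inj₂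

-- Words as lists of rows, and the tables of an encoded graph.

at-++ʳ : ∀ {A : Set} (xs : List A) {ys} i → (xs ++ ys) at (length xs + i) ≡ ys at i
at-++ʳ []       i = refl
at-++ʳ (x ∷ xs) i = at-++ʳ xs i

at-just⇒< : ∀ {A : Set} (xs : List A) {i x} → xs at i ≡ just x → i < length xs
at-just⇒< (x ∷ xs) {zero}  _  = z<s
at-just⇒< (x ∷ xs) {suc i} eq = s≤s (at-just⇒< xs eq)
at-just⇒< []       {zero}  ()
at-just⇒< []       {suc i} ()

<⇒at-just : ∀ {A : Set} (xs : List A) {i} → i < length xs → ∃[ x ] (xs at i ≡ just x)
<⇒at-just (x ∷ xs) {zero}  _         = x , refl
<⇒at-just (x ∷ xs) {suc i} (s≤s i<n) = <⇒at-just xs i<n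

at-map-bit : ∀ s {b} i → (map bit s ++ [ # ]) at i ≡ just (bit b) ⇔ s at i ≡ just b
at-map-bit []      zero    = mk⇔ (λ ()) (λ ())
at-map-bit []      (suc zero) = mk⇔ (λ ()) (λ ())
at-map-bit []      (suc (suc i)) = mk⇔ (λ ()) (λ ())
at-map-bit (c ∷ s) zero    = mk⇔ (λ { refl → refl }) (λ { refl → refl })
at-map-bit (c ∷ s) (suc i) = at-map-bit s i

at-map-# : ∀ s i → (map bit s ++ [ # ]) at i ≡ just # ⇔ length s ≡ i
at-map-# []      zero          = mk⇔ (λ _ → refl) (λ _ → refl)
at-map-# []      (suc zero)    = mk⇔ (λ ()) (λ ())
at-map-# []      (suc (suc i)) = mk⇔ (λ ()) (λ ())
at-map-# (c ∷ s) zero          = mk⇔ (λ ()) (λ ())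
at-map-# (c ∷ s) (suc i)       = ⇔-trans (at-map-# s i) (mk⇔ (cong suc) suc-injective)

encodeRow : List Bool → List Letter
encodeRow s = map bit s ++ [ # ]

encodeRows : List (List Bool) → List Letter
encodeRows = concatMap encodeRow

-- Every word has this shape, whether it encodes anything or not. The decision procedure only has to
-- rule out a nonempty unclosed tail and to test the rows.
splitRows : ∀ w → ∃₂ λ rs s → w ≡ encodeRows rs ++ map bit s
splitRows []      = [] , [] , refl
splitRows (# ∷ w) with splitRows w
... | rs , s , eq = [] ∷ rs , s , cong (# ∷_) eq
splitRows (bit b ∷ w) with splitRows w
... | []     , s , eq = [] , b ∷ s , cong (bit b ∷_) eq
... | r ∷ rs , s , eq = (b ∷ r) ∷ rs , s , cong (bit b ∷_) eq

endPosition-row : ∀ s u j t → endPosition (encodeRow s ++ u) j t ≡ endPosition u (suc j) 0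
endPosition-row []      u j t = refl
endPosition-row (b ∷ s) u j t = endPosition-row s u j (suc t)

endPosition-rows : ∀ rs s j → endPosition (encodeRows rs ++ map bit s) j 0 ≡ (j + length rs , length s)
endPosition-rows []       s j = trans (bits s 0) (cong₂ _,_ (sym (+-identityʳ j)) refl)
  where
  bits : ∀ s t → endPosition (map bit s) j t ≡ (j , t + length s)
  bits []      t = cong (j ,_) (sym (+-identityʳ t))
  bits (b ∷ s) t = trans (bits s (suc t)) (cong (j ,_) (sym (+-suc t (length s))))
endPosition-rows (r ∷ rs) s j rewrite List.++-assoc (encodeRow r) (encodeRows rs) (map bit s) =
  trans (endPosition-row r _ j 0)
      (trans (endPosition-rows rs s (suc j)) (cong (_, length s) (sym (+-suc j (length rs)))))

Cell-row : ∀ s u j t {a x y} → Cell (encodeRow s ++ u) j t a x y ⇔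
           ((x ≡ j × ∃[ k ] (y ≡ t + k × encodeRow s at k ≡ just a)) ⊎ Cell u (suc j) 0 a x y)
Cell-row [] u j t = mk⇔
  (λ { (inj₁ (refl , x≡ , y≡)) → inj₁ (x≡ , 0 , trans y≡ (sym (+-identityʳ t)) , refl) ; (inj₂ c) → inj₂ c })
  (λ { (inj₁ (x≡ , zero , y≡ , refl)) → inj₁ (refl , x≡ , trans y≡ (+-identityʳ t))
     ; (inj₁ (x≡ , suc zero , y≡ , ()))
     ; (inj₁ (x≡ , suc (suc k) , y≡ , ()))
     ; (inj₂ c) → inj₂ c })
Cell-row (b ∷ s) u j t = ⇔-trans (⇔-refl ⊎-⇔ Cell-row s u j (suc t)) (mk⇔
  (λ { (inj₁ (refl , x≡ , y≡)) → inj₁ (x≡ , 0 , trans y≡ (sym (+-identityʳ t)) , refl)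
     ; (inj₂ (inj₁ (x≡ , k , y≡ , e))) → inj₁ (x≡ , suc k , trans y≡ (sym (+-suc t k)) , e)
     ; (inj₂ (inj₂ c)) → inj₂ c })
  (λ { (inj₁ (x≡ , zero , y≡ , refl)) → inj₁ (refl , x≡ , trans y≡ (+-identityʳ t))
     ; (inj₁ (x≡ , suc k , y≡ , e)) → inj₂ (inj₁ (x≡ , k , trans y≡ (+-suc t k) , e))
     ; (inj₂ c) → inj₂ (inj₂ c) }))

Cell-rows : ∀ rs j {a x y} → Cell (encodeRows rs) j 0 a x y ⇔
            (∃₂ λ i s → x ≡ j + i × rs at i ≡ just s × encodeRow s at y ≡ just a)
Cell-rows [] j = mk⇔ (λ ()) λ { (zero , s , _ , () , _) ; (suc i , s , _ , () , _) }
Cell-rows (r ∷ rs) j = ⇔-trans (Cell-row r (encodeRows rs) j 0) (⇔-trans (⇔-refl ⊎-⇔ Cell-rows rs (suc j)) (mk⇔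
  (λ { (inj₁ (x≡ , k , refl , e)) → 0 , r , trans x≡ (sym (+-identityʳ j)) , refl , e
     ; (inj₂ (i , s , x≡ , e , e′)) → suc i , s , trans x≡ (sym (+-suc j i)) , e , e′ })
  (λ { (zero , s , x≡ , refl , e′) → inj₁ (trans x≡ (+-identityʳ j) , _ , refl , e′)
     ; (suc i , s , x≡ , e , e′) → inj₂ (i , s , trans x≡ (+-suc j i) , e , e′) })))

-- Each row contributes at least its closing `#`. Thus all row numbers, and the number of rows
-- itself, are values of variables.
length-rows : ∀ rs → length rs ≤ length (encodeRows rs)
length-rows []       = z≤n
length-rows (r ∷ rs) = ≤-trans
    (+-mono-≤ (≤-trans (m≤n+m 1 (length (map bit r))) (≤-reflexive (sym (List.length-++ (map bit r)))))
  (length-rows rs)) (≤-reflexive (sym (List.length-++ (encodeRow r))))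

length-row : ∀ rs {i s} → rs at i ≡ just s → length s ≤ length (encodeRows rs)
length-row (r ∷ rs) {zero} refl = ≤-trans
  (≤-trans (≤-reflexive (sym (List.length-map bit r)))
    (≤-trans (m≤m+n _ 1) (≤-reflexive (sym (List.length-++ (map bit r))))))
  (≤-trans (m≤m+n _ _) (≤-reflexive (sym (List.length-++ (encodeRow r)))))
length-row (r ∷ rs) {suc i} eq = ≤-trans (length-row rs {i} eq)
  (≤-trans (m≤n+m _ (length (encodeRow r))) (≤-reflexive (sym (List.length-++ (encodeRow r)))))
length-row [] {zero}  ()
length-row [] {suc i} ()

module Pairs {A : Set} where

  -- Interleaved, because the encoding gives for every vertex its color row followed by its
  -- adjacency row; these end up at even and odd places.
  pairs : ∀ {n} → (Fin n → A) → (Fin n → A) → List A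
  pairs {zero}  f g = []
  pairs {suc n} f g = f zero ∷ g zero ∷ pairs (f ∘ suc) (g ∘ suc)

  length-pairs : ∀ {n} (f g : Fin n → A) → length (pairs f g) ≡ n + n
  length-pairs {zero}  f g = refl
  length-pairs {suc n} f g = cong suc (trans (cong suc (length-pairs (f ∘ suc) (g ∘ suc))) (sym (+-suc n n)))

  pairs-at-even : ∀ {n} (f g : Fin n → A) v → pairs f g at (toℕ v + toℕ v) ≡ just (f v)
  pairs-at-even f g zero    = refl
  pairs-at-even f g (suc v) rewrite +-suc (toℕ v) (toℕ v) = pairs-at-even (f ∘ suc) (g ∘ suc) v

  pairs-at-odd : ∀ {n} (f g : Fin n → A) v → pairs f g at suc (toℕ v + toℕ v) ≡ just (g v)
  pairs-at-odd f g zero    = refl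
  pairs-at-odd f g (suc v) rewrite +-suc (toℕ v) (toℕ v) = pairs-at-odd (f ∘ suc) (g ∘ suc) v

  toPairs : ∀ n (xs : List A) → length xs ≡ n + n → ∃₂ λ (f g : Fin n → A) → xs ≡ pairs f g
  toPairs zero    []           _  = (λ ()) , (λ ()) , refl
  toPairs (suc n) (x ∷ [])     eq = contradiction (trans (suc-injective eq) (+-suc n n)) λ ()
  toPairs (suc n) (x ∷ y ∷ xs) eq with toPairs n xs (suc-injective (trans (suc-injective eq) (+-suc n n)))
  ... | f , g , refl = (λ { zero → x ; (suc i) → f i }) , (λ { zero → y ; (suc i) → g i }) , refl

open Pairs

pairs-cong : ∀ {A : Set} {n} {f f′ g g′ : Fin n → A} → (∀ v → f v ≡ f′ v) → (∀ v → g v ≡ g′ v) →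
             pairs f g ≡ pairs f′ g′
pairs-cong {n = zero}  ef eg = refl
pairs-cong {n = suc n} ef eg = cong₂ _∷_ (ef zero) (cong₂ _∷_ (eg zero) (pairs-cong (ef ∘ suc) (eg ∘ suc)))

module GraphRows (G : ColoredGraph) where

  open ColoredGraph G

  hueRow adjacencyRow : Vertex → List Bool
  hueRow v       = replicate (toℕ (color v)) true
  adjacencyRow v = List.tabulate (adjacent v)

  graphRows : List (List Bool)
  graphRows = replicate numColors true ∷ pairs hueRow adjacencyRow

  map-unary : ∀ m → map bit (replicate m true) ≡ unary m
  map-unary m = List.map-replicate bit m true

  concat-tabulate : ∀ {n} (f : Fin n → List Letter) (g h : Fin n → List Bool) →
                    (∀ v → f v ≡ encodeRow (g v) ++ encodeRow (h v)) →
                    concatMap f (List.allFin n) ≡ encodeRows (pairs g h)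
  concat-tabulate f g h eq = trans (cong List.concat (List.map-tabulate id f)) (go f g h eq)
    where
    go : ∀ {n} (f : Fin n → List Letter) (g h : Fin n → List Bool) →
         (∀ v → f v ≡ encodeRow (g v) ++ encodeRow (h v)) →
         List.concat (List.tabulate f) ≡ encodeRows (pairs g h)
    go {zero}  f g h eq = refl
    go {suc n} f g h eq = trans (cong₂ _++_ (eq zero) (go (f ∘ suc) (g ∘ suc) (h ∘ suc) (eq ∘ suc)))
      (List.++-assoc (encodeRow (g zero)) (encodeRow (h zero)) _)

  encodeColoredGraph-rows : encodeColoredGraph G ≡ encodeRows graphRows
  encodeColoredGraph-rows = trans
    (cong₂ (λ x y → x ++ # ∷ y) (sym (map-unary numColors)) (concat-tabulate _ hueRow adjacencyRow vertexRows))
    (sym (List.++-assoc (map bit (replicate numColors true)) [ # ] _))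
    where
    vertexRows : ∀ v → unary (toℕ (color v)) ++ # ∷ List.tabulate (λ u → bit (adjacent v u)) ++ [ # ] ≡
                       encodeRow (hueRow v) ++ encodeRow (adjacencyRow v)
    vertexRows v = trans
      (cong₂ (λ x y → x ++ # ∷ y ++ [ # ]) (sym (map-unary (toℕ (color v))))
        (sym (List.map-tabulate (adjacent v) bit)))
      (sym (List.++-assoc (map bit (hueRow v)) [ # ] _))

  length-adjacencyRow : ∀ v → length (adjacencyRow v) ≡ order
  length-adjacencyRow v = List.length-tabulate (adjacent v)

at-tabulate : ∀ {A : Set} {n} (f : Fin n → A) v → List.tabulate f at toℕ v ≡ just (f v)
at-tabulate f zero    = refl
at-tabulate f (suc v) = at-tabulate (f ∘ suc) v

replicate-true : ∀ s → (∀ t → s at t ≢ just false) → s ≡ replicate (length s) true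
replicate-true []          h = refl
replicate-true (true ∷ s)  h = cong (true ∷_) (replicate-true s (λ t → h (suc t)))
replicate-true (false ∷ s) h = contradiction refl (h 0)

at-replicate-true : ∀ m t → replicate m true at t ≢ just false
at-replicate-true zero    zero    ()
at-replicate-true zero    (suc t) ()
at-replicate-true (suc m) zero    ()
at-replicate-true (suc m) (suc t) = at-replicate-true m t

-- c is the number of rows before the description of the graph.
module GraphForms (c : ℕ) where

  -- Row c gives the number of colors and rows c + 1 + 2 v and c + 2 + 2 v belong to vertex v, which
  -- exists iff the first of these is below the final value of `ROW`. A unary number is read off as
  -- the column of the closing `#`. The color table includes the number of colors itself, for a
  -- later round in which no vertex is deleted.
  vtxForm adjForm hueForm clrForm : Form 2
  vtxForm = ex (ex (double c 3F 1F ∧ᶠ rel ROW 0F 0F ∧ᶠ less (1F ∷ []) 0F))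
  adjForm = rel VTX 1F 1F ∧ᶠ rel VTX 0F 0F ∧ᶠ ex (ex (double c 3F 1F ∧ᶠ successor 1F 0F ∧ᶠ rel ONE 0F 2F))
  hueForm = rel VTX 1F 1F ∧ᶠ ex (double c 2F 0F ∧ᶠ rel END 0F 1F)
  clrForm = ex (ex (isConst c 1F ∧ᶠ rel END 1F 0F ∧ᶠ neg (less (0F ∷ []) 3F)))

  graphTables : Prog 0
  graphTables = define VTX vtxForm ▹ define ADJ adjForm ▹ define HUE hueForm ▹ define CLR clrForm

≤-double : ∀ {a b} → a + a < b + b → a < b
≤-double {a} {b} lt with a <? b
... | yes a<b = a<b
... | no a≮b  = contradiction lt (≤⇒≯ (+-mono-≤ (≮⇒≥ a≮b) (≮⇒≥ a≮b)))

module RowStage (rs : List (List Bool)) where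

  w : List Letter
  w = encodeRows rs

  open Semantics w
  open Meaning {16} w
  open VocabularyMeaning w
  open Parsing w

  CellTables : Tables → Set
  CellTables ρ = ∀ a {x y} → x < N → y < N →
    T (ρ (tableOf a) x y) ⇔ (∃[ s ] (rs at x ≡ just s × encodeRow s at y ≡ just a))

  RowTable : Tables → Set
  RowTable ρ = ∀ {a b} → a < N → T (ρ ROW a b) ⇔ a ≡ length rs

  row<N : ∀ {i} → i ≤ length rs → i < N
  row<N i≤ = within (≤-trans i≤ (length-rows rs))

  entry<N : ∀ {i s t} → rs at i ≡ just s → t ≤ length s → t < N
  entry<N {i} eq t≤ = within (≤-trans t≤ (length-row rs {i} eq))

  module _ {s : Store} (P : Parsed [] s) where

    end≡ : (Parsed.j P , Parsed.t P) ≡ (length rs , 0)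
    end≡ = trans (Parsed.end P)
        (trans (cong (λ u → endPosition u 0 0) (sym (List.++-identityʳ w))) (endPosition-rows rs [] 0))

    rowTable : RowTable (proj₁ s)
    rowTable a<N = ⇔-trans (Parsed.row P a<N)
      (subst (λ j → (_ ≡ Parsed.j P) ⇔ (_ ≡ j)) (cong proj₁ end≡) ⇔-refl)

    cellTables : CellTables (proj₁ s)
    cellTables a {x} {y} x<N y<N = ⇔-trans (mk⇔ inj₁ λ { (inj₁ h) → h ; (inj₂ ()) })
      (⇔-trans (Parsed.cells P a x<N y<N) (⇔-trans (Cell-rows rs 0)
        (mk⇔ (λ { (_ , s , refl , e , e′) → s , e , e′ }) (λ (s , e , e′) → x , s , refl , e , e′))))

  module _ (c : ℕ) where

    open GraphForms c

    -- The meaning of the tables for arbitrary rows, not just for encodings of graphs: the validity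
    -- check reads the same tables before anything is known about the rows.
    record RawTables (ρ : Tables) : Set where
      field
        rows  : RowTable ρ
        cells : CellTables ρ
        vtx   : ∀ {a b} → T (ρ VTX a b) ⇔ suc (c + (a + a)) < length rs
        adj   : ∀ {a b} → b < N → T (ρ ADJ a b) ⇔
                (suc (c + (a + a)) < length rs × suc (c + (b + b)) < length rs ×
                 ∃[ s ] (rs at suc (suc (c + (a + a))) ≡ just s × s at b ≡ just true))
        hue   : ∀ {a b} → b < N → T (ρ HUE a b) ⇔
                (suc (c + (a + a)) < length rs × ∃[ s ] (rs at suc (c + (a + a)) ≡ just s × length s ≡ b))
        clr   : ∀ {a b} → T (ρ CLR a b) ⇔ (∃[ s ] (rs at c ≡ just s × a ≤ length s))

    rawTables : ∀ {s} → RowTable (proj₁ s) → CellTables (proj₁ s) → RawTables (proj₁ (exec graphTables [] s))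
    rawTables {s} rows cells = record
      { rows = rows
      ; cells = λ { (bit true) → cells (bit true) ; (bit false) → cells (bit false) ; # → cells # }
      ; vtx = λ {a} {b} → ⇔-trans (evalF⇔Holds vtxForm (b ∷ a ∷ []) (proj₁ s)) (vtx⇔ a b)
      ; adj = λ {a} {b} b<N → ⇔-trans (evalF⇔Holds adjForm (b ∷ a ∷ []) (proj₁ s₁))
          (vtx₁ a a ×-⇔ (vtx₁ b b ×-⇔ adj⇔ a b b<N))
      ; hue = λ {a} {b} b<N → ⇔-trans (evalF⇔Holds hueForm (b ∷ a ∷ []) (proj₁ s₂))
          (vtx₁ a a ×-⇔ hue⇔ a b b<N)
      ; clr = λ {a} {b} → ⇔-trans (evalF⇔Holds clrForm (b ∷ a ∷ []) (proj₁ s₃)) (clr⇔ a b)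
      }
      where
      s₁ s₂ s₃ : Store
      s₁ = exec (define VTX vtxForm) [] s
      s₂ = exec (define ADJ adjForm) [] s₁
      s₃ = exec (define HUE hueForm) [] s₂
      vtx⇔ : ∀ a b → Holds vtxForm (b ∷ a ∷ []) (proj₁ s) ⇔ suc (c + (a + a)) < length rs
      vtx⇔ a b = mk⇔
        (λ (y , y<N , z , z<N , d , r , y<z) →
           subst₂ _<_ (to (double-⇔ (z ∷ y ∷ b ∷ a ∷ []) (proj₁ s) c 3F 1F y<N) d) (to (rows {b = z} z<N) r) y<z)
        (λ lt → _ , row<N (<⇒≤ lt) , _ , row<N ≤-refl ,
           from (double-⇔ (length rs ∷ _ ∷ b ∷ a ∷ []) (proj₁ s) c 3F 1F (row<N (<⇒≤ lt))) refl ,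
           from (rows {b = length rs} (row<N ≤-refl)) refl , lt)
      vtx₁ : ∀ a b → T (proj₁ s₁ VTX a b) ⇔ suc (c + (a + a)) < length rs
      vtx₁ a b = ⇔-trans (evalF⇔Holds vtxForm (b ∷ a ∷ []) (proj₁ s)) (vtx⇔ a b)
      adj⇔ : ∀ a b → b < N → Holds (ex (ex (double c 3F 1F ∧ᶠ successor 1F 0F ∧ᶠ rel ONE 0F 2F))) (b ∷ a ∷ [])
          (proj₁ s₁) ⇔
             (∃[ s ] (rs at suc (suc (c + (a + a))) ≡ just s × s at b ≡ just true))
      adj⇔ a b b<N = mk⇔
        (λ (y , y<N , z , z<N , d , sz , h) →
           case to (double-⇔ (z ∷ y ∷ b ∷ a ∷ []) (proj₁ s₁) c 3F 1F y<N) d of λ { refl →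
           case to (successor-⇔ (z ∷ y ∷ b ∷ a ∷ []) (proj₁ s₁) 1F 0F z<N) sz of λ { refl →
           case to (cells (bit true) z<N b<N) h of λ (s , e , e′) → s , e , to (at-map-bit s b) e′ } })
        (λ (r , e , e′) → case at-just⇒< rs {suc (suc (c + (a + a)))} e of λ lt →
           _ , row<N (≤-trans (n≤1+n _) (<⇒≤ lt)) , _ , row<N (<⇒≤ lt) ,
           from (double-⇔ (_ ∷ _ ∷ b ∷ a ∷ []) (proj₁ s₁) c 3F 1F (row<N (≤-trans (n≤1+n _) (<⇒≤ lt)))) refl ,
           from (successor-⇔ (_ ∷ _ ∷ b ∷ a ∷ []) (proj₁ s₁) 1F 0F (row<N (<⇒≤ lt))) refl ,
           from (cells (bit true) (row<N (<⇒≤ lt)) b<N) (r , e , from (at-map-bit r b) e′))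
      hue⇔ : ∀ a b → b < N → Holds (ex (double c 2F 0F ∧ᶠ rel END 0F 1F)) (b ∷ a ∷ []) (proj₁ s₂) ⇔
             (∃[ s ] (rs at suc (c + (a + a)) ≡ just s × length s ≡ b))
      hue⇔ a b b<N = mk⇔
        (λ (y , y<N , d , h) → case to (double-⇔ (y ∷ b ∷ a ∷ []) (proj₁ s₂) c 2F 0F y<N) d of λ { refl →
           case to (cells # y<N b<N) h of λ (s , e , e′) → s , e , to (at-map-# s b) e′ })
        (λ (r , e , e′) → case at-just⇒< rs {suc (c + (a + a))} e of λ lt →
           _ , row<N (<⇒≤ lt) ,
           from (double-⇔ (_ ∷ b ∷ a ∷ []) (proj₁ s₂) c 2F 0F (row<N (<⇒≤ lt))) refl ,
           from (cells # (row<N (<⇒≤ lt)) b<N) (r , e , from (at-map-# r b) e′))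
      clr⇔ : ∀ a b → Holds clrForm (b ∷ a ∷ []) (proj₁ s₃) ⇔ (∃[ s ] (rs at c ≡ just s × a ≤ length s))
      clr⇔ a b = mk⇔
        (λ (y , y<N , z , z<N , d , h , z≮a) →
           case to (isConst-⇔ (z ∷ y ∷ b ∷ a ∷ []) (proj₁ s₃) c 1F y<N) d of λ { refl →
           case to (cells # y<N z<N) h of λ (s , e , e′) → s , e ,
               ≤-trans (≮⇒≥ z≮a) (≤-reflexive (sym (to (at-map-# s z) e′))) })
        (λ (r , e , a≤) → case at-just⇒< rs {c} e of λ lt →
           c , row<N (<⇒≤ lt) , length r , entry<N {c} e ≤-refl ,
           from (isConst-⇔ (length r ∷ c ∷ b ∷ a ∷ []) (proj₁ s₃) c 1F (row<N (<⇒≤ lt))) refl ,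
           from (cells # (row<N (<⇒≤ lt)) (entry<N {c} e ≤-refl)) (r , e , from (at-map-# r (length r)) refl) ,
           ≤⇒≯ a≤)

record GraphTables (G : ColoredGraph) (n : ℕ) (ρ : Tables) : Set where
  open ColoredGraph G
  field
    vtx       : ∀ {a b} → T (ρ VTX a b) ⇔ a < order
    adj       : ∀ u v → T (ρ ADJ (toℕ u) (toℕ v)) ⇔ Adj u v
    hue       : ∀ u {i} → i < n → T (ρ HUE (toℕ u) i) ⇔ toℕ (color u) ≡ i
    clr       : ∀ {i b} → T (ρ CLR i b) ⇔ i ≤ numColors
    order<    : order < n
    numColors< : numColors < n

module GraphStage (G : ColoredGraph) (pre : List (List Bool)) where

  open ColoredGraph G
  open GraphRows G

  rs : List (List Bool)
  rs = pre ++ graphRows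

  open RowStage rs
  open Semantics w

  private
    c : ℕ
    c = length pre

  length-rs : length rs ≡ suc (c + (order + order))
  length-rs = trans (List.length-++ pre)
      (trans (cong (λ l → c + suc l) (length-pairs hueRow adjacencyRow)) (+-suc c _))

  rs-at : ∀ i → rs at (c + i) ≡ graphRows at i
  rs-at i = at-++ʳ pre i

  at-hue : ∀ v → rs at suc (c + (toℕ v + toℕ v)) ≡ just (hueRow v)
  at-hue v = trans (cong (rs at_) (sym (+-suc c _))) (trans (rs-at _) (pairs-at-even hueRow adjacencyRow v))

  at-adjacency : ∀ v → rs at suc (suc (c + (toℕ v + toℕ v))) ≡ just (adjacencyRow v)
  at-adjacency v = trans (cong (rs at_) (sym (trans (+-suc c _) (cong suc (+-suc c _)))))
    (trans (rs-at _) (pairs-at-odd hueRow adjacencyRow v))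

  at-colors : rs at c ≡ just (replicate numColors true)
  at-colors = trans (cong (rs at_) (sym (+-identityʳ c))) (rs-at 0)

  vertex-row : ∀ {a} → suc (c + (a + a)) < length rs ⇔ a < order
  vertex-row {a} = mk⇔
    (λ lt → ≤-double (+-cancelˡ-< c _ _ (≤-pred (subst (suc (c + (a + a)) <_) length-rs lt))))
    (λ a<n → subst (suc (c + (a + a)) <_) (sym length-rs) (s≤s (+-monoʳ-< c (+-mono-< a<n a<n))))

  toℕ<N : ∀ (u : Vertex) → toℕ u < N
  toℕ<N u = <-trans (Fin.toℕ<n u) order<N
    where
    order<N : order < N
    order<N = row<N (≤-trans (m≤n+m order order)
        (≤-trans (m≤n+m _ c) (≤-trans (n≤1+n _) (≤-reflexive (sym length-rs)))))

  graphTables-correct : ∀ {ρ} → RawTables c ρ → GraphTables G N ρ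
  graphTables-correct {ρ} raw = record
    { vtx = ⇔-trans vtx vertex-row
    ; adj = λ u v → ⇔-trans (adj (toℕ<N v)) (mk⇔
        (λ { (_ , _ , s , e , e′) → case just-injective (trans (sym (at-adjacency u)) e) of λ { refl →
             subst T (just-injective (trans (sym e′) (at-tabulate (adjacent u) v))) tt } })
        (λ a → from vertex-row (Fin.toℕ<n u) , from vertex-row (Fin.toℕ<n v) , _ , at-adjacency u ,
               trans (at-tabulate (adjacent u) v) (cong just (T⇒≡ a))))
    ; hue = λ u i<N → ⇔-trans (hue i<N) (mk⇔
        (λ { (_ , s , e , refl) → case just-injective (trans (sym (at-hue u)) e) of
          λ { refl → sym (List.length-replicate _) } })
        (λ { refl → from vertex-row (Fin.toℕ<n u) , _ , at-hue u , List.length-replicate _ }))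
    ; clr = ⇔-trans clr (mk⇔
        (λ { (s , e , i≤) → case just-injective (trans (sym at-colors) e) of
          λ { refl → ≤-trans i≤ (≤-reflexive (List.length-replicate numColors)) } })
        (λ i≤ → _ , at-colors , ≤-trans i≤ (≤-reflexive (sym (List.length-replicate numColors)))))
    ; order< = row<N (≤-trans (m≤n+m order order)
      (≤-trans (m≤n+m _ c) (≤-trans (n≤1+n _) (≤-reflexive (sym length-rs)))))
    ; numColors< = entry<N {c} at-colors (≤-reflexive (sym (List.length-replicate numColors)))
    }
    where
    open RawTables raw
    T⇒≡ : ∀ {b} → T b → b ≡ true
    T⇒≡ {true} _ = refl

-- Weak color-avoiding connectivity by transitive closures.

vertexPair : ∀ {d} → Form (2 + d)
vertexPair = rel VTX 1F 1F ∧ᶠ rel VTX 0F 0F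

-- Reflexivity includes the deleted vertices, in accordance with the empty walks of
-- `SameComponentAvoiding`; the two `HUE` alternatives of `restrictForm` admit deleted vertices in
-- any case.
baseForm restrictForm : Form 3
baseForm     = vertexPair ∧ᶠ (same 1F 0F ∨ᶠ rel ADJ 1F 0F ∧ᶠ neg (rel HUE 1F 2F) ∧ᶠ neg (rel HUE 0F 2F))
restrictForm = rel WCA 1F 0F ∧ᶠ (rel HUE 1F 2F ∨ᶠ rel HUE 0F 2F ∨ᶠ rel RCH 1F 0F)

closeForm : Form 4
closeForm = rel RCH 1F 0F ∨ᶠ rel RCH 1F 2F ∧ᶠ rel RCH 2F 0F

-- No vertex has the color number numColors, so the last round stands for
-- connectivity in the whole graph.  RCH is computed by Warshall's algorithm.
avoidColor connectivityRound : Prog 1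
avoidColor        = (define RCH baseForm ▹ for (define RCH closeForm)) ▹ define WCA restrictForm
connectivityRound = when (rel CLR 0F 0F) avoidColor

connectivity : Prog 0
connectivity = define WCA vertexPair ▹ for connectivityRound

define-other : ∀ ρ A f {B} → B ≢ A → (ρ [ A ↦ f ]) B ≡ ρ B
define-other ρ A f {B} B≢A rewrite dec-false (B Fin.≟ A) B≢A = refl

module ConnectivityStage (G : ColoredGraph) (w : List Letter) where

  open ColoredGraph G
  open WeakConnectivity G
  open Semantics w
  open Meaning {16} w
  open VocabularyMeaning w

  when-elim : ∀ {d} (φ : Form d) P env s (Q : Store → Set) →
              (Holds φ env (proj₁ s) → Q (exec P env s)) → (¬ Holds φ env (proj₁ s) → Q s) →
              Q (exec (when φ P) env s)
  when-elim φ P env s Q yes′ no′ with evalF φ env (proj₁ s) | holds-reflects φ env (proj₁ s)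
  ... | true  | ofʸ h  = yes′ h
  ... | false | ofⁿ ¬h = no′ ¬h

  module _ (ρ₀ : Tables) (o₀ : List Letter) (tables : GraphTables G N ρ₀) where

    open GraphTables tables

    Base : ℕ → ℕ → ℕ → Set
    Base i a b = (a < order × b < order) × (T (ρ₀ ADJ a b) × ¬ T (ρ₀ HUE a i) × ¬ T (ρ₀ HUE b i))

    record Frame (s : Store) : Set where
      field
        others : ∀ {B} → B ≢ RCH → B ≢ WCA → proj₁ s B ≡ ρ₀ B
        silent : proj₂ s ≡ o₀

    module Closure (i : ℕ) where

      -- Warshall's invariant without reference to inner vertices of paths: the relation is sound,
      -- contains the base and is transitive through every midpoint z < m. At m = N it is
      -- transitive, as all vertices are below N.
      record Closing (wca : ℕ → ℕ → Bool) (m : ℕ) (s : Store) : Set where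
        field
          frame  : Frame s
          same-wca : proj₁ s WCA ≡ wca
          sound  : ∀ {a b} → T (proj₁ s RCH a b) → (a < order × b < order) × Star (Base i) a b
          base   : ∀ {a b} → a < order × b < order → a ≡ b ⊎ Base i a b → T (proj₁ s RCH a b)
          closed : ∀ {a b z} → z < m → T (proj₁ s RCH a z) → T (proj₁ s RCH z b) → T (proj₁ s RCH a b)

      initial-closing : ∀ {s} → Frame s → Closing (proj₁ s WCA) 0 (exec (define RCH baseForm) (i ∷ []) s)
      initial-closing {s} F = record
        { frame = record { others = λ B≢R B≢W →
          trans (define-other (proj₁ s) RCH _ B≢R) (Frame.others F B≢R B≢W) ; silent = Frame.silent F }
        ; same-wca = refl
        ; sound = λ {a} {b} h → case to (base⇔ a b) h of λ
            { (ab , inj₁ refl) → ab , ε ; (ab , inj₂ e) → ab , (ab , e) ◅ ε }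
        ; base = λ { {a} {b} ab (inj₁ e) → from (base⇔ a b) (ab , inj₁ e)
                   ; {a} {b} ab (inj₂ (_ , e)) → from (base⇔ a b) (ab , inj₂ e) }
        ; closed = λ ()
        }
        where
        is-vtx : ∀ a → T (proj₁ s VTX a a) ⇔ a < order
        is-vtx a = subst (λ f → T (f a a) ⇔ a < order) (sym (Frame.others F (λ ()) (λ ()))) vtx
        is-adj : ∀ a b → T (proj₁ s ADJ a b) ⇔ T (ρ₀ ADJ a b)
        is-adj a b = subst (λ f → T (f a b) ⇔ T (ρ₀ ADJ a b)) (sym (Frame.others F (λ ()) (λ ()))) ⇔-refl
        not-hue : ∀ a → (¬ T (proj₁ s HUE a i)) ⇔ (¬ T (ρ₀ HUE a i))
        not-hue a = subst (λ f → (¬ T (f a i)) ⇔ (¬ T (ρ₀ HUE a i))) (sym (Frame.others F (λ ()) (λ ()))) ⇔-refl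
        base⇔ : ∀ a b → T (proj₁ (exec (define RCH baseForm) (i ∷ []) s) RCH a b) ⇔
                ((a < order × b < order) × (a ≡ b ⊎ (T (ρ₀ ADJ a b) × ¬ T (ρ₀ HUE a i) × ¬ T (ρ₀ HUE b i))))
        base⇔ a b = ⇔-trans (evalF⇔Holds baseForm (b ∷ a ∷ i ∷ []) (proj₁ s))
          ((is-vtx a ×-⇔ is-vtx b) ×-⇔
           (same-⇔ (b ∷ a ∷ i ∷ []) (proj₁ s) 1F 0F ⊎-⇔ (is-adj a b ×-⇔ (not-hue a ×-⇔ not-hue b))))

      close-step : ∀ {wca m s} → Closing wca m s → Closing wca (suc m) (exec (define RCH closeForm) (m ∷ i ∷ []) s)
      close-step {wca} {m} {s} C = record
        { frame = record { others = λ B≢R B≢W →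
          trans (define-other (proj₁ s) RCH _ B≢R) (Frame.others frame B≢R B≢W) ; silent = Frame.silent frame }
        ; same-wca = same-wca
        ; sound = λ {a} {b} h → case to (close⇔ a b) h of λ
            { (inj₁ h) → sound h
            ; (inj₂ (h , h′)) → case sound h of
              λ { ((a< , _) , p) → case sound h′ of λ { ((_ , b<) , q) → (a< , b<) , p ◅◅ q } } }
        ; base = λ {a} {b} ab e → from (close⇔ a b) (inj₁ (base ab e))
        ; closed = λ {a} {b} {z} z<1+m h h′ →
          from (close⇔ a b) (compose (m<1+n⇒m<n∨m≡n z<1+m) (to (close⇔ a z) h) (to (close⇔ z b) h′))
        }
        where
        open Closing C
        open import Relation.Binary.Construct.Closure.ReflexiveTransitive using (_◅◅_)
        R : ℕ → ℕ → Set
        R a b = T (proj₁ s RCH a b)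
        close⇔ : ∀ a b → T (proj₁ (exec (define RCH closeForm) (m ∷ i ∷ []) s) RCH a b) ⇔ (R a b ⊎ (R a m × R m b))
        close⇔ a b = evalF⇔Holds closeForm (b ∷ a ∷ m ∷ i ∷ []) (proj₁ s)
        into : ∀ {a} → R a m ⊎ (R a m × R m m) → R a m
        into (inj₁ h)       = h
        into (inj₂ (h , _)) = h
        out : ∀ {b} → R m b ⊎ (R m m × R m b) → R m b
        out (inj₁ h)       = h
        out (inj₂ (_ , h)) = h
        -- A new pair factors through m. For z < m the old transitivity at z removes z from the part
        -- before or after m; if both factors pass through m, the stretch from m to z and back is
        -- cut out.
        compose : ∀ {a z b} → z < m ⊎ z ≡ m → R a z ⊎ (R a m × R m z) → R z b ⊎ (R z m × R m b) →
            R a b ⊎ (R a m × R m b)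
        compose (inj₂ refl) h h′ = inj₂ (into h , out h′)
        compose (inj₁ z<m) (inj₁ h)        (inj₁ h′)       = inj₁ (closed z<m h h′)
        compose (inj₁ z<m) (inj₁ h)        (inj₂ (h′ , k)) = inj₂ (closed z<m h h′ , k)
        compose (inj₁ z<m) (inj₂ (h , k))  (inj₁ h′)       = inj₂ (h , closed z<m k h′)
        compose (inj₁ z<m) (inj₂ (h , _))  (inj₂ (_ , k))  = inj₂ (h , k)

      closing-complete : ∀ {wca s} → Closing wca N s → ∀ {a b} → a < order → Star (Base i) a b → T (proj₁ s RCH a b)
      closing-complete C a< ε = Closing.base C (a< , a<) (inj₁ refl)
      closing-complete C a< (e@((_ , c<) , _) ◅ p) = Closing.closed C (<-trans c< order<)
        (Closing.base C (a< , c<) (inj₂ e)) (closing-complete C c< p)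

      closed-tables : ∀ {s} → Frame s →
        Closing (proj₁ s WCA) N (exec (define RCH baseForm ▹ for (define RCH closeForm)) (i ∷ []) s)
      closed-tables {s} F = loop-invariant (Closing (proj₁ s WCA)) N (λ _ → close-step) (initial-closing F)

    Linked : ℕ → ℕ → ℕ → Set
    Linked i a b = T (ρ₀ HUE a i) ⊎ T (ρ₀ HUE b i) ⊎ Star (Base i) a b

    record Linking (v : ℕ) (s : Store) : Set where
      field
        frame : Frame s
        wca   : ∀ {a b} → T (proj₁ s WCA a b) ⇔
            ((a < order × b < order) × (∀ i → i < v → i ≤ numColors → Linked i a b))

    link-step : ∀ {v s} → Linking v s → Linking (suc v) (exec connectivityRound (v ∷ []) s)
    link-step {v} {s} L = when-elim (rel CLR 0F 0F) avoidColor (v ∷ []) s (Linking (suc v)) link skipped′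
      where
      open Linking L
      open Closure v
      is-clr : T (proj₁ s CLR v v) ⇔ v ≤ numColors
      is-clr = subst (λ f → T (f v v) ⇔ v ≤ numColors) (sym (Frame.others frame (λ ()) (λ ()))) clr
      -- Rounds beyond the number of colors change nothing, and the invariant asks nothing about
      -- them.
      skipped′ : ¬ T (proj₁ s CLR v v) → Linking (suc v) s
      skipped′ ¬clr = record { frame = frame ; wca =
          ⇔-trans wca (⇔-refl ×-⇔ mk⇔ extend (λ h i i<v → h i (m<n⇒m<1+n i<v))) }
        where
        extend : ∀ {a b} → (∀ i → i < v → i ≤ numColors → Linked i a b) → ∀ i → i < suc v → i ≤ numColors →
            Linked i a b
        extend h i i<1+v i≤ with m<1+n⇒m<n∨m≡n i<1+v
        ... | inj₁ i<v  = h i i<v i≤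
        ... | inj₂ refl = contradiction (from is-clr i≤) ¬clr
      s₁ : Store
      s₁ = exec (define RCH baseForm ▹ for (define RCH closeForm)) (v ∷ []) s
      C : Closing (proj₁ s WCA) N s₁
      C = closed-tables frame
      link : T (proj₁ s CLR v v) → Linking (suc v) (exec (define WCA restrictForm) (v ∷ []) s₁)
      link is = record
        { frame = record { others = λ B≢R B≢W →
          trans (define-other (proj₁ s₁) WCA _ B≢W) (Frame.others (Closing.frame C) B≢R B≢W)
                         ; silent = Frame.silent (Closing.frame C) }
        ; wca = λ {a} {b} → ⇔-trans (evalF⇔Holds restrictForm (b ∷ a ∷ v ∷ []) (proj₁ s₁))
            (⇔-trans ((was-wca a b) ×-⇔ (is-hue a ⊎-⇔ (is-hue b ⊎-⇔ ⇔-refl))) (mk⇔ (add a b) (remove a b)))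
        }
        where
        was-wca : ∀ a b → T (proj₁ s₁ WCA a b) ⇔
            ((a < order × b < order) × (∀ i → i < v → i ≤ numColors → Linked i a b))
        was-wca a b = subst (λ f → T (f a b) ⇔ _) (sym (Closing.same-wca C)) wca
        is-hue : ∀ a → T (proj₁ s₁ HUE a v) ⇔ T (ρ₀ HUE a v)
        is-hue a = subst (λ f → T (f a v) ⇔ T (ρ₀ HUE a v))
            (sym (Frame.others (Closing.frame C) (λ ()) (λ ()))) ⇔-refl
        add : ∀ a b → ((a < order × b < order) × (∀ i → i < v → i ≤ numColors → Linked i a b)) ×
                (T (ρ₀ HUE a v) ⊎ T (ρ₀ HUE b v) ⊎ T (proj₁ s₁ RCH a b)) →
              (a < order × b < order) × (∀ i → i < suc v → i ≤ numColors → Linked i a b)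
        add a b ((ab , h) , r) = ab , λ i i<1+v i≤ → case m<1+n⇒m<n∨m≡n i<1+v of λ
          { (inj₁ i<v) → h i i<v i≤
          ; (inj₂ refl) → Sum.map₂ (Sum.map₂ (λ x → proj₂ (Closing.sound C x))) r }
        remove : ∀ a b → (a < order × b < order) × (∀ i → i < suc v → i ≤ numColors → Linked i a b) →
              ((a < order × b < order) × (∀ i → i < v → i ≤ numColors → Linked i a b)) ×
                (T (ρ₀ HUE a v) ⊎ T (ρ₀ HUE b v) ⊎ T (proj₁ s₁ RCH a b))
        remove a b (ab , h) = (ab , λ i i<v → h i (m<n⇒m<1+n i<v)) ,
          Sum.map₂ (Sum.map₂ (closing-complete C (proj₁ ab))) (h v ≤-refl (to is-clr is))

    linked : Linking N (exec connectivity [] (ρ₀ , o₀))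
    linked = loop-invariant Linking N (λ _ → link-step) record
      { frame = record { others = λ _ B≢W → define-other ρ₀ WCA _ B≢W ; silent = refl }
      ; wca = λ {a} {b} → ⇔-trans (evalF⇔Holds vertexPair (b ∷ a ∷ []) ρ₀)
          (⇔-trans (vtx ×-⇔ vtx) (mk⇔ (λ ab → ab , λ _ ()) proj₁))
      }

    private
      ρ₁ : Tables
      ρ₁ = proj₁ (exec connectivity [] (ρ₀ , o₀))

    -- The tables relate numbers, the problem relates vertices. Since each step ends at the number
    -- of a vertex, a walk on numbers that starts at one never leaves them.
    Star-lift : ∀ {R : ℕ → ℕ → Set} {Q : Vertex → Vertex → Set} →
      (∀ {u b} → R (toℕ u) b → b < order) → (∀ {u v} → R (toℕ u) (toℕ v) → Q u v) →
      ∀ {u v a b} → a ≡ toℕ u → b ≡ toℕ v → Star R a b → Star Q u v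
    Star-lift bound step a≡ b≡ ε = subst (Star _ _) (Fin.toℕ-injective (trans (sym a≡) b≡)) ε
    Star-lift {R} bound step {u} a≡ b≡ (_◅_ {j = c} e p) =
      step (subst₂ R a≡ (sym (Fin.toℕ-fromℕ< c<)) e) ◅ Star-lift bound step (sym (Fin.toℕ-fromℕ< c<)) b≡ p
      where
      c< : c < order
      c< = bound {u} (subst (λ a → R a c) a≡ e)

    color<N : ∀ (i : Fin numColors) → toℕ i < N
    color<N i = <-trans (Fin.toℕ<n i) numColors<

    hue-color : ∀ u i → T (ρ₀ HUE (toℕ u) (toℕ i)) ⇔ color u ≡ i
    hue-color u i = ⇔-trans (hue u (color<N i)) (mk⇔ Fin.toℕ-injective (cong toℕ))

    no-hue : ∀ u → ¬ T (ρ₀ HUE (toℕ u) numColors)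
    no-hue u h = <⇒≢ (Fin.toℕ<n (color u)) (to (hue u numColors<) h)

    linked-color : ∀ u v i → Linked (toℕ i) (toℕ u) (toℕ v) ⇔ WeaklyAvoidingConnected i u v
    linked-color u v i = ⇔-trans (hue-color u i ⊎-⇔ (hue-color v i ⊎-⇔ mk⇔
        (Star-lift (λ ((_ , b<) , _) → b<)
          (λ {x} {y} (_ , a , ¬x , ¬y) → (λ e → ¬x (from (hue-color x i) e)) ,
            (λ e → ¬y (from (hue-color y i) e)) , to (adj x y) a) refl refl)
        (gmap toℕ (λ {x} {y} (¬x , ¬y , a) → (Fin.toℕ<n x , Fin.toℕ<n y) , from (adj x y) a ,
          (λ e → ¬x (to (hue-color x i) e)) , (λ e → ¬y (to (hue-color y i) e))))))
      (mk⇔ Sum.assocˡ Sum.assocʳ)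

    linked-all : ∀ u v → Linked numColors (toℕ u) (toℕ v) ⇔ SameComponent u v
    linked-all u v = mk⇔
      (λ { (inj₁ h) → contradiction h (no-hue u) ; (inj₂ (inj₁ h)) → contradiction h (no-hue v)
         ; (inj₂ (inj₂ p)) → Star-lift (λ ((_ , b<) , _) → b<) (λ {x} {y} (_ , a , _) → to (adj x y) a) refl refl p })
      (λ p → inj₂ (inj₂ (gmap toℕ
        (λ {x} {y} a → (Fin.toℕ<n x , Fin.toℕ<n y) , from (adj x y) a , no-hue x , no-hue y) p)))

    connectivity-correct : ∀ {u v} → T (ρ₁ WCA (toℕ u) (toℕ v)) ⇔ u ∼ v
    connectivity-correct {u} {v} = ⇔-trans (Linking.wca linked) (mk⇔
      (λ (_ , h) → to (linked-all u v) (h numColors numColors< ≤-refl) ,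
                   λ i → to (linked-color u v i) (h (toℕ i) (color<N i) (<⇒≤ (Fin.toℕ<n i))))
      (λ (c , a) → (Fin.toℕ<n u , Fin.toℕ<n v) , every c a))
      where
      every : SameComponent u v → (∀ i → WeaklyAvoidingConnected i u v) → ∀ i → i < N → i ≤ numColors →
          Linked i (toℕ u) (toℕ v)
      every c a i _ i≤ with m≤n⇒m<n∨m≡n i≤
      ... | inj₂ refl = from (linked-all u v) c
      ... | inj₁ i<   = subst (λ i → Linked i (toℕ u) (toℕ v)) (Fin.toℕ-fromℕ< i<)
          (from (linked-color u v (fromℕ< i<)) (a (fromℕ< i<)))

    wca-vertices : ∀ {a b} → T (ρ₁ WCA a b) → a < order × b < order
    wca-vertices h = proj₁ (to (Linking.wca linked) h)

    connectivity-frame : Frame (exec connectivity [] (ρ₀ , o₀))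
    connectivity-frame = Linking.frame linked

-- The table of generating pairs.

sameHue : ∀ {d} → Fin d → Fin d → Form d
sameHue x y = ex (rel HUE (suc x) 0F ∧ᶠ rel HUE (suc y) 0F)

allSameHue : Form 2
allSameHue = all (rel WCA 2F 0F ⇒ᶠ sameHue 2F 0F)

genForm : Form 2
genForm = rel WCA 1F 0F ∧ᶠ (neg (sameHue 1F 0F) ∨ᶠ same 1F 0F ∧ᶠ allSameHue)

generators : Prog 0
generators = connectivity ▹ define GEN genForm

record ComponentTables (G : ColoredGraph) (n : ℕ) (ρ : Tables) : Set where
  open ColoredGraph G
  open WeakConnectivity G
  field
    vtx          : ∀ {a b} → T (ρ VTX a b) ⇔ a < order
    wca          : ∀ {u v} → T (ρ WCA (toℕ u) (toℕ v)) ⇔ u ∼ v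
    wca-vertices : ∀ {a b} → T (ρ WCA a b) → a < order × b < order
    gen          : ∀ {u v} → T (ρ GEN (toℕ u) (toℕ v)) ⇔ Generates u v
    gen-vertices : ∀ {a b} → T (ρ GEN a b) → a < order × b < order
    order<       : order < n

¬-cong : ∀ {A B : Set} → A ⇔ B → (¬ A) ⇔ (¬ B)
¬-cong e = mk⇔ (λ ¬a b → ¬a (from e b)) (λ ¬b a → ¬b (to e a))

module GeneratorStage (G : ColoredGraph) (w : List Letter) where

  open ColoredGraph G
  open WeakConnectivity G
  open Semantics w
  open Meaning {16} w
  open VocabularyMeaning w
  open ConnectivityStage G w

  module _ {ρ₀ : Tables} {o₀ : List Letter} (tables : GraphTables G N ρ₀) where

    open GraphTables tables

    private
      s₁ s₂ : Store
      s₁ = exec connectivity [] (ρ₀ , o₀)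
      s₂ = exec (define GEN genForm) [] s₁

      framed : Frame ρ₀ o₀ tables s₁
      framed = connectivity-frame ρ₀ o₀ tables

    generators-others : ∀ {B} → B ≢ RCH → B ≢ WCA → B ≢ GEN → proj₁ (exec generators [] (ρ₀ , o₀)) B ≡ ρ₀ B
    generators-others B≢R B≢W B≢G = trans (define-other (proj₁ s₁) GEN _ B≢G) (Frame.others framed B≢R B≢W)

    generators-silent : proj₂ (exec generators [] (ρ₀ , o₀)) ≡ o₀
    generators-silent = Frame.silent framed

    sameHue-⇔ : ∀ {d} (env : Vec ℕ d) x y u v → lookup env x ≡ toℕ u → lookup env y ≡ toℕ v →
                Holds (sameHue x y) env (proj₁ s₁) ⇔ color u ≡ color v
    sameHue-⇔ env x y u v x≡ y≡ rewrite x≡ | y≡ | Frame.others framed {HUE} (λ ()) (λ ()) = mk⇔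
      (λ (i , i<N , h , h′) → Fin.toℕ-injective (trans (to (hue u i<N) h) (sym (to (hue v i<N) h′))))
      (λ e → _ , color<N′ , from (hue u color<N′) refl , from (hue v color<N′) (cong toℕ (sym e)))
      where
      color<N′ : toℕ (color u) < N
      color<N′ = <-trans (Fin.toℕ<n (color u)) numColors<

    private
      wca₁ : ∀ {u v} → T (proj₁ s₁ WCA (toℕ u) (toℕ v)) ⇔ u ∼ v
      wca₁ = connectivity-correct ρ₀ o₀ tables

    allSameHue-⇔ : ∀ b u → Holds allSameHue (b ∷ toℕ u ∷ []) (proj₁ s₁) ⇔ (∀ x → u ∼ x → color u ≡ color x)
    allSameHue-⇔ b u = mk⇔
      (λ h x ux → to (sameHue-⇔ (toℕ x ∷ b ∷ toℕ u ∷ []) 2F 0F u x refl refl)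
        (to (⇒ᶠ-⇔ (toℕ x ∷ b ∷ toℕ u ∷ []) (proj₁ s₁) (rel WCA 2F 0F) (sameHue 2F 0F))
          (h (toℕ x) (<-trans (Fin.toℕ<n x) order<)) (from wca₁ ux)))
      (λ h a a<N → from (⇒ᶠ-⇔ (a ∷ b ∷ toℕ u ∷ []) (proj₁ s₁) (rel WCA 2F 0F) (sameHue 2F 0F)) λ ua →
        case wca-vertices ρ₀ o₀ tables ua of λ (_ , a<) →
        from (sameHue-⇔ (a ∷ b ∷ toℕ u ∷ []) 2F 0F u (fromℕ< a<) refl (sym (Fin.toℕ-fromℕ< a<)))
          (h (fromℕ< a<) (to wca₁ (subst (λ c → T (proj₁ s₁ WCA (toℕ u) c)) (sym (Fin.toℕ-fromℕ< a<)) ua))))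

    componentTables : ComponentTables G N (proj₁ (exec generators [] (ρ₀ , o₀)))
    componentTables = record
      { vtx = λ {a} {b} → subst (λ f → T (f a b) ⇔ a < order) (sym (generators-others (λ ()) (λ ()) (λ ()))) vtx
      ; wca = wca₁
      ; wca-vertices = wca-vertices ρ₀ o₀ tables
      ; gen = λ {u} {v} → ⇔-trans (evalF⇔Holds genForm (toℕ v ∷ toℕ u ∷ []) (proj₁ s₁))
          (wca₁ ×-⇔ (¬-cong (sameHue-⇔ (toℕ v ∷ toℕ u ∷ []) 1F 0F u v refl refl) ⊎-⇔
            (⇔-trans (same-⇔ (toℕ v ∷ toℕ u ∷ []) (proj₁ s₁) 1F 0F) (mk⇔ Fin.toℕ-injective (cong toℕ))
              ×-⇔ allSameHue-⇔ (toℕ v) u)))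
      ; gen-vertices = λ {a} {b} h →
        wca-vertices ρ₀ o₀ tables (proj₁ (to (evalF⇔Holds genForm (b ∷ a ∷ []) (proj₁ s₁)) h))
      ; order< = order<
      }

-- Listing the components

inBoth : ∀ {d} → Fin d → Fin d → Fin d → Form d
inBoth u v x = rel WCA u x ∧ᶠ rel WCA v x

differForm : Form 4
differForm = ex (inBoth 4F 3F 0F ∧ᶠ neg (inBoth 2F 1F 0F) ∨ᶠ neg (inBoth 4F 3F 0F) ∧ᶠ inBoth 2F 1F 0F)

earlierForm : Form 4
earlierForm = rel GEN 1F 0F ∧ᶠ (less (1F ∷ []) 3F ∨ᶠ same 1F 3F ∧ᶠ less (0F ∷ []) 2F)

-- Lexicographic minimality of the generating pair makes every component listed
-- once.
keepForm : Form 2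
keepForm = rel GEN 1F 0F ∧ᶠ all (all (earlierForm ⇒ᶠ differForm))

emitOne emitZero emitBit : Prog 3
emitOne  = when (inBoth 2F 1F 0F) (emit (bit true))
emitZero = when (neg (inBoth 2F 1F 0F)) (emit (bit false))
emitBit  = when (rel VTX 0F 0F) (emitOne ▹ emitZero)

emitSets : Prog 0
emitSets = for (for (when (rel KEEP 1F 0F) (for emitBit ▹ emit #)))

noVertex : Form 0
noVertex = neg (ex (rel VTX 0F 0F))

-- The graph without vertices has one component, the empty set.
listing : Prog 0
listing = define KEEP keepForm ▹ when noVertex (emit #) ▹ emitSets

listComponents : Prog 0
listComponents = (parse ▹ GraphForms.graphTables 0) ▹ generators ▹ listing

concatBelow : ∀ {A : Set} → ℕ → (ℕ → List A) → List A
concatBelow zero    e = []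
concatBelow (suc n) e = concatBelow n e ++ e n

module _ {A : Set} where

  concatBelow-cong : ∀ n {e e′ : ℕ → List A} → (∀ v → v < n → e v ≡ e′ v) → concatBelow n e ≡ concatBelow n e′
  concatBelow-cong zero    h = refl
  concatBelow-cong (suc n) h = cong₂ _++_ (concatBelow-cong n (λ v v<n → h v (m<n⇒m<1+n v<n))) (h n ≤-refl)

  concatMap-concatBelow : ∀ {B : Set} (f : A → List B) n (e : ℕ → List A) →
                          concatMap f (concatBelow n e) ≡ concatBelow n (concatMap f ∘ e)
  concatMap-concatBelow f zero    e = refl
  concatMap-concatBelow f (suc n) e = trans (List.concatMap-++ f (concatBelow n e) (e n))
    (cong (_++ concatMap f (e n)) (concatMap-concatBelow f n e))

  All-concatBelow : ∀ {P : A → Set} n (e : ℕ → List A) → (∀ v → v < n → All P (e v)) → All P (concatBelow n e)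
  All-concatBelow zero    e h = []
  All-concatBelow (suc n) e h = All.++⁺ (All-concatBelow n e λ v v<n → h v (m<n⇒m<1+n v<n)) (h n ≤-refl)

  AllPairs-concatBelow : ∀ {R : A → A → Set} n (e : ℕ → List A) → (∀ v → v < n → AllPairs R (e v)) →
    (∀ u v → u < v → v < n → All (λ x → All (R x) (e v)) (e u)) → AllPairs R (concatBelow n e)
  AllPairs-concatBelow zero    e h k = []
  AllPairs-concatBelow (suc n) e h k = AllPairs.++⁺
    (AllPairs-concatBelow n e (λ v v<n → h v (m<n⇒m<1+n v<n)) (λ u v u<v v<n → k u v u<v (m<n⇒m<1+n v<n)))
    (h n ≤-refl) (All-concatBelow n e (λ u u<n → k u n u<n ≤-refl))

  ∈-concatBelow⁺ : ∀ {n x v} (e : ℕ → List A) → v < n → x ∈ e v → x ∈ concatBelow n e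
  ∈-concatBelow⁺ {suc n} e v<1+n x∈ with m<1+n⇒m<n∨m≡n v<1+n
  ... | inj₁ v<n  = ∈-++⁺ˡ (∈-concatBelow⁺ e v<n x∈)
  ... | inj₂ refl = ∈-++⁺ʳ (concatBelow n e) x∈

  ∈-concatBelow⁻ : ∀ n {x} (e : ℕ → List A) → x ∈ concatBelow n e → ∃[ v ] (v < n × x ∈ e v)
  ∈-concatBelow⁻ (suc n) e x∈ with ∈-++⁻ (concatBelow n e) x∈
  ... | inj₂ x∈e = n , ≤-refl , x∈e
  ... | inj₁ x∈r with ∈-concatBelow⁻ n e x∈r
  ...   | v , v<n , x∈e = v , m<n⇒m<1+n v<n , x∈e

  -- Loops run up to `N` although only the first m values are vertices; the remaining rounds
  -- contribute nothing, so a characteristic vector comes out with the right length.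
  concatBelow-singletons : ∀ {m} (f : Fin m → A) n (e : ℕ → List A) → (∀ i → e (toℕ i) ≡ [ f i ]) →
    (∀ v → m ≤ v → e v ≡ []) → m ≤ n → concatBelow n e ≡ List.tabulate f
  concatBelow-singletons {m} f n e single none m≤n with m≤n⇒∃[o]m+o≡n m≤n
  ... | o , refl = padded o
    where
    front : ∀ {m} (f : Fin m → A) (e : ℕ → List A) → (∀ i → e (toℕ i) ≡ [ f i ]) → concatBelow m e ≡ List.tabulate f
    front {zero}  f e single = refl
    front {suc m} f e single = trans (shift m e) (cong₂ _++_ (single zero) (front (f ∘ suc) (e ∘ suc) (single ∘ suc)))
      where
      shift : ∀ m (e : ℕ → List A) → concatBelow (suc m) e ≡ e 0 ++ concatBelow m (e ∘ suc)
      shift zero    e = sym (List.++-identityʳ (e 0))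
      shift (suc m) e = trans (cong (_++ e (suc m)) (shift m e))
          (List.++-assoc (e 0) (concatBelow m (e ∘ suc)) (e (suc m)))
    padded : ∀ o → concatBelow (m + o) e ≡ List.tabulate f
    padded zero    = trans (cong (λ k → concatBelow k e) (+-identityʳ m)) (front f e single)
    padded (suc o) = trans (cong (λ k → concatBelow k e) (+-suc m o))
      (trans (cong₂ _++_ (padded o) (none (m + o) (m≤m+n m o))) (List.++-identityʳ _))

least : ∀ {n} {P : Fin n → Set} → (∀ i → Dec (P i)) → ∃ P → ∃[ i ] (P i × (∀ j → toℕ j < toℕ i → ¬ P j))
least {suc n} {P} P? (i , p) with P? zero
... | yes p₀ = zero , p₀ , λ _ ()
... | no ¬p₀ with least (P? ∘ suc) (shifted i p)
  where
  shifted : ∀ i → P i → ∃[ j ] P (suc j)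
  shifted zero    p = contradiction p ¬p₀
  shifted (suc j) p = j , p
...   | j , q , min = suc j , q , λ { zero _ → ¬p₀ ; (suc k) (s≤s k<j) → min k k<j }

module Emission (w : List Letter) where

  open Semantics w

  -- For programs that leave the tables alone. The output is then independent of what was emitted
  -- before, and composition of programs becomes concatenation.
  Emits : ∀ {d} → Prog d → Vec ℕ d → Tables → List Letter → Set
  Emits P env ρ e = ∀ o → exec P env (ρ , o) ≡ (ρ , e ʳ++ o)

  emits-▹ : ∀ {d} {P Q : Prog d} {env ρ e e′} → Emits P env ρ e → Emits Q env ρ e′ → Emits (P ▹ Q) env ρ (e ++ e′)
  emits-▹ {Q = Q} {env} {ρ} {e} {e′} p q o = trans (cong (exec Q env) (p o))
    (trans (q (e ʳ++ o)) (cong (ρ ,_) (sym (List.++-ʳ++ e))))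

  emits-when : ∀ {d} φ {P : Prog d} {env ρ e} → Emits P env ρ e →
               Emits (when φ P) env ρ (if evalF φ env ρ then e else [])
  emits-when φ {env = env} {ρ} p o with evalF φ env ρ
  ... | true  = p o
  ... | false = refl

  emits-for : ∀ {d} {P : Prog (suc d)} {env ρ} {e : ℕ → List Letter} → (∀ v → Emits P (v ∷ env) ρ (e v)) →
              Emits (for P) env ρ (concatBelow N e)
  emits-for {P = P} {env} {ρ} {e} p o = go N
    where
    go : ∀ n → loop n (λ v → exec P (v ∷ env)) (ρ , o) ≡ (ρ , concatBelow n e ʳ++ o)
    go zero    = refl
    go (suc n) = trans (cong (exec P (n ∷ env)) (go n))
        (trans (p n _) (cong (ρ ,_) (sym (List.++-ʳ++ (concatBelow n e)))))

module ListingStage (G : ColoredGraph) (w : List Letter) where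

  open ColoredGraph G
  open WeakConnectivity G
  open Semantics w
  open Meaning {16} w
  open VocabularyMeaning w
  open Emission w

  module _ {ρ₀ : Tables} (tables : ComponentTables G N ρ₀) where

    open ComponentTables tables
    open Components (λ u v → ρ₀ WCA (toℕ u) (toℕ v)) wca

    -- The set `common` with arbitrary numbers as generators, as loops range over numbers. At vertex
    -- numbers the two agree by definition.
    subsetOf : ℕ → ℕ → Subset order
    subsetOf a b = Vec.tabulate λ x → ρ₀ WCA a (toℕ x) ∧ ρ₀ WCA b (toℕ x)

    InBoth : ℕ → ℕ → ℕ → Set
    InBoth a b x = T (ρ₀ WCA a x) × T (ρ₀ WCA b x)

    Differ : ℕ → ℕ → ℕ → ℕ → ℕ → Set
    Differ a b a′ b′ x = (InBoth a b x × ¬ InBoth a′ b′ x) ⊎ (¬ InBoth a b x × InBoth a′ b′ x)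

    differ⇒≢ : ∀ {a b a′ b′ x} → Differ a b a′ b′ x → subsetOf a b ≢ subsetOf a′ b′
    differ⇒≢ {a} {b} {a′} {b′} {x} d eq with x <? order
    ... | no x≮ = Sum.[ (λ ((h , _) , _) → x≮ (proj₂ (wca-vertices h))) ,
        (λ (_ , (h , _)) → x≮ (proj₂ (wca-vertices h))) ] d
    ... | yes x< = Sum.[ (λ (p , ¬q) → ¬q (to both p)) , (λ (¬p , q) → ¬p (from both q)) ] d
      where
      y : Fin order
      y = fromℕ< x<
      entries : (ρ₀ WCA a (toℕ y) ∧ ρ₀ WCA b (toℕ y)) ≡ (ρ₀ WCA a′ (toℕ y) ∧ ρ₀ WCA b′ (toℕ y))
      entries = trans (sym (Vec.lookup∘tabulate _ y)) (trans (cong (λ S → lookup S y) eq) (Vec.lookup∘tabulate _ y))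
      both : InBoth a b x ⇔ InBoth a′ b′ x
      both = subst (λ x → InBoth a b x ⇔ InBoth a′ b′ x) (Fin.toℕ-fromℕ< x<)
        (⇔-trans (⇔-sym T-∧) (⇔-trans
          (subst (λ p → T (ρ₀ WCA a (toℕ y) ∧ ρ₀ WCA b (toℕ y)) ⇔ T p) entries ⇔-refl) T-∧))

    ≢⇒differ : ∀ {a b a′ b′} → subsetOf a b ≢ subsetOf a′ b′ → ∃[ x ] (x < order × Differ a b a′ b′ x)
    ≢⇒differ {a} {b} {a′} {b′} ≢ with Fin.any?
        (λ x → in? a b x ×-dec ¬? (in? a′ b′ x) ⊎-dec ¬? (in? a b x) ×-dec in? a′ b′ x)
      where
      in? : ∀ a b (x : Fin order) → Dec (InBoth a b (toℕ x))
      in? a b x = T? _ ×-dec T? _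
    ... | yes (x , d) = toℕ x , Fin.toℕ<n x , d
    ... | no none = contradiction (Vec.tabulate-cong λ x → T-injective (⇔-trans T-∧ (⇔-trans (mk⇔
            (λ h → decidable-stable (T? _ ×-dec T? _) λ ¬h → none (x , inj₁ (h , ¬h)))
            (λ h → decidable-stable (T? _ ×-dec T? _) λ ¬h → none (x , inj₂ (¬h , h)))) (⇔-sym T-∧)))) ≢

    ρ₁ : Tables
    ρ₁ = ρ₀ [ KEEP ↦ (λ a b → evalF keepForm (b ∷ a ∷ []) ρ₀) ]

    Earlier : ℕ → ℕ → ℕ → ℕ → Set
    Earlier a′ b′ a b = a′ < a ⊎ (a′ ≡ a × b′ < b)

    keep⇔ : ∀ {a b} → T (ρ₁ KEEP a b) ⇔ (T (ρ₀ GEN a b) ×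
      (∀ a′ → a′ < N → ∀ b′ → b′ < N → T (ρ₀ GEN a′ b′) × Earlier a′ b′ a b → ∃[ x ] (x < N × Differ a b a′ b′ x)))
    keep⇔ {a} {b} = ⇔-trans (evalF⇔Holds keepForm (b ∷ a ∷ []) ρ₀) (⇔-refl ×-⇔ mk⇔
      (λ h a′ a′< b′ b′< (g , e) → to (imp a′ b′) (h a′ a′< b′ b′<)
        (g , Sum.map₂ (Product.map₁ (from (same-⇔ (b′ ∷ a′ ∷ b ∷ a ∷ []) ρ₀ 1F 3F))) e))
      (λ h a′ a′< b′ b′< → from (imp a′ b′) λ (g , e) →
        h a′ a′< b′ b′< (g , Sum.map₂ (Product.map₁ (to (same-⇔ (b′ ∷ a′ ∷ b ∷ a ∷ []) ρ₀ 1F 3F))) e)))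
      where
      imp : ∀ a′ b′ → Holds (earlierForm ⇒ᶠ differForm) (b′ ∷ a′ ∷ b ∷ a ∷ []) ρ₀ ⇔
            (Holds earlierForm (b′ ∷ a′ ∷ b ∷ a ∷ []) ρ₀ → Holds differForm (b′ ∷ a′ ∷ b ∷ a ∷ []) ρ₀)
      imp a′ b′ = ⇒ᶠ-⇔ (b′ ∷ a′ ∷ b ∷ a ∷ []) ρ₀ earlierForm differForm

    sets : ℕ → ℕ → List (Subset order)
    sets a b = if ρ₁ KEEP a b then [ subsetOf a b ] else []

    keptSets emptySets allSets : List (Subset order)
    keptSets  = concatBelow N (λ a → concatBelow N (sets a))
    emptySets = if evalF noVertex [] ρ₁ then [ subsetOf 0 0 ] else []
    allSets   = emptySets ++ keptSets

    bitsOf : ℕ → ℕ → ℕ → List Letter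
    bitsOf a b x = if ρ₁ VTX x x then
      (if ρ₁ WCA a x ∧ ρ₁ WCA b x then [ bit true ] else []) ++
      (if not (ρ₁ WCA a x ∧ ρ₁ WCA b x) then [ bit false ] else []) else []

    bits-subset : ∀ a b → concatBelow N (bitsOf a b) ≡ map bit (Vec.toList (subsetOf a b))
    bits-subset a b = trans (concatBelow-singletons (λ x → bit (ρ₀ WCA a (toℕ x) ∧ ρ₀ WCA b (toℕ x))) N
        (bitsOf a b) single none (<⇒≤ order<))
      (trans (sym (List.map-tabulate (λ x → ρ₀ WCA a (toℕ x) ∧ ρ₀ WCA b (toℕ x)) bit))
        (cong (map bit) (sym (toList-tabulate _))))
      where
      toList-tabulate : ∀ {A : Set} {n} (f : Fin n → A) → Vec.toList (Vec.tabulate f) ≡ List.tabulate f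
      toList-tabulate {n = zero}  f = refl
      toList-tabulate {n = suc n} f = cong (f zero ∷_) (toList-tabulate (f ∘ suc))
      choose : ∀ p → (if p then [ bit true ] else []) ++ (if not p then [ bit false ] else []) ≡ [ bit p ]
      choose true  = refl
      choose false = refl
      single : ∀ i → bitsOf a b (toℕ i) ≡ [ bit (ρ₀ WCA a (toℕ i) ∧ ρ₀ WCA b (toℕ i)) ]
      single i with ρ₀ VTX (toℕ i) (toℕ i) | vtx {toℕ i} {toℕ i}
      ... | true  | _ = choose _
      ... | false | e = contradiction (from e (Fin.toℕ<n i)) id
      none : ∀ v → order ≤ v → bitsOf a b v ≡ []
      none v n≤v with ρ₀ VTX v v | vtx {v} {v}
      ... | false | _ = refl
      ... | true  | e = contradiction (to e tt) (≤⇒≯ n≤v)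

    emits-bits : ∀ a b → Emits (for emitBit) (b ∷ a ∷ []) ρ₁ (concatBelow N (bitsOf a b))
    emits-bits a b = emits-for {P = emitBit} {b ∷ a ∷ []} {ρ₁} λ x →
      emits-when (rel VTX 0F 0F) {emitOne ▹ emitZero} {x ∷ b ∷ a ∷ []} {ρ₁}
        (emits-▹ {P = emitOne} {emitZero} {x ∷ b ∷ a ∷ []} {ρ₁}
          {if ρ₁ WCA a x ∧ ρ₁ WCA b x then [ bit true ] else []}
          {if not (ρ₁ WCA a x ∧ ρ₁ WCA b x) then [ bit false ] else []}
          (emits-when (inBoth 2F 1F 0F) {emit (bit true)} {x ∷ b ∷ a ∷ []} {ρ₁} {[ bit true ]} λ _ → refl)
          (emits-when (neg (inBoth 2F 1F 0F)) {emit (bit false)} {x ∷ b ∷ a ∷ []} {ρ₁} {[ bit false ]} λ _ → refl))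

    emits-sets : Emits emitSets [] ρ₁ (encodeSubsets keptSets)
    emits-sets o = trans (emits-for {P = for (when (rel KEEP 1F 0F) (for emitBit ▹ emit #))} {[]} {ρ₁}
        (λ a → emits-for {P = when (rel KEEP 1F 0F) (for emitBit ▹ emit #)} {a ∷ []} {ρ₁} (λ b →
        emits-when (rel KEEP 1F 0F) {for emitBit ▹ emit #} {b ∷ a ∷ []} {ρ₁}
          (emits-▹ {P = for emitBit} {emit #} {b ∷ a ∷ []} {ρ₁} {concatBelow N (bitsOf a b)} {[ # ]}
            (emits-bits a b) λ _ → refl))) o)
      (cong (λ e → ρ₁ , e ʳ++ o) (sym (trans (concatMap-concatBelow _ N _)
        (concatBelow-cong N λ a _ → trans (concatMap-concatBelow _ N _) (concatBelow-cong N λ b _ → one a b)))))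
      where
      one : ∀ a b → encodeSubsets (sets a b) ≡ (if ρ₁ KEEP a b then concatBelow N (bitsOf a b) ++ [ # ] else [])
      one a b with ρ₁ KEEP a b
      ... | false = refl
      ... | true  = trans (List.++-identityʳ _) (cong (_++ [ # ]) (sym (bits-subset a b)))

    noVertex-⇔ : T (evalF noVertex [] ρ₁) ⇔ order ≡ 0
    noVertex-⇔ = ⇔-trans (evalF⇔Holds noVertex [] ρ₁) (mk⇔
      (λ h → n≤0⇒n≡0 (≮⇒≥ λ 0<n → h (0 , within z≤n , from vtx 0<n)))
      (λ { n≡0 (a , _ , h) → <⇒≱ (to vtx h) (≤-trans (≤-reflexive n≡0) z≤n) }))

    emits-all : ∀ o → exec listing [] (ρ₀ , o) ≡ (ρ₁ , encodeSubsets allSets ʳ++ o)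
    emits-all o = trans (emits-▹ {P = when noVertex (emit #)} {emitSets} {[]} {ρ₁}
          {if evalF noVertex [] ρ₁ then [ # ] else []} {encodeSubsets keptSets}
        (emits-when noVertex {emit #} {[]} {ρ₁} {[ # ]} λ _ → refl) emits-sets o)
      (cong (λ e → ρ₁ , e ʳ++ o)
        (trans (cong (_++ encodeSubsets keptSets) empty) (sym (List.concatMap-++ _ emptySets _))))
      where
      empty : (if evalF noVertex [] ρ₁ then [ # ] else []) ≡ encodeSubsets emptySets
      empty with evalF noVertex [] ρ₁ | noVertex-⇔
      ... | false | _ = refl
      ... | true  | e = trans (cong (λ S → map bit S ++ [ # ]) (sym (no-elements (to e tt) (subsetOf 0 0))))
          (sym (List.++-identityʳ _))
        where
        no-elements : ∀ {A : Set} {n} → n ≡ 0 → (v : Vec A n) → Vec.toList v ≡ []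
        no-elements refl [] = refl

    ∈-sets⁺ : ∀ {a b} → T (ρ₁ KEEP a b) → subsetOf a b ∈ sets a b
    ∈-sets⁺ {a} {b} k with ρ₁ KEEP a b
    ... | true = here refl

    ∈-sets⁻ : ∀ {a b S} → S ∈ sets a b → T (ρ₁ KEEP a b) × S ≡ subsetOf a b
    ∈-sets⁻ {a} {b} S∈ with ρ₁ KEEP a b | S∈
    ... | true | here eq = tt , eq

    vertex<N : ∀ (u : Vertex) → toℕ u < N
    vertex<N u = <-trans (Fin.toℕ<n u) order<

    sets-component : ∀ {a b} → T (ρ₁ KEEP a b) → IsComponent (subsetOf a b)
    sets-component {a} {b} k with to keep⇔ k
    ... | g , _ with gen-vertices g
    ...   | a< , b< = subst₂ (λ a b → IsComponent (subsetOf a b)) (Fin.toℕ-fromℕ< a<) (Fin.toℕ-fromℕ< b<)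
      (common-component (to gen (subst₂ (λ a b → T (ρ₀ GEN a b)) (sym (Fin.toℕ-fromℕ< a<))
        (sym (Fin.toℕ-fromℕ< b<)) g)))

    -- Choose the least row, and in it the least column, of a generating pair with the same set. An
    -- earlier pair with this set would contradict one of the two choices, so the chosen pair is
    -- kept.
    first-generators : ∀ {u v} → Generates u v → ∃₂ λ u′ v′ →
        T (ρ₁ KEEP (toℕ u′) (toℕ v′)) × subsetOf (toℕ u′) (toℕ v′) ≡ common u v
    first-generators {u} {v} g with least Row? (u , v , from gen g , refl)
      where
      P : Vertex → Vertex → Set
      P u′ v′ = T (ρ₀ GEN (toℕ u′) (toℕ v′)) × common u′ v′ ≡ common u v
      P? : ∀ u′ v′ → Dec (P u′ v′)
      P? u′ v′ = T? _ ×-dec Vec.≡-dec Bool._≟_ _ _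
      Row? : ∀ u′ → Dec (∃ (P u′))
      Row? u′ = Fin.any? (P? u′)
    ... | u′ , row , before with least (λ v′ → T? (ρ₀ GEN (toℕ u′) (toℕ v′)) ×-dec Vec.≡-dec Bool._≟_ (common u′ v′) (common u v)) row
    ...   | v′ , (g′ , eq) , before′ = u′ , v′ , from keep⇔ (g′ , λ a _ b _ (h , e) →
              case ≢⇒differ (earlier a b h e) of λ (x , x< , d) → x , <-trans x< order< , d) , eq
      where
      earlier : ∀ a b → T (ρ₀ GEN a b) → Earlier a b (toℕ u′) (toℕ v′) → subsetOf (toℕ u′) (toℕ v′) ≢ subsetOf a b
      earlier a b h e eq′ with gen-vertices h
      ... | a< , b< = at-vertices (fromℕ< a<) (fromℕ< b<) (Fin.toℕ-fromℕ< a<) (Fin.toℕ-fromℕ< b<) h e eq′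
        where
        at-vertices : ∀ x y {a b} → toℕ x ≡ a → toℕ y ≡ b → T (ρ₀ GEN a b) → Earlier a b (toℕ u′) (toℕ v′) →
                      subsetOf (toℕ u′) (toℕ v′) ≡ subsetOf a b → ⊥
        at-vertices x y refl refl h (inj₁ x<) eq′ = before x x< (y , h , trans (sym eq′) eq)
        at-vertices x y refl refl h (inj₂ (x≡ , y<)) eq′ with Fin.toℕ-injective x≡
        ... | refl = before′ y y< (h , trans (sym eq′) eq)

    -- The loops visit pairs in lexicographic order, and the set of a kept pair differs from that of
    -- every earlier generating pair. Without vertices no pair is kept, so only the separately
    -- listed empty set remains.
    sets-unique : Unique allSets
    sets-unique with order ≟ 0
    ... | yes n≡0 = AllPairs.++⁺ emptySets-unique
          (subst (AllPairs _≢_) (sym nothing-kept) []) (All.tabulate λ _ → subst (All _) (sym nothing-kept) [])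
      where
      emptySets-unique : AllPairs _≢_ emptySets
      emptySets-unique with evalF noVertex [] ρ₁
      ... | true  = [] ∷ []
      ... | false = []
      nothing-kept : keptSets ≡ []
      nothing-kept = none keptSets λ S S∈ →
        case ∈-concatBelow⁻ N _ S∈ of λ (a , _ , S∈′) → case ∈-concatBelow⁻ N (sets a) S∈′ of λ (b , _ , S∈″) →
        <⇒≱ (proj₁ (gen-vertices (proj₁ (to keep⇔ (proj₁ (∈-sets⁻ {a} {b} S∈″)))))) (≤-trans (≤-reflexive n≡0) z≤n)
        where
        none : ∀ {A : Set} (xs : List A) → (∀ x → x ∈ xs → ⊥) → xs ≡ []
        none []       h = refl
        none (x ∷ xs) h = contradiction (here refl) (h x)
    ... | no n≢0 = subst (λ E → Unique (E ++ keptSets)) (sym no-empty)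
        (AllPairs-concatBelow N _
          (λ a _ → AllPairs-concatBelow N (sets a) (λ b _ → single a b)
            (λ b b′ b<b′ b′< → apart a b a b′ (inj₂ (refl , b<b′))))
          (λ a a′ a<a′ a′< → All-concatBelow N (sets a) λ b b< → All.tabulate λ {S} S∈ →
             All-concatBelow N (sets a′) λ b′ _ → All.lookup (apart a b a′ b′ (inj₁ a<a′)) S∈))
      where
      no-empty : emptySets ≡ []
      no-empty with evalF noVertex [] ρ₁ | noVertex-⇔
      ... | true  | e = contradiction (to e tt) n≢0
      ... | false | _ = refl
      single : ∀ a b → AllPairs _≢_ (sets a b)
      single a b with ρ₁ KEEP a b
      ... | true  = [] ∷ []
      ... | false = []
      apart : ∀ a b a′ b′ → Earlier a b a′ b′ → All (λ S → All (S ≢_) (sets a′ b′)) (sets a b)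
      apart a b a′ b′ e = All.tabulate λ S∈ → All.tabulate λ S′∈ → λ { refl →
        case ∈-sets⁻ {a} {b} S∈ of λ (k , eq) → case ∈-sets⁻ {a′} {b′} S′∈ of λ (k′ , eq′) →
        case gen-vertices (proj₁ (to keep⇔ k)) of λ (a< , b<) →
        case proj₂ (to keep⇔ k′) a (<-trans a< order<) b (<-trans b< order<) (proj₁ (to keep⇔ k) , e) of
            λ (x , _ , d) →
        differ⇒≢ d (trans (sym eq′) eq) }

    ∈-allSets : ∀ S → S ∈ allSets ⇔ IsComponent S
    ∈-allSets S = mk⇔ sound complete
      where
      sound : S ∈ allSets → IsComponent S
      sound S∈ with ∈-++⁻ emptySets S∈
      ... | inj₂ S∈′ = case ∈-concatBelow⁻ N _ S∈′ of λ (a , _ , S∈″) →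
          case ∈-concatBelow⁻ N (sets a) S∈″ of λ (b , _ , S∈‴) →
              case ∈-sets⁻ {a} {b} S∈‴ of λ (k , eq) → subst IsComponent (sym eq) (sets-component {a} {b} k)
      ... | inj₁ S∈′ with evalF noVertex [] ρ₁ | noVertex-⇔ | S∈′
      ...   | true | e | here refl = empty-component (to e tt) _
        where
        empty-component : order ≡ 0 → ∀ S → IsComponent S
        empty-component n≡0 S = (λ u → contradiction u (no-vertex n≡0)) , λ S′ _ _ → unique-vector n≡0 S′ S
          where
          no-vertex : ∀ {n} → n ≡ 0 → ¬ Fin n
          no-vertex refl ()
          unique-vector : ∀ {n} → n ≡ 0 → (S S′ : Vec Bool n) → S ≡ S′
          unique-vector refl [] [] = refl
      complete : IsComponent S → S ∈ allSets
      complete S-component with order ≟ 0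
      ... | no n≢0 = case component-common (fromℕ< (n≢0⇒n>0 n≢0)) S-component of λ (u , v , g , eq₀) →
          case first-generators g of λ (u′ , v′ , k , eq) →
          ∈-++⁺ʳ emptySets (subst (_∈ keptSets) (trans eq (sym eq₀))
            (∈-concatBelow⁺ _ (vertex<N u′)
              (∈-concatBelow⁺ (sets (toℕ u′)) (vertex<N v′) (∈-sets⁺ {toℕ u′} {toℕ v′} k))))
      ... | yes n≡0 with evalF noVertex [] ρ₁ | noVertex-⇔
      ...   | false | e = contradiction (from e n≡0) id
      ...   | true  | _ = here (unique-vector n≡0 S (subsetOf 0 0))
        where
        unique-vector : ∀ {n} → n ≡ 0 → (S S′ : Vec Bool n) → S ≡ S′
        unique-vector refl [] [] = refl

    lists-components : ListsComponents G (encodeSubsets allSets)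
    lists-components = allSets , refl , sets-unique , ∈-allSets

result-emits : ∀ (P Q R : Prog 0) w {s₁ s₂} ρ e → let open Semantics w in
  s₁ ≡ exec P [] initialStore → s₂ ≡ exec Q [] s₁ → proj₂ s₂ ≡ [] →
  (∀ o → exec R [] (proj₁ s₂ , o) ≡ (ρ , e ʳ++ o)) → result (P ▹ Q ▹ R) w ≡ e
result-emits P Q R w {s₂ = s₂} ρ e refl refl silent emits =
  trans (result-def (P ▹ Q ▹ R) w) (trans (cong (λ s → proj₂ s ʳ++ []) (emits (proj₂ s₂)))
    (trans (cong (λ o → (e ʳ++ o) ʳ++ []) silent) (trans (List.ʳ++-ʳ++ e {[]} {[]}) (List.++-identityʳ e))))

-- The stores reached are opaque, as they are too large to be compared by
-- evaluation.
module Reading (G : ColoredGraph) (pre : List (List Bool)) where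

  open GraphRows G
  open RowStage (pre ++ graphRows)
  open Semantics w
  open Parsing w
  open GraphStage G pre using (graphTables-correct)

  reading : Prog 0
  reading = parse ▹ GraphForms.graphTables (length pre)

  opaque

    read : Store
    read = exec reading [] initialStore

    read-def : read ≡ exec reading [] initialStore
    read-def = refl

    read-raw : RawTables (length pre) (proj₁ read)
    read-raw = rawTables (length pre) {exec parse [] initialStore} (rowTable parse-correct) (cellTables parse-correct)

    read-col : ∀ {a b} → a < N → T (proj₁ read COL a b) ⇔ a ≡ 0
    read-col {a} {b} a<N = subst (λ t → T (proj₁ read COL a b) ⇔ a ≡ t) (cong proj₂ (end≡ parse-correct))
      (Parsed.col parse-correct a<N)

    read-silent : proj₂ read ≡ []
    read-silent = Parsed.silent parse-correct

  read-graph : GraphTables G N (proj₁ read)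
  read-graph = graphTables-correct {proj₁ read} read-raw

  open GeneratorStage G w

  opaque

    generated : Store
    generated = exec generators [] read

    generated-def : generated ≡ exec generators [] read
    generated-def = refl

    generated-tables : ComponentTables G N (proj₁ generated)
    generated-tables = componentTables {proj₁ read} {proj₂ read} read-graph

    generated-silent : proj₂ generated ≡ []
    generated-silent = trans (generators-silent {proj₁ read} {proj₂ read} read-graph) read-silent

    generated-others : ∀ {B} → B ≢ RCH → B ≢ WCA → B ≢ GEN → proj₁ generated B ≡ proj₁ read B
    generated-others = generators-others {proj₁ read} {proj₂ read} read-graph

module ListingCorrectness (G : ColoredGraph) where

  open Reading G []

  private
    w : List Letter
    w = encodeRows (GraphRows.graphRows G)

  open Semantics w
  open ListingStage G w hiding (sets)

  sets : List (Subset (ColoredGraph.order G))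
  sets = allSets {proj₁ generated} generated-tables

  result≡ : result listComponents w ≡ encodeSubsets sets
  result≡ = result-emits reading generators listing w (ρ₁ {proj₁ generated} generated-tables) (encodeSubsets sets)
    read-def generated-def generated-silent (emits-all {proj₁ generated} generated-tables)

  listComponents-correct : ListsComponents G (result listComponents (encodeColoredGraph G))
  listComponents-correct = subst (λ u → ListsComponents G (result listComponents u))
    (sym (GraphRows.encodeColoredGraph-rows G))
    (subst (ListsComponents G) (sym result≡) (lists-components {proj₁ generated} generated-tables))

listing-computable : ComputableInPolynomialTime encodeColoredGraph ListsComponents
listing-computable = Compiler.computable 16 listComponents encodeColoredGraph ListsComponents
  ListingCorrectness.listComponents-correct

-- Counting vertices and the decision problem

digitsᵇ : ℕᵇ → List Bool
digitsᵇ Bin.zero = []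
digitsᵇ 1+[2 b ] = false ∷ digitsᵇ b
digitsᵇ 2[1+ b ] = true ∷ digitsᵇ b

fromDigits : List Bool → ℕᵇ
fromDigits []          = Bin.zero
fromDigits (false ∷ s) = 1+[2 fromDigits s ]
fromDigits (true ∷ s)  = 2[1+ fromDigits s ]

digitsᵇ-fromDigits : ∀ s → digitsᵇ (fromDigits s) ≡ s
digitsᵇ-fromDigits []          = refl
digitsᵇ-fromDigits (false ∷ s) = cong (false ∷_) (digitsᵇ-fromDigits s)
digitsᵇ-fromDigits (true ∷ s)  = cong (true ∷_) (digitsᵇ-fromDigits s)

fromDigits-digitsᵇ : ∀ b → fromDigits (digitsᵇ b) ≡ b
fromDigits-digitsᵇ Bin.zero = refl
fromDigits-digitsᵇ 1+[2 b ] = cong 1+[2_] (fromDigits-digitsᵇ b)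
fromDigits-digitsᵇ 2[1+ b ] = cong 2[1+_] (fromDigits-digitsᵇ b)

map-bit-digitsᵇ : ∀ b → map bit (digitsᵇ b) ≡ bijectiveBinary b
map-bit-digitsᵇ Bin.zero = refl
map-bit-digitsᵇ 1+[2 b ] = cong (bit false ∷_) (map-bit-digitsᵇ b)
map-bit-digitsᵇ 2[1+ b ] = cong (bit true ∷_) (map-bit-digitsᵇ b)

digits : ℕ → List Bool
digits k = digitsᵇ (Bin.fromℕ k)

digits-injective : ∀ {k l} → digits k ≡ digits l → k ≡ l
digits-injective {k} {l} eq = Bin.fromℕ-injective
  (trans (sym (fromDigits-digitsᵇ (Bin.fromℕ k))) (trans (cong fromDigits eq) (fromDigits-digitsᵇ (Bin.fromℕ l))))

-- The carry runs through the digits 2, written `true`, and turns them into digits 1. It stops by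
-- raising a 1 to a 2, or by appending a new 1 at the top.
increment : List Bool → List Bool
increment []          = false ∷ []
increment (true ∷ s)  = false ∷ increment s
increment (false ∷ s) = true ∷ s

digits-suc : ∀ k → digits (suc k) ≡ increment (digits k)
digits-suc k = trans (cong digitsᵇ (trans (Bin.fromℕ≡fromℕ' (suc k)) (cong Bin.suc (sym (Bin.fromℕ≡fromℕ' k)))))
  (digitsᵇ-suc (Bin.fromℕ k))
  where
  digitsᵇ-suc : ∀ b → digitsᵇ (Bin.suc b) ≡ increment (digitsᵇ b)
  digitsᵇ-suc Bin.zero = refl
  digitsᵇ-suc 1+[2 b ] = refl
  digitsᵇ-suc 2[1+ b ] = cong (false ∷_) (digitsᵇ-suc b)

Carry : List Bool → ℕ → Set
Carry s j = ∀ i → i < j → s at i ≡ just true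

Carry-true : ∀ {s j} → Carry (true ∷ s) (suc j) ⇔ Carry s j
Carry-true = mk⇔ (λ h i i<j → h (suc i) (s≤s i<j)) (λ { h zero _ → refl ; h (suc i) (s≤s i<j) → h i i<j })

¬Carry-false : ∀ {s j} → ¬ Carry (false ∷ s) (suc j)
¬Carry-false h = contradiction (h 0 z<s) λ ()

at-[] : ∀ {A : Set} j → _at_ {A} [] j ≡ nothing
at-[] zero    = refl
at-[] (suc j) = refl

-- `Carry` says that all lower digits are 2, that is, the carry arrives at position j. A 2 then
-- results exactly from a 1; elsewhere digits are unchanged. In this form a new digit depends on old
-- digits only and can be defined by a formula.
increment-true : ∀ s j → increment s at j ≡ just true ⇔
  ((Carry s j × s at j ≡ just false) ⊎ (¬ Carry s j × s at j ≡ just true))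
increment-true [] zero = mk⇔ (λ ()) λ { (inj₁ (_ , ())) ; (inj₂ (_ , ())) }
increment-true [] (suc j) rewrite at-[] {Bool} j = mk⇔ (λ ()) λ { (inj₁ (_ , ())) ; (inj₂ (_ , ())) }
increment-true (true ∷ s) zero = mk⇔ (λ ()) λ { (inj₁ (_ , ())) ; (inj₂ (¬c , _)) → contradiction (λ _ ()) ¬c }
increment-true (true ∷ s) (suc j) = ⇔-trans (increment-true s j)
  ((⇔-sym Carry-true ×-⇔ ⇔-refl) ⊎-⇔ (¬-cong (⇔-sym Carry-true) ×-⇔ ⇔-refl))
increment-true (false ∷ s) zero = mk⇔ (λ _ → inj₁ ((λ _ ()) , refl)) (λ _ → refl)
increment-true (false ∷ s) (suc j) = mk⇔ (λ e → inj₂ (¬Carry-false , e))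
  λ { (inj₁ (c , _)) → contradiction c ¬Carry-false ; (inj₂ (_ , e)) → e }

-- Under a carry the inequality covers two cases: a 2 that becomes 1, and the absent digit just
-- above the top that is created as 1.
increment-false : ∀ s j → increment s at j ≡ just false ⇔
  ((Carry s j × s at j ≢ just false) ⊎ (¬ Carry s j × s at j ≡ just false))
increment-false [] zero = mk⇔ (λ _ → inj₁ ((λ _ ()) , λ ())) (λ _ → refl)
increment-false [] (suc j) rewrite at-[] {Bool} j = mk⇔ (λ ())
  λ { (inj₁ (c , _)) → contradiction (c 0 z<s) λ () ; (inj₂ (_ , ())) }
increment-false (true ∷ s) zero = mk⇔ (λ _ → inj₁ ((λ _ ()) , λ ())) (λ _ → refl)
increment-false (true ∷ s) (suc j) = ⇔-trans (increment-false s j)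
  ((⇔-sym Carry-true ×-⇔ ⇔-refl) ⊎-⇔ (¬-cong (⇔-sym Carry-true) ×-⇔ ⇔-refl))
increment-false (false ∷ s) zero = mk⇔ (λ ())
  λ { (inj₁ (_ , n)) → contradiction refl n ; (inj₂ (¬c , _)) → contradiction (λ _ ()) ¬c }
increment-false (false ∷ s) (suc j) = mk⇔ (λ e → inj₂ (¬Carry-false , e))
  λ { (inj₁ (c , _)) → contradiction c ¬Carry-false ; (inj₂ (_ , e)) → e }

-- Only `s′` has to be short: its length is one of the inspected positions, and there the end of
-- `s′` forces `s` to end too. The counter thus needs no length bound.
same-digits : ∀ n s s′ → length s′ < n →
  (∀ j → j < n → (s at j ≡ just true ⇔ s′ at j ≡ just true) × (s at j ≡ just false ⇔ s′ at j ≡ just false)) → s ≡ s′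
same-digits (suc n) []          []           _  h = refl
same-digits (suc n) []          (true ∷ s′)  _  h = contradiction (from (proj₁ (h 0 z<s)) refl) λ ()
same-digits (suc n) []          (false ∷ s′) _  h = contradiction (from (proj₂ (h 0 z<s)) refl) λ ()
same-digits (suc n) (true ∷ s)  []           _  h = contradiction (to (proj₁ (h 0 z<s)) refl) λ ()
same-digits (suc n) (false ∷ s) []           _  h = contradiction (to (proj₂ (h 0 z<s)) refl) λ ()
same-digits (suc n) (true ∷ s)  (false ∷ s′) _  h = contradiction (to (proj₁ (h 0 z<s)) refl) λ ()
same-digits (suc n) (false ∷ s) (true ∷ s′)  _  h = contradiction (to (proj₂ (h 0 z<s)) refl) λ ()
same-digits (suc n) (true ∷ s)  (true ∷ s′)  (s≤s lt) h =
    cong (true ∷_) (same-digits n s s′ lt λ j j<n → h (suc j) (s≤s j<n))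
same-digits (suc n) (false ∷ s) (false ∷ s′) (s≤s lt) h =
    cong (false ∷_) (same-digits n s s′ lt λ j j<n → h (suc j) (s≤s j<n))

countBelow : ℕ → (ℕ → Bool) → ℕ
countBelow zero    f = 0
countBelow (suc n) f = if f n then suc (countBelow n f) else countBelow n f

countBelow-tabulate : ∀ {m} n (f : ℕ → Bool) → m ≤ n → (∀ v → m ≤ v → f v ≡ false) →
                      countBelow n f ≡ ∣ Vec.tabulate {n = m} (f ∘ toℕ) ∣
countBelow-tabulate {m} n f m≤n none with m≤n⇒∃[o]m+o≡n m≤n
... | o , refl = padded o
  where
  shift : ∀ m (f : ℕ → Bool) →
      countBelow (suc m) f ≡ (if f 0 then suc (countBelow m (f ∘ suc)) else countBelow m (f ∘ suc))
  shift zero    f = refl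
  shift (suc m) f with f (suc m) | shift m f
  ... | false | eq = eq
  ... | true  | eq with f 0
  ...   | true  = cong suc eq
  ...   | false = cong suc eq
  front : ∀ m (f : ℕ → Bool) → countBelow m f ≡ ∣ Vec.tabulate {n = m} (f ∘ toℕ) ∣
  front zero    f = refl
  front (suc m) f with f 0 | shift m f
  ... | true  | eq = trans eq (cong suc (front m (f ∘ suc)))
  ... | false | eq = trans eq (front m (f ∘ suc))
  padded : ∀ o → countBelow (m + o) f ≡ ∣ Vec.tabulate {n = m} (f ∘ toℕ) ∣
  padded zero    = trans (cong (λ k → countBelow k f) (+-identityʳ m)) (front m f)
  padded (suc o) = trans (cong (λ k → countBelow k f) (+-suc m o))
    (trans (cong (λ b → if b then suc (countBelow (m + o) f) else countBelow (m + o) f)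
      (none (m + o) (m≤m+n m o))) (padded o))

-- Tables ONE′ and ZER′ hold the digits of a counter in bijective base 2.
carryForm tmpForm zeroForm oneForm : Form 5
carryForm  = all (less (0F ∷ []) 2F ⇒ᶠ rel ONE′ 0F 0F)
tmpForm    = carryForm ∧ᶠ rel ZER′ 1F 1F ∨ᶠ neg carryForm ∧ᶠ rel ONE′ 1F 1F
zeroForm   = carryForm ∧ᶠ neg (rel ZER′ 1F 1F) ∨ᶠ neg carryForm ∧ᶠ rel ZER′ 1F 1F
oneForm    = rel TMP 1F 1F

neverForm : Form 4
neverForm = less (0F ∷ []) 0F

iffForm : ∀ {d} → Form d → Form d → Form d
iffForm φ ψ = (φ ⇒ᶠ ψ) ∧ᶠ (ψ ⇒ᶠ φ)

sameDigit : Form 5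
sameDigit = iffForm (rel ONE′ 0F 0F) (rel ONE 1F 0F) ∧ᶠ iffForm (rel ZER′ 0F 0F) (rel ZERO 1F 0F)

-- The number l may exceed the range of variables, so it is never the value of one. Its digits,
-- which form row 0 of the input, are compared with those of the counter.
reachedForm : Form 3
reachedForm = all (isConst 0 0F ⇒ᶠ all sameDigit)

-- Both digit tables are updated from the old digits. The new `ONE′` therefore waits in `TMP` until
-- `ZER′` has been replaced.
countUp countRound : Prog 3
countUp    = define TMP tmpForm ▹ define ZER′ zeroForm ▹ define ONE′ oneForm
countRound = when (inBoth 2F 1F 0F) (countUp ▹ when reachedForm (emit (bit true)))

countCommon : Prog 2
countCommon = define ONE′ neverForm ▹ define ZER′ neverForm ▹ for countRound

-- A letter is emitted iff some component is large enough: the counter passes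
-- through all numbers up to the size of the component.
counting : Prog 0
counting = for (for (when (rel GEN 1F 0F) countCommon))

module CountingStage (w : List Letter) (ρ₀ : Tables) (l : ℕ) (l>0 : 0 < l)
  (l-small : length (digits l) < Semantics.N w)
  (l-one  : ∀ {j} → j < Semantics.N w → T (ρ₀ ONE 0 j) ⇔ digits l at j ≡ just true)
  (l-zero : ∀ {j} → j < Semantics.N w → T (ρ₀ ZERO 0 j) ⇔ digits l at j ≡ just false) where

  open Semantics w
  open Meaning {16} w
  open VocabularyMeaning w

  Framed : Tables → Set
  Framed ρ = ∀ {B} → B ≢ ONE′ → B ≢ ZER′ → B ≢ TMP → ρ B ≡ ρ₀ B

  record Counter (k : ℕ) (ρ : Tables) : Set where
    field
      framed : Framed ρ
      oneDigits   : ∀ {j b} → j < N → T (ρ ONE′ j b) ⇔ digits k at j ≡ just true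
      zeroDigits  : ∀ {j b} → j < N → T (ρ ZER′ j b) ⇔ digits k at j ≡ just false

  iff-⇔ : ∀ {d} (env : Vec ℕ d) ρ φ ψ → Holds (iffForm φ ψ) env ρ ⇔ (Holds φ env ρ ⇔ Holds ψ env ρ)
  iff-⇔ env ρ φ ψ = ⇔-trans (⇒ᶠ-⇔ env ρ φ ψ ×-⇔ ⇒ᶠ-⇔ env ρ ψ φ)
    (mk⇔ (λ (f , g) → mk⇔ f g) (λ e → to e , from e))

  ⇔-cong : ∀ {A A′ B B′ : Set} → A ⇔ A′ → B ⇔ B′ → (A ⇔ B) ⇔ (A′ ⇔ B′)
  ⇔-cong e f = mk⇔ (λ h → ⇔-trans (⇔-sym e) (⇔-trans h f)) (λ h → ⇔-trans e (⇔-trans h (⇔-sym f)))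

  countUp-correct : ∀ {k s} env → Counter k (proj₁ s) → Counter (suc k) (proj₁ (exec countUp env s))
  countUp-correct {k} {s} env C = record
    { framed = λ B≢O B≢Z B≢T → trans (define-other (proj₁ s₂) ONE′ _ B≢O)
        (trans (define-other (proj₁ s₁) ZER′ _ B≢Z) (trans (define-other (proj₁ s) TMP _ B≢T) (framed B≢O B≢Z B≢T)))
    ; oneDigits = λ {j} {b} j<N → ⇔-trans (evalF⇔Holds oneForm (b ∷ j ∷ env) (proj₁ s₂))
        (⇔-trans (evalF⇔Holds tmpForm (j ∷ j ∷ env) (proj₁ s))
          (⇔-trans ((carry⇔ (proj₁ s) oneDigits j j j<N ×-⇔ zeroDigits {b = j} j<N) ⊎-⇔
            (¬-cong (carry⇔ (proj₁ s) oneDigits j j j<N) ×-⇔ oneDigits {b = j} j<N))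
            (⇔-trans (⇔-sym (increment-true (digits k) j)) (next j true))))
    ; zeroDigits = λ {j} {b} j<N → ⇔-trans (evalF⇔Holds zeroForm (b ∷ j ∷ env) (proj₁ s₁))
          (⇔-trans ((carry⇔ (proj₁ s₁) oneDigits b j j<N ×-⇔ ¬-cong (zeroDigits {b = j} j<N)) ⊎-⇔
            (¬-cong (carry⇔ (proj₁ s₁) oneDigits b j j<N) ×-⇔ zeroDigits {b = j} j<N))
            (⇔-trans (⇔-sym (increment-false (digits k) j)) (next j false)))
    }
    where
    open Counter C
    s₁ s₂ : Store
    s₁ = exec (define TMP tmpForm) env s
    s₂ = exec (define ZER′ zeroForm) env s₁
    next : ∀ j c → (increment (digits k) at j ≡ just c) ⇔ (digits (suc k) at j ≡ just c)
    next j c = subst (λ ds → (increment (digits k) at j ≡ just c) ⇔ (ds at j ≡ just c)) (sym (digits-suc k)) ⇔-refl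
    carry⇔ : ∀ ρ → (∀ {j b} → j < N → T (ρ ONE′ j b) ⇔ digits k at j ≡ just true) → ∀ b j → j < N →
             Holds carryForm (b ∷ j ∷ env) ρ ⇔ Carry (digits k) j
    carry⇔ ρ oneDigits′ b j j<N = mk⇔
      (λ h i i<j → to (oneDigits′ {b = i} (<-trans i<j j<N))
        (to (⇒ᶠ-⇔ (i ∷ b ∷ j ∷ env) ρ (less (0F ∷ []) 2F) (rel ONE′ 0F 0F)) (h i (<-trans i<j j<N)) i<j))
      (λ c i i<N → from (⇒ᶠ-⇔ (i ∷ b ∷ j ∷ env) ρ (less (0F ∷ []) 2F) (rel ONE′ 0F 0F)) λ i<j →
        from (oneDigits′ {b = i} i<N) (c i i<j))

  reached-⇔ : ∀ {k ρ} env → Counter k ρ → Holds reachedForm env ρ ⇔ k ≡ l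
  reached-⇔ {k} {ρ} env C = mk⇔
    (λ h → digits-injective (same-digits N (digits k) (digits l) l-small λ j j<N →
      to (digit⇔ j j<N) (to (imp 0) (h 0 (within z≤n)) (from (isConst-⇔ (0 ∷ env) ρ 0 0F (within z≤n)) refl) j j<N)))
    (λ k≡l z z<N → from (imp z) λ z≡0 j j<N → digit₀ k≡l j j<N (to (isConst-⇔ (z ∷ env) ρ 0 0F z<N) z≡0))
    where
    open Counter C
    imp : ∀ z → Holds (isConst 0 0F ⇒ᶠ all sameDigit) (z ∷ env) ρ ⇔
          (Holds (isConst 0 0F) (z ∷ env) ρ → Holds (all sameDigit) (z ∷ env) ρ)
    imp z = ⇒ᶠ-⇔ (z ∷ env) ρ (isConst 0 0F) (all sameDigit)
    row₀ : ∀ {B j} {P : Set} → B ≢ ONE′ → B ≢ ZER′ → B ≢ TMP → T (ρ₀ B 0 j) ⇔ P → T (ρ B 0 j) ⇔ P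
    row₀ {j = j} {P} n₁ n₂ n₃ = subst (λ f → T (f 0 j) ⇔ P) (sym (framed n₁ n₂ n₃))
    digit⇔ : ∀ j → j < N → Holds sameDigit (j ∷ 0 ∷ env) ρ ⇔
      ((digits k at j ≡ just true ⇔ digits l at j ≡ just true) ×
        (digits k at j ≡ just false ⇔ digits l at j ≡ just false))
    digit⇔ j j<N =
      ⇔-trans (iff-⇔ (j ∷ 0 ∷ env) ρ (rel ONE′ 0F 0F) (rel ONE 1F 0F))
        (⇔-cong (oneDigits {b = j} j<N) (row₀ {ONE} (λ ()) (λ ()) (λ ()) (l-one j<N))) ×-⇔
      ⇔-trans (iff-⇔ (j ∷ 0 ∷ env) ρ (rel ZER′ 0F 0F) (rel ZERO 1F 0F))
        (⇔-cong (zeroDigits {b = j} j<N) (row₀ {ZERO} (λ ()) (λ ()) (λ ()) (l-zero j<N)))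
    digit₀ : ∀ {z} → k ≡ l → ∀ j → j < N → z ≡ 0 → Holds sameDigit (j ∷ z ∷ env) ρ
    digit₀ refl j j<N refl = from (digit⇔ j j<N) (⇔-refl , ⇔-refl)

  size : ℕ → ℕ → ℕ
  size a b = countBelow N (λ x → ρ₀ WCA a x ∧ ρ₀ WCA b x)

  -- The output serves as a flag: letters are only ever added, so once nonempty it stays so, and the
  -- outcomes of successive rounds combine by disjunction.
  record Outcome (before : List Letter) (A : Set) (s : Store) : Set where
    field
      framed  : Framed (proj₁ s)
      emitted : proj₂ s ≢ [] ⇔ (before ≢ [] ⊎ A)

  Outcome-⇔ : ∀ {o A B s} → A ⇔ B → Outcome o A s → Outcome o B s
  Outcome-⇔ e O = record { framed = Outcome.framed O ; emitted = ⇔-trans (Outcome.emitted O) (⇔-refl ⊎-⇔ e) }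

  module _ (a b : ℕ) where

    member : ℕ → Bool
    member x = ρ₀ WCA a x ∧ ρ₀ WCA b x

    record Counting (o : List Letter) (k : ℕ) (s : Store) : Set where
      field
        counter : Counter k (proj₁ s)
        emitted : proj₂ s ≢ [] ⇔ (o ≢ [] ⊎ l ≤ k)

    count-step : ∀ {o v s} → Counting o (countBelow v member) s →
                 Counting o (countBelow (suc v) member) (exec countRound (v ∷ b ∷ a ∷ []) s)
    count-step {o} {v} {s} C =
        go (evalF (inBoth 2F 1F 0F) env (proj₁ s)) (holds-reflects (inBoth 2F 1F 0F) env (proj₁ s))
      where
      open Counting C
      env : Vec ℕ 3
      env = v ∷ b ∷ a ∷ []
      k : ℕ
      k = countBelow v member
      member⇔ : (T (proj₁ s WCA a v) × T (proj₁ s WCA b v)) ⇔ T (member v)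
      member⇔ = subst (λ f → (T (f a v) × T (f b v)) ⇔ T (member v))
        (sym (Counter.framed counter (λ ()) (λ ()) (λ ()))) (⇔-sym T-∧)
      s₁ : Store
      s₁ = exec countUp env s
      C₁ : Counter (suc k) (proj₁ s₁)
      C₁ = countUp-correct {s = s} env counter
      decide : ∀ {c} → Reflects (Holds reachedForm env (proj₁ s₁)) c →
               Counting o (suc k) (if c then exec (emit (bit true)) env s₁ else s₁)
      decide (ofʸ h)  = record { counter = C₁ ; emitted =
          mk⇔ (λ _ → inj₂ (≤-reflexive (sym (to (reached-⇔ env C₁) h)))) (λ _ ()) }
      decide (ofⁿ ¬h) = record { counter = C₁ ; emitted =
          ⇔-trans emitted (⇔-refl ⊎-⇔ mk⇔ m≤n⇒m≤1+n (λ l≤ → notYet (m≤n⇒m<n∨m≡n l≤))) }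
        where
        notYet : l < suc k ⊎ l ≡ suc k → l ≤ k
        notYet (inj₁ (s≤s lt)) = lt
        notYet (inj₂ l≡)       = contradiction (from (reached-⇔ env C₁) (sym l≡)) ¬h
      grown : T (member v) → Counting o (suc k) (exec (when reachedForm (emit (bit true))) env s₁) →
              Counting o (countBelow (suc v) member) (exec (when reachedForm (emit (bit true))) env s₁)
      grown m with member v
      ... | true = id
      kept : ¬ T (member v) → Counting o (countBelow (suc v) member) s
      kept ¬m with member v
      ... | true  = contradiction tt ¬m
      ... | false = C
      go : ∀ c → Reflects (Holds (inBoth 2F 1F 0F) env (proj₁ s)) c →
           Counting o (countBelow (suc v) member)
               (if c then exec (countUp ▹ when reachedForm (emit (bit true))) env s else s)
      go true  (ofʸ h)  = grown (to member⇔ h) (decide (holds-reflects reachedForm env (proj₁ s₁)))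
      go false (ofⁿ ¬h) = kept (λ m → ¬h (from member⇔ m))

    countCommon-correct : ∀ {s} → Framed (proj₁ s) →
        Outcome (proj₂ s) (l ≤ size a b) (exec countCommon (b ∷ a ∷ []) s)
    countCommon-correct {s} framed = record
      { framed = Counter.framed (Counting.counter counted) ; emitted = Counting.emitted counted }
      where
      never : ∀ {j c} env ρ {d} → T (evalF neverForm (c ∷ j ∷ env) ρ) ⇔ digits 0 at j ≡ just d
      never {j} {c} env ρ {d} = ⇔-trans (evalF⇔Holds neverForm (c ∷ j ∷ env) ρ)
          (mk⇔ (λ lt → contradiction refl (<⇒≢ lt))
        (λ e → contradiction (trans (sym e) (at-[] j)) λ ()))
      counted : Counting (proj₂ s) (size a b) (exec countCommon (b ∷ a ∷ []) s)
      counted = loop-invariant (λ v → Counting (proj₂ s) (countBelow v member)) N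
          (λ {v} _ → count-step {v = v}) record
        { counter = record
          { framed = λ B≢O B≢Z B≢T →
            trans (define-other (proj₁ (exec (define ONE′ neverForm) (b ∷ a ∷ []) s)) ZER′ _ B≢Z)
              (trans (define-other (proj₁ s) ONE′ _ B≢O) (framed B≢O B≢Z B≢T))
          ; oneDigits = λ {j} {c} _ → never {j} {c} (b ∷ a ∷ []) (proj₁ s)
          ; zeroDigits = λ {j} {c} _ →
            never {j} {c} (b ∷ a ∷ []) (proj₁ (exec (define ONE′ neverForm) (b ∷ a ∷ []) s)) }
        -- The counter is compared with l only after an increment, never at 0. Positivity of l makes
        -- this correct.
        ; emitted = mk⇔ inj₁ (λ { (inj₁ h) → h ; (inj₂ l≤0) → contradiction l≤0 (<⇒≱ l>0) })
        }

  Large : ℕ → ℕ → Set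
  Large a b = T (ρ₀ GEN a b) × l ≤ size a b

  ∃-below-suc : ∀ {P : ℕ → Set} {v} → ((∃[ x ] (x < v × P x)) ⊎ P v) ⇔ (∃[ x ] (x < suc v × P x))
  ∃-below-suc {P} {v} = mk⇔
    (λ { (inj₁ (x , x<v , p)) → x , m<n⇒m<1+n x<v , p ; (inj₂ p) → v , ≤-refl , p })
    (λ (x , x< , p) → split x p (m<1+n⇒m<n∨m≡n x<))
    where
    split : ∀ x → P x → x < v ⊎ x ≡ v → (∃[ x ] (x < v × P x)) ⊎ P v
    split x p (inj₁ x<v)  = inj₁ (x , x<v , p)
    split x p (inj₂ refl) = inj₂ p

  outcome-for : ∀ {d} (P : Prog (suc d)) (env : Vec ℕ d) (A : ℕ → Set) →
    (∀ v {s} → Framed (proj₁ s) → Outcome (proj₂ s) (A v) (exec P (v ∷ env) s)) →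
    ∀ {s} → Framed (proj₁ s) → Outcome (proj₂ s) (∃[ v ] (v < N × A v)) (exec (for P) env s)
  outcome-for P env A body {s} framed = loop-invariant (λ v → Outcome (proj₂ s) (∃[ x ] (x < v × A x))) N
    (λ {v} {s′} _ O → let O′ = body v {s′} (Outcome.framed O) in Outcome-⇔ ∃-below-suc record
      { framed = Outcome.framed O′
      ; emitted = ⇔-trans (Outcome.emitted O′) (⇔-trans (Outcome.emitted O ⊎-⇔ ⇔-refl) (mk⇔ Sum.assocʳ Sum.assocˡ)) })
    record { framed = framed ; emitted = mk⇔ inj₁ (λ { (inj₁ h) → h ; (inj₂ (_ , () , _)) }) }

  counting-correct : ∀ {s} → Framed (proj₁ s) →
    Outcome (proj₂ s) (∃[ a ] (a < N × ∃[ b ] (b < N × Large a b))) (exec counting [] s)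
  counting-correct = outcome-for (for (when (rel GEN 1F 0F) countCommon)) [] (λ a → ∃[ b ] (b < N × Large a b)) λ a →
    outcome-for (when (rel GEN 1F 0F) countCommon) (a ∷ []) (Large a) λ b {s} → generated a b s
    where
    generated : ∀ a b s → Framed (proj₁ s) →
        Outcome (proj₂ s) (Large a b) (exec (when (rel GEN 1F 0F) countCommon) (b ∷ a ∷ []) s)
    generated a b s framed = go (proj₁ s GEN a b) refl
      where
      gen≡ : proj₁ s GEN a b ≡ ρ₀ GEN a b
      gen≡ = cong (λ f → f a b) (framed (λ ()) (λ ()) (λ ()))
      go : ∀ c → proj₁ s GEN a b ≡ c →
          Outcome (proj₂ s) (Large a b) (if c then exec countCommon (b ∷ a ∷ []) s else s)
      go true eq = Outcome-⇔ (mk⇔ (λ l≤ → subst T (trans (sym eq) gen≡) tt , l≤) proj₂)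
          (countCommon-correct a b {s} framed)
      go false eq = record { framed = framed ; emitted = mk⇔ inj₁
        (λ { (inj₁ h) → h ; (inj₂ (g , _)) → contradiction (subst T (trans (sym gen≡) eq) g) id }) }

-- Recognition of the words that encode instances.

tailForm parityForm boundForm colorsForm huesForm paletteForm widthForm symmetryForm irreflexivityForm
    rowsForm wellFormed : Form 0
tailForm          = ex (isConst 0 0F ∧ᶠ rel COL 0F 0F)
parityForm        = ex (ex (double 1 1F 0F ∧ᶠ rel ROW 0F 0F))
boundForm         = all (isConst 0 0F ⇒ᶠ neg (rel END 0F 0F))
colorsForm        = all (isConst 1 0F ⇒ᶠ all (neg (rel ZERO 1F 0F)))
huesForm          = all (all (double 1 1F 0F ⇒ᶠ all (neg (rel ZERO 1F 0F))))
paletteForm       = all (all (rel HUE 1F 0F ⇒ᶠ ex (less (1F ∷ []) 0F ∧ᶠ rel CLR 0F 0F)))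
widthForm         = all (all (double 2 1F 0F ⇒ᶠ all (rel END 1F 0F ⇒ᶠ ex (double 1 1F 0F ∧ᶠ rel ROW 0F 0F))))
symmetryForm      = all (all (rel ADJ 1F 0F ⇒ᶠ rel ADJ 0F 1F))
irreflexivityForm = all (neg (rel ADJ 0F 0F))
rowsForm          = parityForm ∧ᶠ boundForm ∧ᶠ colorsForm ∧ᶠ huesForm ∧ᶠ paletteForm ∧ᶠ widthForm ∧ᶠ
    symmetryForm ∧ᶠ irreflexivityForm
wellFormed        = tailForm ∧ᶠ rowsForm

-- Row 0 is the size bound, row 1 the number of colors, and rows 2 + 2 v and
-- 3 + 2 v are the color and the neighbors of vertex v.
module _ (rs : List (List Bool)) where

  InRange : ℕ → Set
  InRange v = suc (1 + (v + v)) < length rs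

  Entry : ℕ → ℕ → Set
  Entry u v = InRange u × InRange v × ∃[ s ] (rs at suc (suc (1 + (u + u))) ≡ just s × s at v ≡ just true)

  record WellFormed : Set where
    constructor wellFormedRows
    field
      evenness    : ∃[ n ] (length rs ≡ suc (1 + (n + n)))
      -- In bijective base 2 every string of digits denotes exactly one number, and only the empty
      -- string denotes 0. So this is positivity of l, and leading digits raise no further
      -- condition.
      bound       : ∀ s → rs at 0 ≡ just s → length s ≢ 0
      colors      : ∀ s t → rs at 1 ≡ just s → s at t ≢ just false
      hues        : ∀ v s t → rs at suc (1 + (v + v)) ≡ just s → s at t ≢ just false
      palette     : ∀ v s s₁ → rs at suc (1 + (v + v)) ≡ just s → rs at 1 ≡ just s₁ → length s < length s₁
      -- An adjacency row must have as many entries as there are vertices. The order is only given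
      -- through the row count 2 + 2 n, so the width is tied to that.
      width       : ∀ v s → rs at suc (2 + (v + v)) ≡ just s → length rs ≡ suc (1 + (length s + length s))
      symmetry    : ∀ u v → Entry u v → Entry v u
      irreflexive : ∀ u → ¬ Entry u u

v≤double : ∀ c v → v ≤ suc (c + (v + v))
v≤double c v = ≤-trans (m≤m+n v v) (≤-trans (m≤n+m (v + v) c) (n≤1+n _))

module WellFormedRows (rs : List (List Bool)) (ρ : Tables) (raw : RowStage.RawTables rs 1 ρ) where

  open RowStage rs using (w; row<N; entry<N; module RawTables)
  open Semantics w
  open Meaning {16} w
  open VocabularyMeaning w
  open RawTables raw

  at⇒<N : ∀ {i s} → rs at i ≡ just s → i < N
  at⇒<N {i} eq = row<N (<⇒≤ (at-just⇒< rs {i} eq))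

  parity⇔ : Holds parityForm [] ρ ⇔ (∃[ n ] (length rs ≡ suc (1 + (n + n))))
  parity⇔ = mk⇔
    (λ (n , _ , y , y<N , d , r) → n ,
      trans (sym (to (rows {b = y} y<N) r)) (to (double-⇔ (y ∷ n ∷ []) ρ 1 1F 0F y<N) d))
    (λ (n , eq) → n , row<N (≤-trans (v≤double 1 n) (≤-reflexive (sym eq))) , length rs , row<N ≤-refl ,
       from (double-⇔ (length rs ∷ n ∷ []) ρ 1 1F 0F (row<N ≤-refl)) eq ,
           from (rows {b = length rs} (row<N ≤-refl)) refl)

  bound⇔ : Holds boundForm [] ρ ⇔ (∀ s → rs at 0 ≡ just s → length s ≢ 0)
  bound⇔ = mk⇔
    (λ h s e l≡0 → to (imp 0) (h 0 (at⇒<N {0} e)) (from (isConst-⇔ (0 ∷ []) ρ 0 0F (at⇒<N {0} e)) refl)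
      (from (cells # (at⇒<N {0} e) (at⇒<N {0} e)) (s , e , from (at-map-# s 0) l≡0)))
    (λ h z z<N → from (imp z) λ z≡0 e → refute h (to (isConst-⇔ (z ∷ []) ρ 0 0F z<N) z≡0) (to (cells # z<N z<N) e))
    where
    imp : ∀ z → Holds (isConst 0 0F ⇒ᶠ neg (rel END 0F 0F)) (z ∷ []) ρ ⇔
                (Holds (isConst 0 0F) (z ∷ []) ρ → ¬ T (ρ END z z))
    imp z = ⇒ᶠ-⇔ (z ∷ []) ρ (isConst 0 0F) (neg (rel END 0F 0F))
    refute : ∀ {z} → (∀ s → rs at 0 ≡ just s → length s ≢ 0) → z ≡ 0 →
        ¬ (∃[ s ] (rs at z ≡ just s × encodeRow s at z ≡ just #))
    refute h refl (s , e , e′) = h s e (to (at-map-# s 0) e′)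

  noZero⇔ : ∀ y → y < N → (∀ t → t < N → ¬ T (ρ ZERO y t)) ⇔ (∀ s t → rs at y ≡ just s → s at t ≢ just false)
  noZero⇔ y y<N = mk⇔
    (λ h s t e e′ → h t (entry<N {y} e (<⇒≤ (at-just⇒< s {t} e′)))
      (from (cells (bit false) y<N (entry<N {y} e (<⇒≤ (at-just⇒< s {t} e′)))) (s , e , from (at-map-bit s t) e′)))
    (λ h t t<N z → case to (cells (bit false) y<N t<N) z of λ (s , e , e′) → h s t e (to (at-map-bit s t) e′))

  colors⇔ : Holds colorsForm [] ρ ⇔ (∀ s t → rs at 1 ≡ just s → s at t ≢ just false)
  colors⇔ = mk⇔
    (λ h s t e → to (noZero⇔ 1 (at⇒<N {1} e))
      (to (imp 1) (h 1 (at⇒<N {1} e)) (from (isConst-⇔ (1 ∷ []) ρ 1 0F (at⇒<N {1} e)) refl)) s t e)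
    (λ h z z<N → from (imp z) λ z≡1 → from (noZero⇔ z z<N) (moved (to (isConst-⇔ (z ∷ []) ρ 1 0F z<N) z≡1) h))
    where
    imp : ∀ z → Holds (isConst 1 0F ⇒ᶠ all (neg (rel ZERO 1F 0F))) (z ∷ []) ρ ⇔
                (Holds (isConst 1 0F) (z ∷ []) ρ → ∀ t → t < N → ¬ T (ρ ZERO z t))
    imp z = ⇒ᶠ-⇔ (z ∷ []) ρ (isConst 1 0F) (all (neg (rel ZERO 1F 0F)))
    moved : ∀ {z} → z ≡ 1 → (∀ s t → rs at 1 ≡ just s → s at t ≢ just false) → ∀ s t → rs at z ≡ just s →
        s at t ≢ just false
    moved refl h = h

  hues⇔ : Holds huesForm [] ρ ⇔ (∀ v s t → rs at suc (1 + (v + v)) ≡ just s → s at t ≢ just false)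
  hues⇔ = mk⇔
    (λ h v s t e → to (noZero⇔ _ (at⇒<N {suc (1 + (v + v))} e))
      (to (imp v _) (h v (≤-<-trans (v≤double 1 v) (at⇒<N {suc (1 + (v + v))} e)) _ (at⇒<N {suc (1 + (v + v))} e))
        (from (double-⇔ (suc (1 + (v + v)) ∷ v ∷ []) ρ 1 1F 0F (at⇒<N {suc (1 + (v + v))} e)) refl)) s t e)
    (λ h v v<N y y<N → from (imp v y) λ d →
      from (noZero⇔ y y<N) (moved (to (double-⇔ (y ∷ v ∷ []) ρ 1 1F 0F y<N) d) (h v)))
    where
    imp : ∀ v y → Holds (double 1 1F 0F ⇒ᶠ all (neg (rel ZERO 1F 0F))) (y ∷ v ∷ []) ρ ⇔
                (Holds (double 1 1F 0F) (y ∷ v ∷ []) ρ → ∀ t → t < N → ¬ T (ρ ZERO y t))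
    imp v y = ⇒ᶠ-⇔ (y ∷ v ∷ []) ρ (double 1 1F 0F) (all (neg (rel ZERO 1F 0F)))
    moved : ∀ {y y′} → y ≡ y′ → (∀ s t → rs at y′ ≡ just s → s at t ≢ just false) → ∀ s t → rs at y ≡ just s →
        s at t ≢ just false
    moved refl h = h

  palette⇔ : Holds paletteForm [] ρ ⇔
    (∀ v s s₁ → rs at suc (1 + (v + v)) ≡ just s → rs at 1 ≡ just s₁ → length s < length s₁)
  palette⇔ = mk⇔
    (λ h v s s₁ e e₁ → bounded s₁ e₁ (to (imp v (length s))
      (h v (≤-<-trans (v≤double 1 v) (at⇒<N {suc (1 + (v + v))} e)) (length s) (entry<N {suc (1 + (v + v))} e ≤-refl))
      (from (hue (entry<N {suc (1 + (v + v))} e ≤-refl)) (at-just⇒< rs {suc (1 + (v + v))} e , s , e , refl))))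
    (λ h v v<N i i<N → from (imp v i) λ u → exists {v} h (to (hue {v} i<N) u))
    where
    imp : ∀ v i → Holds (rel HUE 1F 0F ⇒ᶠ ex (less (1F ∷ []) 0F ∧ᶠ rel CLR 0F 0F)) (i ∷ v ∷ []) ρ ⇔
          (T (ρ HUE v i) → ∃[ j ] (j < N × i < j × T (ρ CLR j j)))
    imp v i = ⇒ᶠ-⇔ (i ∷ v ∷ []) ρ (rel HUE 1F 0F) (ex (less (1F ∷ []) 0F ∧ᶠ rel CLR 0F 0F))
    bounded : ∀ {i} s₁ → rs at 1 ≡ just s₁ → ∃[ j ] (j < N × i < j × T (ρ CLR j j)) → i < length s₁
    bounded s₁ e₁ (j , _ , i<j , c) with to clr c
    ... | s , e , j≤ = ≤-trans i<j (≤-trans j≤ (≤-reflexive (cong length (just-injective (trans (sym e) e₁)))))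
    exists : ∀ {v i} → (∀ v s s₁ → rs at suc (1 + (v + v)) ≡ just s → rs at 1 ≡ just s₁ → length s < length s₁) →
             InRange rs v × ∃[ s ] (rs at suc (1 + (v + v)) ≡ just s × length s ≡ i) →
                 ∃[ j ] (j < N × i < j × T (ρ CLR j j))
    exists {v} h (in-range , s , e , refl) with <⇒at-just rs {1} (≤-<-trans (s≤s z≤n) in-range)
    ... | s₁ , e₁ = length s₁ , entry<N {1} e₁ ≤-refl , h v s s₁ e e₁ , from clr (s₁ , e₁ , ≤-refl)

  width⇔ : Holds widthForm [] ρ ⇔
      (∀ v s → rs at suc (2 + (v + v)) ≡ just s → length rs ≡ suc (1 + (length s + length s)))
  width⇔ = mk⇔
    (λ h v s e → counted {suc (2 + (v + v))} {v} (length s) (to (imp₂ _ v (length s))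
      (to (imp v _) (h v (≤-<-trans (v≤double 2 v) (at⇒<N {suc (2 + (v + v))} e)) _ (at⇒<N {suc (2 + (v + v))} e))
        (from (double-⇔ (suc (2 + (v + v)) ∷ v ∷ []) ρ 2 1F 0F (at⇒<N {suc (2 + (v + v))} e)) refl)
        (length s) (entry<N {suc (2 + (v + v))} e ≤-refl))
      (from (cells # (at⇒<N {suc (2 + (v + v))} e) (entry<N {suc (2 + (v + v))} e ≤-refl))
        (s , e , from (at-map-# s _) refl))))
    (λ h v v<N y y<N → from (imp v y) λ d m m<N → from (imp₂ y v m) λ c →
      measured {y} {v} {m} h (to (double-⇔ (y ∷ v ∷ []) ρ 2 1F 0F y<N) d) (to (cells # y<N m<N) c))
    where
    Counted : ℕ → ℕ → ℕ → Set
    Counted y v m = ∃[ q ] (q < N × Holds (double 1 1F 0F) (q ∷ m ∷ y ∷ v ∷ []) ρ × T (ρ ROW q q))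
    imp : ∀ v y → Holds (double 2 1F 0F ⇒ᶠ all (rel END 1F 0F ⇒ᶠ ex (double 1 1F 0F ∧ᶠ rel ROW 0F 0F)))
        (y ∷ v ∷ []) ρ ⇔
          (Holds (double 2 1F 0F) (y ∷ v ∷ []) ρ →
            Holds (all (rel END 1F 0F ⇒ᶠ ex (double 1 1F 0F ∧ᶠ rel ROW 0F 0F))) (y ∷ v ∷ []) ρ)
    imp v y = ⇒ᶠ-⇔ (y ∷ v ∷ []) ρ (double 2 1F 0F) (all (rel END 1F 0F ⇒ᶠ ex (double 1 1F 0F ∧ᶠ rel ROW 0F 0F)))
    imp₂ : ∀ y v m → Holds (rel END 1F 0F ⇒ᶠ ex (double 1 1F 0F ∧ᶠ rel ROW 0F 0F)) (m ∷ y ∷ v ∷ []) ρ ⇔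
           (T (ρ END y m) → Counted y v m)
    imp₂ y v m = ⇒ᶠ-⇔ (m ∷ y ∷ v ∷ []) ρ (rel END 1F 0F) (ex (double 1 1F 0F ∧ᶠ rel ROW 0F 0F))
    counted : ∀ {y v} m → Counted y v m → length rs ≡ suc (1 + (m + m))
    counted {y} {v} m (q , q<N , d , r) =
        trans (sym (to (rows {b = q} q<N) r)) (to (double-⇔ (q ∷ m ∷ y ∷ v ∷ []) ρ 1 1F 0F q<N) d)
    measured : ∀ {y v m} → (∀ v s → rs at suc (2 + (v + v)) ≡ just s → length rs ≡ suc (1 + (length s + length s))) →
               y ≡ suc (2 + (v + v)) → ∃[ s ] (rs at y ≡ just s × encodeRow s at m ≡ just #) → Counted y v m
    measured {v = v} {m} h refl (s , e , e′) with to (at-map-# s m) e′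
    ... | refl = length rs , row<N ≤-refl ,
                 from (double-⇔ (length rs ∷ length s ∷ suc (2 + (v + v)) ∷ v ∷ []) ρ 1 1F 0F (row<N ≤-refl))
                     (h v s e) ,
                 from (rows {b = length rs} (row<N ≤-refl)) refl

  range<N : ∀ {v} → InRange rs v → v < N
  range<N {v} in-range = row<N (≤-trans (v≤double 1 v) (<⇒≤ in-range))

  symmetry⇔ : Holds symmetryForm [] ρ ⇔ (∀ u v → Entry rs u v → Entry rs v u)
  symmetry⇔ = mk⇔
    (λ h u v e@(iu , iv , _) →
      to (adj (range<N iu)) (to (imp u v) (h u (range<N iu) v (range<N iv)) (from (adj (range<N iv)) e)))
    (λ h u u<N v v<N → from (imp u v) λ e → from (adj u<N) (h u v (to (adj v<N) e)))
    where
    imp : ∀ u v → Holds (rel ADJ 1F 0F ⇒ᶠ rel ADJ 0F 1F) (v ∷ u ∷ []) ρ ⇔ (T (ρ ADJ u v) → T (ρ ADJ v u))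
    imp u v = ⇒ᶠ-⇔ (v ∷ u ∷ []) ρ (rel ADJ 1F 0F) (rel ADJ 0F 1F)

  irreflexivity⇔ : Holds irreflexivityForm [] ρ ⇔ (∀ u → ¬ Entry rs u u)
  irreflexivity⇔ = mk⇔
    (λ h u e@(iu , _) → h u (range<N iu) (from (adj (range<N iu)) e))
    (λ h u u<N e → h u (to (adj u<N) e))

  wellFormed⇔ : Holds rowsForm [] ρ ⇔ WellFormed rs
  wellFormed⇔ = mk⇔
    (λ (a , b , c , d , e , f , g , h) → wellFormedRows (to parity⇔ a) (to bound⇔ b) (to colors⇔ c) (to hues⇔ d)
      (to palette⇔ e) (to width⇔ f) (to symmetry⇔ g) (to irreflexivity⇔ h))
    (λ (wellFormedRows a b c d e f g h) → from parity⇔ a , from bound⇔ b , from colors⇔ c , from hues⇔ d ,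
      from palette⇔ e , from width⇔ f , from symmetry⇔ g , from irreflexivity⇔ h)

digits-bound : ∀ {l} → 0 < l → length (digits l) ≢ 0
digits-bound {l} l>0 len = <⇒≢ l>0 (digits-injective {0} {l} (sym (length≡0⇒[] len)))

instanceRows : Instance → List (List Bool)
instanceRows x = digits l ∷ GraphRows.graphRows coloredGraph
  where open Instance x

encodeInstance-rows : ∀ x → encodeInstance x ≡ encodeRows (instanceRows x)
encodeInstance-rows x = trans
  (cong₂ (λ u v → u ++ # ∷ v) (sym (map-bit-digitsᵇ (Bin.fromℕ l))) (GraphRows.encodeColoredGraph-rows coloredGraph))
  (sym (List.++-assoc (map bit (digits l)) [ # ] _))
  where open Instance x

instance-wellFormed : ∀ x → WellFormed (instanceRows x)
instance-wellFormed x = wellFormedRows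
  (order , length-rs)
  (λ { s refl → digits-bound l-positive })
  (λ s t e → colors′ (just-injective (trans (sym at-colors) e)) t)
  (λ v s t e → case vertexAt 1 v (at-just⇒< rows {suc (1 + (v + v))} e) of λ { (u , refl) →
     hues′ (just-injective (trans (sym (at-hue u)) e)) t })
  (λ v s s₁ e e₁ → case vertexAt 1 v (at-just⇒< rows {suc (1 + (v + v))} e) of λ { (u , refl) →
     subst₂ (λ s s₁ → length s < length s₁) (just-injective (trans (sym (at-hue u)) e))
         (just-injective (trans (sym at-colors) e₁))
       (subst₂ _<_ (sym (List.length-replicate (toℕ (color u)))) (sym (List.length-replicate numColors))
         (Fin.toℕ<n (color u))) })
  (λ v s e → case vertexAt 1 v (<-trans (n<1+n _) (at-just⇒< rows {suc (2 + (v + v))} e)) of λ { (u , refl) →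
     trans length-rs (cong (λ m → suc (1 + (m + m))) (trans (sym (length-adjacencyRow u))
       (cong length (just-injective (trans (sym (at-adjacency u)) e))))) })
  (λ u v (iu , iv , s , e , e′) → iv , iu , symmetric′ u v iu iv s e e′)
  (λ u (iu , _ , s , e , e′) → irreflexive′ u iu s e e′)
  where
  open Instance x
  open GraphRows coloredGraph
  open GraphStage coloredGraph (digits l ∷ [])
  rows : List (List Bool)
  rows = instanceRows x
  colors′ : ∀ {s} → replicate numColors true ≡ s → ∀ t → s at t ≢ just false
  colors′ refl t = at-replicate-true numColors t
  hues′ : ∀ {u s} → hueRow u ≡ s → ∀ t → s at t ≢ just false
  hues′ {u} refl t = at-replicate-true (toℕ (color u)) t
  vertexAt : ∀ (c : ℕ) v → InRange rows v → ∃[ u ] (toℕ u ≡ v)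
  vertexAt _ v in-range = fromℕ< (to vertex-row in-range) , Fin.toℕ-fromℕ< (to vertex-row in-range)
  entry : ∀ u v s → rows at suc (suc (1 + (toℕ u + toℕ u))) ≡ just s → s at toℕ v ≡ just true → adjacent u v ≡ true
  entry u v s e e′ = just-injective (trans (sym (at-tabulate (adjacent u) v))
    (trans (cong (_at toℕ v) (just-injective (trans (sym (at-adjacency u)) e))) e′))
  symmetric′ : ∀ u v → InRange rows u → InRange rows v → ∀ s → rows at suc (suc (1 + (u + u))) ≡ just s →
      s at v ≡ just true →
               ∃[ s ] (rows at suc (suc (1 + (v + v))) ≡ just s × s at u ≡ just true)
  symmetric′ u v iu iv s e e′ with vertexAt 1 u iu | vertexAt 1 v iv
  ... | u′ , refl | v′ , refl = _ , at-adjacency v′ , trans (at-tabulate (adjacent v′) u′)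
    (cong just (trans (symmetric v′ u′) (entry u′ v′ s e e′)))
  irreflexive′ : ∀ u → InRange rows u → ∀ s → rows at suc (suc (1 + (u + u))) ≡ just s → s at u ≡ just true → ⊥
  irreflexive′ u iu s e e′ with vertexAt 1 u iu
  ... | u′ , refl = contradiction (trans (sym (entry u′ u′ s e e′)) (irreflexive u′)) λ ()

module FromRows {n} (r₀ r₁ : List Bool) (f g : Fin n → List Bool)
  (wf : WellFormed (r₀ ∷ r₁ ∷ pairs f g)) where

  open WellFormed wf

  private
    rs : List (List Bool)
    rs = r₀ ∷ r₁ ∷ pairs f g

  length-rows′ : length rs ≡ suc (1 + (n + n))
  length-rows′ = cong (λ m → suc (suc m)) (length-pairs f g)

  in-range : ∀ (v : Fin n) → InRange rs (toℕ v)
  in-range v = subst (suc (1 + (toℕ v + toℕ v)) <_) (sym length-rows′)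
    (s≤s (s≤s (+-mono-< (Fin.toℕ<n v) (Fin.toℕ<n v))))

  length-g : ∀ v → length (g v) ≡ n
  length-g v = half (suc-injective
      (suc-injective (trans (sym (width (toℕ v) (g v) (pairs-at-odd f g v))) length-rows′)))
    where
    half : ∀ {a b} → a + a ≡ b + b → a ≡ b
    half {a} {b} eq with <-cmp a b
    ... | tri< a<b _ _ = contradiction eq (<⇒≢ (+-mono-< a<b a<b))
    ... | tri≈ _ a≡b _ = a≡b
    ... | tri> _ _ b<a = contradiction (sym eq) (<⇒≢ (+-mono-< b<a b<a))

  -- By `length-g` all adjacency rows have length n, so the default is met only outside of the
  -- vertices.
  entryOf : List Bool → ℕ → Bool
  entryOf s i = maybe id false (s at i)

  entryOf-true : ∀ s i → T (entryOf s i) ⇔ s at i ≡ just true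
  entryOf-true s i with s at i
  ... | just true  = mk⇔ (λ _ → refl) (λ _ → tt)
  ... | just false = mk⇔ (λ ()) (λ ())
  ... | nothing    = mk⇔ (λ ()) (λ ())

  tabulate-entryOf : ∀ {m} s → length s ≡ m → List.tabulate {n = m} (λ i → entryOf s (toℕ i)) ≡ s
  tabulate-entryOf {zero}  []      _   = refl
  tabulate-entryOf {suc m} (b ∷ s) len = cong (b ∷_) (tabulate-entryOf s (suc-injective len))

  hue< : ∀ v → length (f v) < length r₁
  hue< v = palette (toℕ v) (f v) r₁ (pairs-at-even f g v) refl

  adj : Fin n → Fin n → Bool
  adj u v = entryOf (g u) (toℕ v)

  adj⇔Entry : ∀ u v → T (adj u v) ⇔ Entry rs (toℕ u) (toℕ v)
  adj⇔Entry u v = ⇔-trans (entryOf-true (g u) (toℕ v)) (mk⇔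
    (λ e → in-range u , in-range v , g u , pairs-at-odd f g u , e)
    (λ (_ , _ , s , e , e′) → trans (cong (_at toℕ v) (just-injective (trans (sym (pairs-at-odd f g u)) e))) e′))

  decodedGraph : ColoredGraph
  decodedGraph = record
    { graph = record
      { order = n
      ; adjacent = adj
      ; symmetric = λ u v → T-injective (mk⇔ (flipped u v) (flipped v u))
      ; irreflexive = λ v → ¬T⇒false (λ e → WellFormed.irreflexive wf (toℕ v) (to (adj⇔Entry v v) e))
      }
    ; numColors = length r₁
    ; color = λ v → fromℕ< (hue< v)
    }
    where
    flipped : ∀ u v → T (adj u v) → T (adj v u)
    flipped u v e = from (adj⇔Entry v u) (symmetry (toℕ u) (toℕ v) (to (adj⇔Entry u v) e))
    ¬T⇒false : ∀ {p} → ¬ T p → p ≡ false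
    ¬T⇒false {true}  ¬p = contradiction tt ¬p
    ¬T⇒false {false} _  = refl

  decoded : Instance
  decoded = record { coloredGraph = decodedGraph ; l = Bin.toℕ (fromDigits r₀) ; l-positive =
      positive r₀ (WellFormed.bound wf r₀ refl) }
    where
    positive : ∀ s → length s ≢ 0 → 0 < Bin.toℕ (fromDigits s)
    positive []          ≢0 = contradiction refl ≢0
    positive (false ∷ s) _  = z<s
    positive (true ∷ s)  _  = z<s

  decoded-rows : instanceRows decoded ≡ rs
  decoded-rows = cong₂ _∷_ (trans (cong digitsᵇ (Bin.fromℕ-toℕ (fromDigits r₀))) (digitsᵇ-fromDigits r₀))
    (cong₂ _∷_ (sym (replicate-true r₁ (λ t → colors r₁ t refl))) (pairs-cong
      (λ v → trans (cong (λ m → replicate m true) (Fin.toℕ-fromℕ< (hue< v)))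
               (sym (replicate-true (f v) (λ t → hues (toℕ v) (f v) t (pairs-at-even f g v)))))
      (λ v → tabulate-entryOf (g v) (length-g v))))

-- The completeness of the validity conditions: rows that satisfy them can be decoded. It is what
-- allows every other word to be rejected.
wellFormed-instance : ∀ rs → WellFormed rs → ∃[ x ] (instanceRows x ≡ rs)
wellFormed-instance rs wf with WellFormed.evenness wf
... | n , eq = go rs wf eq
  where
  go : ∀ rs → WellFormed rs → length rs ≡ suc (1 + (n + n)) → ∃[ x ] (instanceRows x ≡ rs)
  go (r₀ ∷ r₁ ∷ rest) wf eq with toPairs n rest (suc-injective (suc-injective eq))
  ... | f , g , refl = FromRows.decoded r₀ r₁ f g wf , FromRows.decoded-rows r₀ r₁ f g wf

-- The decision procedure on instances and on arbitrary words.

reading₁ deciding : Prog 0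
reading₁ = parse ▹ GraphForms.graphTables 1
deciding = reading₁ ▹ when wellFormed (generators ▹ counting)

module DecisionCorrectness (x : Instance) where

  open Instance x
  open WeakConnectivity coloredGraph
  open Reading coloredGraph (digits l ∷ []) public
  open RowStage (instanceRows x) using (w; entry<N; module RawTables)
  open Semantics w
  open Meaning {16} w
  open VocabularyMeaning w
  open ComponentTables generated-tables
  open Components (λ u v → proj₁ generated WCA (toℕ u) (toℕ v)) wca

  read-wellFormed : Holds wellFormed [] (proj₁ read)
  read-wellFormed = (0 , within z≤n , from (isConst-⇔ (0 ∷ []) (proj₁ read) 0 0F (within z≤n)) refl ,
      from (read-col {0} {0} (within z≤n)) refl) ,
    from (WellFormedRows.wellFormed⇔ (instanceRows x) (proj₁ read) read-raw) (instance-wellFormed x)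

  row-zero : ∀ (c : Bool) {j} → j < N → T (proj₁ generated (tableOf (bit c)) 0 j) ⇔ digits l at j ≡ just c
  row-zero c {j} j<N = ⇔-trans (unchanged c) (⇔-trans (RawTables.cells read-raw (bit c) (within z≤n) j<N) (mk⇔
    (λ { (s , refl , e) → to (at-map-bit s j) e })
    (λ e → digits l , refl , from (at-map-bit (digits l) j) e)))
    where
    unchanged : ∀ c → T (proj₁ generated (tableOf (bit c)) 0 j) ⇔ T (proj₁ read (tableOf (bit c)) 0 j)
    unchanged true  = subst (λ f → T (f 0 j) ⇔ T (proj₁ read ONE 0 j))
        (sym (generated-others {ONE} (λ ()) (λ ()) (λ ()))) ⇔-refl
    unchanged false = subst (λ f → T (f 0 j) ⇔ T (proj₁ read ZERO 0 j))
        (sym (generated-others {ZERO} (λ ()) (λ ()) (λ ()))) ⇔-refl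

  open CountingStage w (proj₁ generated) l l-positive (entry<N {0} refl ≤-refl) (row-zero true) (row-zero false)

  size-common : ∀ u v → size (toℕ u) (toℕ v) ≡ ∣ common u v ∣
  size-common u v = countBelow-tabulate N _ (<⇒≤ order<) λ y n≤y → outside y n≤y
    where
    outside : ∀ y → order ≤ y → (proj₁ generated WCA (toℕ u) y ∧ proj₁ generated WCA (toℕ v) y) ≡ false
    outside y n≤y with proj₁ generated WCA (toℕ u) y in eq
    ... | false = refl
    ... | true  = contradiction (proj₂ (wca-vertices {toℕ u} {y} (subst T (sym eq) tt))) (≤⇒≯ n≤y)

  large⇔ : (∃[ a ] (a < N × ∃[ b ] (b < N × Large a b))) ⇔ HasLargeComponent x
  large⇔ = mk⇔ found complete
    where
    found : (∃[ a ] (a < N × ∃[ b ] (b < N × Large a b))) → HasLargeComponent x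
    found (a , _ , b , _ , g , l≤) with gen-vertices g
    ... | a< , b< = at-vertices (fromℕ< a<) (fromℕ< b<) (Fin.toℕ-fromℕ< a<) (Fin.toℕ-fromℕ< b<) g l≤
      where
      at-vertices : ∀ u v {a b} → toℕ u ≡ a → toℕ v ≡ b → T (proj₁ generated GEN a b) → l ≤ size a b →
          HasLargeComponent x
      at-vertices u v refl refl g l≤ = common u v , common-component (to gen g) ,
          ≤-trans l≤ (≤-reflexive (size-common u v))
    vertex : ∀ {n} (S : Vec Bool n) → 0 < ∣ S ∣ → Fin n
    vertex (b ∷ S) _ = zero
    complete : HasLargeComponent x → ∃[ a ] (a < N × ∃[ b ] (b < N × Large a b))
    -- A component of at least l > 0 vertices supplies the vertex that `component-common` asks for,
    -- so the graph without vertices needs no separate case here.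
    complete (S , S-component , l≤) with component-common (vertex S (<-≤-trans l-positive l≤)) S-component
    ... | u , v , g , eq = toℕ u , <-trans (Fin.toℕ<n u) order< , toℕ v , <-trans (Fin.toℕ<n v) order< , from gen g ,
            ≤-trans l≤ (≤-reflexive (trans (cong ∣_∣ eq) (sym (size-common u v))))

  answered : proj₂ (exec counting [] generated) ≢ [] ⇔ HasLargeComponent x
  answered = ⇔-trans (Outcome.emitted (counting-correct {generated} (λ _ _ _ → refl)))
    (⇔-trans (mk⇔ (λ { (inj₁ h) → contradiction generated-silent h ; (inj₂ h) → h }) inj₂) large⇔)

ʳ++-nonempty : ∀ (o : List Letter) → o ʳ++ [] ≢ [] ⇔ o ≢ []
ʳ++-nonempty []      = ⇔-refl
ʳ++-nonempty (c ∷ o) = mk⇔ (λ _ ()) λ _ eq →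
    contradiction (trans (sym (List.length-reverse (c ∷ o))) (cong length eq)) λ ()

result-when : ∀ (P Q : Prog 0) φ w {s} → let open Semantics w in
  s ≡ exec P [] initialStore → proj₂ s ≡ [] → result (P ▹ when φ Q) w ≢ [] → T (evalF φ [] (proj₁ s))
result-when P Q φ w {s} refl silent ≢[] = holds (λ e → ≢[] (trans (result-def (P ▹ when φ Q) w) e))
  where
  open Semantics w
  holds : proj₂ (if evalF φ [] (proj₁ s) then exec Q [] s else s) ʳ++ [] ≢ [] → T (evalF φ [] (proj₁ s))
  holds h with evalF φ [] (proj₁ s)
  ... | true  = tt
  ... | false = contradiction (cong (_ʳ++ []) silent) h

result-when-▹ : ∀ (P Q R : Prog 0) φ w {s₁ s₂} → let open Semantics w in
  s₁ ≡ exec P [] initialStore → s₂ ≡ exec Q [] s₁ → T (evalF φ [] (proj₁ s₁)) →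
  result (P ▹ when φ (Q ▹ R)) w ≡ proj₂ (exec R [] s₂) ʳ++ []
result-when-▹ P Q R φ w {s₁} refl refl h =
    trans (result-def (P ▹ when φ (Q ▹ R)) w) (cong (λ s → proj₂ s ʳ++ []) (taken h))
  where
  open Semantics w
  taken : T (evalF φ [] (proj₁ s₁)) →
      (if evalF φ [] (proj₁ s₁) then exec R [] (exec Q [] s₁) else s₁) ≡ exec R [] (exec Q [] s₁)
  taken h with evalF φ [] (proj₁ s₁)
  ... | true = refl

decides-instance : ∀ x → result deciding (encodeInstance x) ≢ [] ⇔ HasLargeComponent x
decides-instance x = subst (λ u → result deciding u ≢ [] ⇔ HasLargeComponent x) (sym (encodeInstance-rows x))
  (subst (λ o → o ≢ [] ⇔ HasLargeComponent x)
    (sym (result-when-▹ reading₁ generators counting wellFormed w read-def generated-def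
      (from (evalF⇔Holds wellFormed [] (proj₁ read)) read-wellFormed)))
    (⇔-trans (ʳ++-nonempty (proj₂ (exec counting [] generated))) answered))
  where
  w : List Letter
  w = encodeRows (instanceRows x)
  open DecisionCorrectness x using (read; read-def; generated; generated-def; read-wellFormed; answered)
  open Semantics w
  open Meaning {16} w

opaque

  scanned : List Letter → Store
  scanned w = Semantics.exec w reading₁ [] initialStore

  scanned-def : ∀ w → scanned w ≡ Semantics.exec w reading₁ [] initialStore
  scanned-def w = refl

  scanned-silent : ∀ w → proj₂ (scanned w) ≡ []
  scanned-silent w = Parsing.Parsed.silent (Parsing.parse-correct w)

  scanned-col : ∀ w rs t → w ≡ encodeRows rs ++ map bit t → ∀ {a b} → a < Semantics.N w →
                T (proj₁ (scanned w) COL a b) ⇔ a ≡ length t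
  scanned-col w rs t eq {a} {b} a<N = subst (λ m → T (proj₁ (scanned w) COL a b) ⇔ a ≡ m)
    (cong proj₂ (trans (Parsing.Parsed.end (Parsing.parse-correct w))
      (trans (cong (λ u → endPosition u 0 0) eq) (endPosition-rows rs t 0))))
    (Parsing.Parsed.col (Parsing.parse-correct w) a<N)

  scanned-raw : ∀ rs → RowStage.RawTables rs 1 (proj₁ (scanned (encodeRows rs)))
  scanned-raw rs = rawTables 1 {Semantics.exec w parse [] initialStore} (rowTable (Parsing.parse-correct w))
      (cellTables (Parsing.parse-correct w))
    where open RowStage rs

tail-empty : ∀ w rs t → w ≡ encodeRows rs ++ map bit t → Meaning.Holds w tailForm [] (proj₁ (scanned w)) → t ≡ []
tail-empty w rs t eq (z , z<N , is-0 , c) = length≡0⇒[] (trans (sym (to (scanned-col w rs t eq {z} {z} z<N) c))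
  (to (VocabularyMeaning.isConst-⇔ w (z ∷ []) (proj₁ (scanned w)) 0 0F z<N) is-0))

accepted-wellFormed : ∀ w → result deciding w ≢ [] → Meaning.Holds w wellFormed [] (proj₁ (scanned w))
accepted-wellFormed w accepted = to (Meaning.evalF⇔Holds w wellFormed [] (proj₁ (scanned w)))
  (result-when reading₁ (generators ▹ counting) wellFormed w (scanned-def w) (scanned-silent w) accepted)

accepted-rows : ∀ {w} rs → w ≡ encodeRows rs → Meaning.Holds w rowsForm [] (proj₁ (scanned w)) →
    ∃[ x ] (encodeInstance x ≡ w)
accepted-rows rs refl h = Product.map₂ (λ {x} eq → trans (encodeInstance-rows x) (cong encodeRows eq))
  (wellFormed-instance rs (to (WellFormedRows.wellFormed⇔ rs (proj₁ (scanned (encodeRows rs))) (scanned-raw rs)) h))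

-- Letters are emitted only if `wellFormed` holds. Its first conjunct places the reader at column 0
-- at the end, so there is no unclosed tail; the other conjuncts make the rows decodable.
accepted-instance : ∀ w → result deciding w ≢ [] → ∃[ x ] (encodeInstance x ≡ w)
accepted-instance w accepted = decode (splitRows w) (accepted-wellFormed w accepted)
  where
  decode : (∃₂ λ rs t → w ≡ encodeRows rs ++ map bit t) → Meaning.Holds w wellFormed [] (proj₁ (scanned w)) →
      ∃[ x ] (encodeInstance x ≡ w)
  decode (rs , t , eq) (h , h′) = accepted-rows rs (trans eq
    (trans (cong (λ t → encodeRows rs ++ map bit t) (tail-empty w rs t eq h)) (List.++-identityʳ (encodeRows rs)))) h′

decides : ∀ w → result deciding w ≢ [] ⇔ WeaklyColorAvoidingConnectedComponent w
decides w = mk⇔ sound complete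
  where
  sound : result deciding w ≢ [] → WeaklyColorAvoidingConnectedComponent w
  sound accepted = located (accepted-instance w accepted) accepted
    where
    located : ∀ {w} → ∃[ x ] (encodeInstance x ≡ w) → result deciding w ≢ [] → WeaklyColorAvoidingConnectedComponent w
    located (x , refl) h = x , refl , to (decides-instance x) h
  complete : ∀ {w} → WeaklyColorAvoidingConnectedComponent w → result deciding w ≢ []
  complete (x , refl , h) = from (decides-instance x) h

corollary1 : InP WeaklyColorAvoidingConnectedComponent × ComputableInPolynomialTime encodeColoredGraph ListsComponents
corollary1 = Compiler.decidable 16 deciding WeaklyColorAvoidingConnectedComponent decides , listing-computable
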